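{- Let $G$ be an undirected multigraph without self-loops and without isolated vertices, of maximum degree at most $d$, with $|E(G)| = m$. Then there exists a partition $(A,B)$ of $V(G)$ such that \begin{itemize} \item $\frac{m}{4} - \frac{d}{2} \le |E(G[A])| \le \frac{m}{4} + \frac{d}{2}$, \item $\frac{m}{4} - \frac{d}{2} \le |E(G[B])| \le \frac{m}{4} + \frac{d}{2}$, and \item $\frac{m}{2} - d \le |E(G[A,B])| \le \frac{m}{2} + d$. \end{itemize} Furthermore, there is a polynomial time algorithm that, given $G$, obtains such a partition.
   Context: Graphs are finite. A multigraph may contain more than one edge between the same pair of vertices; edges and degrees are counted with multiplicity. $G[A]$ is the subgraph of $G$ induced by $A$, and $E(G[A,B])$ is the set of edges of $G$ with one endpoint in $A$ and the other in $B$. -}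

module Defs where

open import Data.Bool using (if_then_else_)
open import Data.Fin using (Fin; toℕ; _≟_)
open import Data.Fin.Subset using (Subset; _∪_; _∩_; ⊤; ⊥)
open import Data.Fin.Subset.Properties using (_∈?_)
open import Data.Integer using (+_)
open import Data.List using (List; []; _∷_; length; filter; map; concatMap; applyUpTo)
open import Data.List.Relation.Unary.All using (All)
open import Data.Nat using (ℕ; zero; suc; _+_; _*_; _∸_; _^_; _≤_; _<_; _≡ᵇ_)
open import Data.Product using (Σ-syntax; ∃-syntax; _×_; _,_; proj₁; proj₂)
open import Data.Rational as ℚ using (ℚ; _/_)
open import Data.Vec using (toList)
open import Relation.Binary.PropositionalEquality using (_≡_; _≢_)
open import Relation.Nullary.Decidable using (_×-dec_; _⊎-dec_)

-- An edge is stored as a pair of endpoints; degrees and edge counts are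
-- insensitive to the order of the two.  Parallel edges are repeated
-- entries of the list.
record Multigraph : Set where
  constructor multigraph
  field
    order : ℕ
    edges : List (Fin order × Fin order)

  Vertex : Set
  Vertex = Fin order

  size : ℕ
  size = length edges

  degree : Vertex → ℕ
  degree v = length (filter (λ e → proj₁ e ≟ v) edges)
           + length (filter (λ e → proj₂ e ≟ v) edges)

  edgesWithin : Subset order → ℕ
  edgesWithin A =
    length (filter (λ e → (proj₁ e ∈? A) ×-dec (proj₂ e ∈? A)) edges)

  edgesBetween : Subset order → Subset order → ℕ
  edgesBetween A B =
    length (filter (λ e → ((proj₁ e ∈? A) ×-dec (proj₂ e ∈? B))
                       ⊎-dec ((proj₁ e ∈? B) ×-dec (proj₂ e ∈? A))) edges)

open Multigraph public

Loopless : Multigraph → Set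
Loopless G = All (λ e → proj₁ e ≢ proj₂ e) (edges G)

NoIsolatedVertices : Multigraph → Set
NoIsolatedVertices G = ∀ v → 0 < degree G v

MaxDegreeAtMost : Multigraph → ℕ → Set
MaxDegreeAtMost G d = ∀ v → degree G v ≤ d

IsPartition : ∀ {n} → Subset n → Subset n → Set
IsPartition A B = (A ∪ B ≡ ⊤) × (A ∩ B ≡ ⊥)

-- k lies in the closed interval [c - r , c + r]
_∈[_±_] : ℕ → ℚ → ℚ → Set
k ∈[ c ± r ] = (c ℚ.- r ℚ.≤ + k / 1) × (+ k / 1 ℚ.≤ c ℚ.+ r)

Balanced : (G : Multigraph) → ℕ → Subset (order G) → Subset (order G) → Set
Balanced G d A B =
    (edgesWithin G A    ∈[ + size G / 4 ± + d / 2 ])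
  × (edgesWithin G B    ∈[ + size G / 4 ± + d / 2 ])
  × (edgesBetween G A B ∈[ + size G / 2 ± + d / 1 ])

-- Structured programs for a random access machine: finitely many
-- registers (those named in the program), a memory of natural numbers
-- with indirect addressing, and unit cost per operation and per test.
-- The only arithmetic is addition and truncated subtraction, so numbers
-- gain at most one bit per step and unit-cost time agrees with Turing
-- machine time up to a polynomial.  (Unit-cost multiplication would
-- break this.)

Reg : Set
Reg = ℕ

infix  20 _≔_ _≔[_⊞_] _≔[_⊟_] _≔mem[_] mem[_]≔_
infixr 10 _⨾_

data Program : Set where
  skip           : Program
  _≔_            : Reg → ℕ → Program
  _≔[_⊞_]      : Reg → Reg → Reg → Program
  _≔[_⊟_]      : Reg → Reg → Reg → Program
  _≔mem[_]       : Reg → Reg → Program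
  mem[_]≔_       : Reg → Reg → Program
  _⨾_            : Program → Program → Program
  ifNonzero      : Reg → Program → Program → Program
  whileNonzero   : Reg → Program → Program

record State : Set where
  constructor ⟨_,_⟩
  field
    reg : Reg → ℕ
    mem : ℕ → ℕ

open State public

_[_↦_] : (ℕ → ℕ) → ℕ → ℕ → (ℕ → ℕ)
(f [ i ↦ a ]) j = if j ≡ᵇ i then a else f j

setReg : Reg → ℕ → State → State
setReg x a s = ⟨ reg s [ x ↦ a ] , mem s ⟩

setMem : ℕ → ℕ → State → State
setMem i a s = ⟨ reg s , mem s [ i ↦ a ] ⟩

infix 4 ⟪_,_⟫⇓[_]_

-- ⟪ p , s ⟫⇓[ t ] s′ : started in s, p halts in s′ after t steps.
data ⟪_,_⟫⇓[_]_ : Program → State → ℕ → State → Set where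
  skip  : ∀ {s} → ⟪ skip , s ⟫⇓[ 0 ] s
  const : ∀ {s x a} → ⟪ x ≔ a , s ⟫⇓[ 1 ] setReg x a s
  add   : ∀ {s x y z} → ⟪ x ≔[ y ⊞ z ] , s ⟫⇓[ 1 ] setReg x (reg s y + reg s z) s
  sub   : ∀ {s x y z} → ⟪ x ≔[ y ⊟ z ] , s ⟫⇓[ 1 ] setReg x (reg s y ∸ reg s z) s
  load  : ∀ {s x y} → ⟪ x ≔mem[ y ] , s ⟫⇓[ 1 ] setReg x (mem s (reg s y)) s
  store : ∀ {s x y} → ⟪ mem[ x ]≔ y , s ⟫⇓[ 1 ] setMem (reg s x) (reg s y) s
  seq   : ∀ {s s′ s″ p q t t′} →
          ⟪ p , s ⟫⇓[ t ] s′ → ⟪ q , s′ ⟫⇓[ t′ ] s″ →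
          ⟪ p ⨾ q , s ⟫⇓[ t + t′ ] s″
  if≢0  : ∀ {s s′ x p q t} → reg s x ≢ 0 →
          ⟪ p , s ⟫⇓[ t ] s′ → ⟪ ifNonzero x p q , s ⟫⇓[ suc t ] s′
  if≡0  : ∀ {s s′ x p q t} → reg s x ≡ 0 →
          ⟪ q , s ⟫⇓[ t ] s′ → ⟪ ifNonzero x p q , s ⟫⇓[ suc t ] s′
  loop  : ∀ {s s′ s″ x p t t′} → reg s x ≢ 0 →
          ⟪ p , s ⟫⇓[ t ] s′ → ⟪ whileNonzero x p , s′ ⟫⇓[ t′ ] s″ →
          ⟪ whileNonzero x p , s ⟫⇓[ suc (t + t′) ] s″
  exit  : ∀ {s x p} → reg s x ≡ 0 →
          ⟪ whileNonzero x p , s ⟫⇓[ 1 ] s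

-- A word is read from, and written to, memory cells 0, 1, 2, …, with
-- its length in register 0.  Everything else is initially 0.

contents : List ℕ → ℕ → ℕ
contents []       _       = 0
contents (a ∷ as) zero    = a
contents (a ∷ as) (suc i) = contents as i

initial : List ℕ → State
initial w = ⟨ (λ _ → 0) [ 0 ↦ length w ] , contents w ⟩

output : State → List ℕ
output s = applyUpTo (mem s) (reg s 0)

-- One program and one polynomial serve all valid instances.  Size is
-- measured in words of the encoding, which is at most its bit length.
SolvableInPolynomialTime : {Instance : Set} → (Instance → Set) →
  (Instance → List ℕ) → (Instance → List ℕ → Set) → Set
SolvableInPolynomialTime {Instance} Valid encode Solution =
  Σ[ p ∈ Program ] ∃[ c ] ∃[ k ]
    ((I : Instance) → Valid I →
      ∃[ s ] ∃[ t ]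
        (⟪ p , initial (encode I) ⟫⇓[ t ] s)
        × (t ≤ c * suc (length (encode I)) ^ k)
        × Solution I (output s))

encodeGraph : Multigraph → List ℕ
encodeGraph G =
  order G ∷ size G ∷ concatMap (λ e → toℕ (proj₁ e) ∷ toℕ (proj₂ e) ∷ []) (edges G)

-- The pair (A , B) is written as the list of membership bits of A.
encodeSide : ∀ {n} → Subset n → List ℕ
encodeSide A = map (λ b → if b then 1 else 0) (toList A)

Admissible : Multigraph → Set
Admissible G = Loopless G × NoIsolatedVertices G

-- The degree bound d is not part of the input, so the partition found
-- has to be balanced for every valid d.
EncodesBalancedPartition : Multigraph → List ℕ → Set
EncodesBalancedPartition G w =
  Σ[ A ∈ Subset (order G) ] Σ[ B ∈ Subset (order G) ]
    IsPartition A B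
    × (w ≡ encodeSide A)
    × (∀ d → MaxDegreeAtMost G d → Balanced G d A B)

{-# OPTIONS --safe #-}

-- Write x, y, z for the numbers of edges within A, within B and across, α and β for the
-- volumes of A and B, and Ψ = 2mz - αβ = z² - 4xy.  Moving a vertex v of degree D from B to A
-- changes Ψ by an amount whose sum over all v in B is - 2Ψ + Σ D².  So, starting from A = ∅, if
-- each move makes Ψ as large as possible, then Ψ ≥ 0 throughout, and x and y never both exceed
-- m/4; if each move makes Ψ as small as possible, then Ψ ≤ dm throughout, and x + y is always
-- at least m/2 - d/2.  These are two chains of vertex sets, both growing from ∅ to all vertices.
-- Consider the unions of a member of one chain with a member of the other, as a grid.  Each step
-- in it adds at most one vertex, so it changes x and y by at most d in total; a discrete
-- intermediate value argument then yields a union with x and y within d/2 of m/4, which also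
-- gives the bound for z.  The algorithm computes both chains and takes the best union.

module Submission where

open import Defs
import Data.Integer as ℤ
import Data.Integer.Properties as ℤₚ
import Data.Rational.Properties as ℚₚ
import Data.Rational.Unnormalised.Properties as ℚᵘₚ
open import Data.Bool using (Bool; true; false; not; T; if_then_else_; _∧_; _∨_)
open import Data.Empty using (⊥; ⊥-elim)
open import Data.Fin as Fin using (Fin; toℕ; fromℕ<)
open import Data.Fin.Properties using (toℕ<n; toℕ-injective; toℕ-fromℕ<)
open import Data.Fin.Subset using (Subset; ∁)
open import Data.Fin.Subset.Properties using (_∈?_; p∪∁p≡⊤; ∩-inverseʳ; x∈p⇒x∉∁p; x∉p⇒x∈∁p)
open import Data.List using (List; []; _∷_; length; filter; concatMap; applyUpTo)
open import Data.List.Relation.Unary.All using (All; []; _∷_)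
open import Data.Nat hiding (_/_)
open import Data.Nat.Properties
open import Algebra.Properties.CommutativeSemigroup +-commutativeSemigroup using (interchange; x∙yz≈y∙xz; xy∙z≈xz∙y; xy∙z≈yz∙x; xy∙z≈zx∙y)
open import Data.Nat.Tactic.RingSolver using (solve-∀)
open import Data.Product using (Σ-syntax; ∃-syntax; _×_; _,_; proj₁; proj₂)
open import Data.Rational as ℚ using (_/_)
open import Data.Rational.Unnormalised as ℚᵘ using (mkℚᵘ; *≤*)
open import Data.Sum using (_⊎_; inj₁; inj₂)
open import Data.Unit using (⊤; tt)
open import Data.Vec using (tabulate)
open import Data.Vec.Properties using (lookup∘tabulate; []=⇒lookup; lookup⇒[]=)
open import Relation.Binary.PropositionalEquality
open import Relation.Nullary using (¬_; Dec; does; yes; no; contradiction)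
open import Relation.Nullary.Decidable using (_×-dec_; _⊎-dec_)
open import Relation.Unary using (Decidable)

-- Sums over edges and the effect of inserting a vertex

-- With k vertices still outside, the values of Ψ after the k possible insertions sum to (k - 2)Ψ +
-- ΣD². If Ψ ≥ 0, their average is nonnegative. If Ψ ≤ dm, then ΣD² ≤ d ΣD ≤ 2dm makes the sum at
-- most k dm. This is the origin of the slack dm, and the reason why an averaging step needs k ≥ 2.
--
-- The bound d is not given to the program. Neither the greedy rules nor the final search refer to
-- it; it enters only into the analysis, so that one output serves every valid d.
--
-- The absence of isolated vertices gives n ≤ 2m. Hence loops over vertices are bounded by the
-- length of the input, and the n output bits can be written from address 0 on without reaching the
-- two rankings, which are stored behind the input.
--
-- A vertex set is a function into the natural numbers because this is what the program computes for
-- a vertex: a sum of truncated differences that is nonzero for members. The sums over edges below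
-- can then serve directly as loop invariants.

∑ : ℕ → (ℕ → ℕ) → ℕ
∑ zero    f = 0
∑ (suc n) f = f n + ∑ n f

∑-cong : ∀ n {f g} → (∀ i → i < n → f i ≡ g i) → ∑ n f ≡ ∑ n g
∑-cong zero    eq = refl
∑-cong (suc n) eq = cong₂ _+_ (eq n ≤-refl) (∑-cong n λ i i<n → eq i (m<n⇒m<1+n i<n))

∑-mono : ∀ n {f g} → (∀ i → i < n → f i ≤ g i) → ∑ n f ≤ ∑ n g
∑-mono zero    le = z≤n
∑-mono (suc n) le = +-mono-≤ (le n ≤-refl) (∑-mono n λ i i<n → le i (m<n⇒m<1+n i<n))

∑-+ : ∀ n (f g : ℕ → ℕ) → ∑ n (λ i → f i + g i) ≡ ∑ n f + ∑ n g
∑-+ zero    f g = refl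
∑-+ (suc n) f g rewrite ∑-+ n f g = interchange (f n) (g n) (∑ n f) (∑ n g)

∑-*ˡ : ∀ n c (f : ℕ → ℕ) → ∑ n (λ i → c * f i) ≡ c * ∑ n f
∑-*ˡ zero    c f = sym (*-zeroʳ c)
∑-*ˡ (suc n) c f rewrite ∑-*ˡ n c f = sym (*-distribˡ-+ c (f n) (∑ n f))

∑-*ʳ : ∀ n c (f : ℕ → ℕ) → ∑ n (λ i → f i * c) ≡ ∑ n f * c
∑-*ʳ zero    c f = refl
∑-*ʳ (suc n) c f rewrite ∑-*ʳ n c f = sym (*-distribʳ-+ c (f n) (∑ n f))

∑-const : ∀ n c → ∑ n (λ _ → c) ≡ n * c
∑-const zero    c = refl
∑-const (suc n) c = cong (c +_) (∑-const n c)

∑-zero : ∀ n {f} → (∀ i → i < n → f i ≡ 0) → ∑ n f ≡ 0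
∑-zero n eq = trans (∑-cong n eq) (trans (∑-const n 0) (*-zeroʳ n))

∑-swap : ∀ n m (f : ℕ → ℕ → ℕ) → ∑ n (λ i → ∑ m (f i)) ≡ ∑ m (λ j → ∑ n (λ i → f i j))
∑-swap zero    m f = sym (∑-zero m λ _ _ → refl)
∑-swap (suc n) m f rewrite ∑-swap n m f = sym (∑-+ m (f n) (λ j → ∑ n λ i → f i j))

∑-head : ∀ n (f : ℕ → ℕ) → ∑ (suc n) f ≡ f 0 + ∑ n (λ i → f (suc i))
∑-head zero    f = refl
∑-head (suc n) f rewrite ∑-head n f = x∙yz≈y∙xz (f (suc n)) (f 0) (∑ n (λ i → f (suc i)))

term≤∑ : ∀ n (f : ℕ → ℕ) {i} → i < n → f i ≤ ∑ n f
term≤∑ (suc n) f {i} i<1+n with i ≟ n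
... | yes refl = m≤m+n (f n) _
... | no  i≢n  = ≤-trans (term≤∑ n f (≤∧≢⇒< (≤-pred i<1+n) i≢n)) (m≤n+m _ (f n))

dist : ℕ → ℕ → ℕ
dist x y = (x ∸ y) + (y ∸ x)

dist-zero : ∀ v → dist v v ≡ 0
dist-zero v rewrite n∸n≡0 v = refl

dist≡0⇒≡ : ∀ v w → dist v w ≡ 0 → v ≡ w
dist≡0⇒≡ v w eq = ≤-antisym (m∸n≡0⇒m≤n (m+n≡0⇒m≡0 _ eq)) (m∸n≡0⇒m≤n (m+n≡0⇒n≡0 (v ∸ w) eq))

-- Kronecker's delta, in the form in which `member` computes it with truncated subtraction.
δ : ℕ → ℕ → ℕ
δ v w = 1 ∸ dist v w

δ-refl : ∀ v → δ v v ≡ 1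
δ-refl v rewrite dist-zero v = refl

δ-≢ : ∀ {v w} → v ≢ w → δ v w ≡ 0
δ-≢ {v} {w} v≢w with dist v w in eq
... | zero  = ⊥-elim (v≢w (dist≡0⇒≡ v w eq))
... | suc k = 0∸n≡0 k

∑-δ : ∀ n (f : ℕ → ℕ) {v} → v < n → ∑ n (λ w → f w * δ v w) ≡ f v
∑-δ (suc n) f {v} v<1+n with v ≟ n
... | yes refl rewrite δ-refl v
                     | ∑-zero n {λ w → f w * δ v w}
                         (λ w w<n → trans (cong (f w *_) (δ-≢ {n} {w} λ { refl → <-irrefl refl w<n })) (*-zeroʳ (f w)))
      = trans (+-identityʳ _) (*-identityʳ (f v))
... | no v≢n rewrite δ-≢ v≢n | *-zeroʳ (f n) = ∑-δ n f (≤∧≢⇒< (≤-pred v<1+n) v≢n)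

-- A set of vertices is a function χ : ℕ → ℕ, the members being the v with χ v ≢ 0.
inside outside : ℕ → ℕ
inside zero = 0
inside (suc _) = 1
outside zero = 1
outside (suc _) = 0

both neither cut : ℕ → ℕ → ℕ
both    a b = inside a * inside b
neither a b = outside a * outside b
cut     a b = inside a * outside b + outside a * inside b

_⊕_ : (ℕ → ℕ) → ℕ → (ℕ → ℕ)
(χ ⊕ w) v = χ v + δ v w

inside+outside : ∀ a → inside a + outside a ≡ 1
inside+outside zero    = refl
inside+outside (suc _) = refl

outside-cong⇒inside : ∀ a b → outside a ≡ outside b → inside a ≡ inside b
outside-cong⇒inside zero    zero    _ = refl
outside-cong⇒inside (suc _) (suc _) _ = refl

-- With x and y edges within the two sides and z across, the factors on the left are the volumes.
volumes-product : ∀ x y z →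
  (x + x + z) * (y + y + z) + dist x y * dist x y ≡ (x + y + z) * (x + y + z)
volumes-product x y z with ≤-total x y
... | inj₁ x≤y with k , refl ← m≤n⇒∃[o]m+o≡n x≤y
  rewrite m≤n⇒m∸n≡0 x≤y | m+n∸m≡n x k = identity x k z
  where
  identity : ∀ x k z → (x + x + z) * (x + k + (x + k) + z) + k * k ≡ (x + (x + k) + z) * (x + (x + k) + z)
  identity = solve-∀
... | inj₂ y≤x with k , refl ← m≤n⇒∃[o]m+o≡n y≤x
  rewrite m≤n⇒m∸n≡0 y≤x | m+n∸m≡n y k | +-identityʳ k = identity y k z
  where
  identity : ∀ y k z → (y + k + (y + k) + z) * (y + y + z) + k * k ≡ (y + k + y + z) * (y + k + y + z)
  identity = solve-∀

module Edges (n m : ℕ) (src tgt : ℕ → ℕ)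
  (src< : ∀ e → e < m → src e < n) (tgt< : ∀ e → e < m → tgt e < n)
  (src≢tgt : ∀ e → e < m → src e ≢ tgt e) where

  within avoiding across vol covol : (ℕ → ℕ) → ℕ
  within   χ = ∑ m λ e → both    (χ (src e)) (χ (tgt e))
  avoiding χ = ∑ m λ e → neither (χ (src e)) (χ (tgt e))
  across   χ = ∑ m λ e → cut     (χ (src e)) (χ (tgt e))
  vol      χ = ∑ m λ e → inside  (χ (src e)) + inside  (χ (tgt e))
  covol    χ = ∑ m λ e → outside (χ (src e)) + outside (χ (tgt e))

  deg : ℕ → ℕ
  deg w = ∑ m λ e → δ (src e) w + δ (tgt e) w

  missing : (ℕ → ℕ) → ℕ
  missing χ = ∑ n λ w → outside (χ w)

  size-split : ∀ χ → within χ + avoiding χ + across χ ≡ m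
  size-split χ = begin
    within χ + avoiding χ + across χ            ≡⟨ cong (_+ across χ) (∑-+ m _ _) ⟨
    ∑ m _ + across χ                            ≡⟨ ∑-+ m _ _ ⟨
    ∑ m _                                       ≡⟨ ∑-cong m (λ e _ → pointwise (χ (src e)) (χ (tgt e))) ⟩
    ∑ m (λ _ → 1)                               ≡⟨ ∑-const m 1 ⟩
    m * 1                                       ≡⟨ *-identityʳ m ⟩
    m                                           ∎
    where
    open ≡-Reasoning
    pointwise : ∀ a b → both a b + neither a b + cut a b ≡ 1
    pointwise zero    zero    = refl
    pointwise zero    (suc _) = refl
    pointwise (suc _) zero    = refl
    pointwise (suc _) (suc _) = refl

  vol-split : ∀ χ → vol χ ≡ within χ + within χ + across χ
  vol-split χ = begin
    vol χ                                ≡⟨ ∑-cong m (λ e _ → pointwise (χ (src e)) (χ (tgt e))) ⟩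
    ∑ m _                                ≡⟨ ∑-+ m _ _ ⟩
    ∑ m _ + across χ                     ≡⟨ cong (_+ across χ) (∑-+ m _ _) ⟩
    within χ + within χ + across χ       ∎
    where
    open ≡-Reasoning
    pointwise : ∀ a b → inside a + inside b ≡ both a b + both a b + cut a b
    pointwise zero    zero    = refl
    pointwise zero    (suc _) = refl
    pointwise (suc _) zero    = refl
    pointwise (suc _) (suc _) = refl

  covol-split : ∀ χ → covol χ ≡ avoiding χ + avoiding χ + across χ
  covol-split χ = begin
    covol χ                                ≡⟨ ∑-cong m (λ e _ → pointwise (χ (src e)) (χ (tgt e))) ⟩
    ∑ m _                                  ≡⟨ ∑-+ m _ _ ⟩
    ∑ m _ + across χ                       ≡⟨ cong (_+ across χ) (∑-+ m _ _) ⟩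
    avoiding χ + avoiding χ + across χ     ∎
    where
    open ≡-Reasoning
    pointwise : ∀ a b → outside a + outside b ≡ neither a b + neither a b + cut a b
    pointwise zero    zero    = refl
    pointwise zero    (suc _) = refl
    pointwise (suc _) zero    = refl
    pointwise (suc _) (suc _) = refl

  vol+covol : ∀ χ → vol χ + covol χ ≡ m + m
  vol+covol χ = begin
    vol χ + covol χ    ≡⟨ cong₂ _+_ (vol-split χ) (covol-split χ) ⟩
    x + x + z + (y + y + z) ≡⟨ regroup x y z ⟩
    (x + y + z) + (x + y + z) ≡⟨ cong₂ _+_ (size-split χ) (size-split χ) ⟩
    m + m ∎
    where
    open ≡-Reasoning
    x = within χ
    y = avoiding χ
    z = across χ
    regroup : ∀ x y z → x + x + z + (y + y + z) ≡ (x + y + z) + (x + y + z)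
    regroup = solve-∀

  -- The volumes sum to 2m and differ by 2(x - y), so this is a difference of two squares. It
  -- eliminates the volumes from Ψ, so that a key needs only x, y and m.
  vol-*-covol : ∀ χ → vol χ * covol χ + dist (within χ) (avoiding χ) * dist (within χ) (avoiding χ) ≡ m * m
  vol-*-covol χ rewrite vol-split χ | covol-split χ =
    trans (volumes-product (within χ) (avoiding χ) (across χ)) (cong₂ _*_ (size-split χ) (size-split χ))

  module _ {χ χ′ : ℕ → ℕ} (eq : ∀ v → v < n → outside (χ v) ≡ outside (χ′ v)) where
    private
      in-eq : ∀ v → v < n → inside (χ v) ≡ inside (χ′ v)
      in-eq v v<n = outside-cong⇒inside (χ v) (χ′ v) (eq v v<n)

    within-cong : within χ ≡ within χ′
    within-cong = ∑-cong m λ e e<m → cong₂ _*_ (in-eq _ (src< e e<m)) (in-eq _ (tgt< e e<m))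

    avoiding-cong : avoiding χ ≡ avoiding χ′
    avoiding-cong = ∑-cong m λ e e<m → cong₂ _*_ (eq _ (src< e e<m)) (eq _ (tgt< e e<m))

    missing-cong : missing χ ≡ missing χ′
    missing-cong = ∑-cong n eq

  module _ {χ χ′ : ℕ → ℕ} (sub : ∀ v → v < n → outside (χ′ v) ≤ outside (χ v)) where
    private
      complement : ∀ a b → outside b ≤ outside a → inside a ≤ inside b
      complement zero    b       _ = z≤n
      complement (suc _) zero    ()
      complement (suc _) (suc _) _ = ≤-refl

    within-mono : within χ ≤ within χ′
    within-mono = ∑-mono m λ e e<m → *-mono-≤
      (complement (χ (src e)) (χ′ (src e)) (sub _ (src< e e<m)))
      (complement (χ (tgt e)) (χ′ (tgt e)) (sub _ (tgt< e e<m)))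

    avoiding-antimono : avoiding χ′ ≤ avoiding χ
    avoiding-antimono = ∑-mono m λ e e<m → *-mono-≤ (sub _ (src< e e<m)) (sub _ (tgt< e e<m))

  -- Only edges at `w` matter: such an edge joins those within the set or leaves those avoiding it.
  -- Bounding both changes together by one degree is what makes a tolerance of d/2 sufficient in the
  -- grid.
  one-vertex-step : ∀ {χ χ′} w → (∀ v → v < n → outside (χ v) ≤ outside (χ′ v) + δ v w) →
    (∀ v → v < n → outside (χ′ v) ≤ outside (χ v)) →
    within χ′ + avoiding χ ≤ within χ + avoiding χ′ + deg w
  one-vertex-step {χ} {χ′} w up down = begin
    within χ′ + avoiding χ            ≡⟨ ∑-+ m _ _ ⟨
    ∑ m _                             ≤⟨ ∑-mono m (λ e e<m → pointwise (χ (src e)) (χ (tgt e)) (χ′ (src e)) (χ′ (tgt e))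
                                           (up _ (src< e e<m)) (up _ (tgt< e e<m))
                                           (down _ (src< e e<m)) (down _ (tgt< e e<m))) ⟩
    ∑ m _                             ≡⟨ ∑-+ m _ _ ⟩
    ∑ m _ + deg w                     ≡⟨ cong (_+ deg w) (∑-+ m _ _) ⟩
    within χ + avoiding χ′ + deg w    ∎
    where
    open ≤-Reasoning
    pointwise : ∀ a b a′ b′ {s t} → outside a ≤ outside a′ + s → outside b ≤ outside b′ + t →
      outside a′ ≤ outside a → outside b′ ≤ outside b →
      both a′ b′ + neither a b ≤ both a b + neither a′ b′ + (s + t)
    pointwise zero    zero    zero    zero    p q _ _ = m≤m+n 1 _
    pointwise zero    zero    zero    (suc _) p q _ _ = ≤-trans q (m≤n+m _ _)
    pointwise zero    zero    (suc _) zero    p q _ _ = ≤-trans p (m≤m+n _ _)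
    pointwise zero    zero    (suc _) (suc _) {s} p q _ _ = +-mono-≤ p q
    pointwise zero    (suc _) zero    (suc _) p q _ _ = z≤n
    pointwise zero    (suc _) (suc _) (suc _) p q _ _ = ≤-trans p (m≤m+n _ _)
    pointwise (suc _) zero    (suc _) zero    p q _ _ = z≤n
    pointwise (suc _) zero    (suc _) (suc _) p q _ _ = ≤-trans q (m≤n+m _ _)
    pointwise (suc _) (suc _) (suc _) (suc _) p q _ _ = m≤m+n 1 _

  module Averaging (χ : ℕ → ℕ) where

    private
      o : ℕ → ℕ
      o w = outside (χ w)
      k = missing χ
      α = vol χ
      β = covol χ
      z = across χ
      y = avoiding χ

    -- Double counting of the pairs of an edge and an endpoint of it outside the set. For the empty
    -- set this is the handshake lemma.
    degrees : ∑ n (λ w → o w * deg w) ≡ β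
    degrees = begin
      ∑ n (λ w → o w * deg w)
        ≡⟨ ∑-cong n (λ w _ → ∑-*ˡ m (o w) _) ⟨
      ∑ n (λ w → ∑ m λ e → o w * (δ (src e) w + δ (tgt e) w))
        ≡⟨ ∑-swap n m _ ⟩
      ∑ m (λ e → ∑ n λ w → o w * (δ (src e) w + δ (tgt e) w))
        ≡⟨ ∑-cong m (λ e e<m → trans (∑-cong n λ w _ → *-distribˡ-+ (o w) _ _)
             (trans (∑-+ n _ _) (cong₂ _+_ (∑-δ n o (src< e e<m)) (∑-δ n o (tgt< e e<m))))) ⟩
      β ∎
      where open ≡-Reasoning

    insert-inside : ∀ {w} → χ w ≡ 0 → ∀ v → inside (χ v + δ v w) ≡ inside (χ v) + δ v w
    insert-inside {w} χw≡0 v with v ≟ w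
    ... | yes refl rewrite χw≡0 | δ-refl v = refl
    ... | no v≢w rewrite δ-≢ v≢w | +-identityʳ (χ v) = sym (+-identityʳ _)

    insert-outside : ∀ {w} → χ w ≡ 0 → ∀ v → outside (χ v) ≡ outside (χ v + δ v w) + δ v w
    insert-outside {w} χw≡0 v with v ≟ w
    ... | yes refl rewrite χw≡0 | δ-refl v = refl
    ... | no v≢w rewrite δ-≢ v≢w | +-identityʳ (χ v) = sym (+-identityʳ _)

    vol-insert : ∀ {w} → χ w ≡ 0 → vol (χ ⊕ w) ≡ α + deg w
    vol-insert {w} χw≡0 = trans (∑-cong m λ e _ →
        trans (cong₂ _+_ (insert-inside χw≡0 (src e)) (insert-inside χw≡0 (tgt e)))
              (interchange (inside (χ (src e))) _ (inside (χ (tgt e))) _))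
      (∑-+ m _ _)

    covol-insert : ∀ {w} → χ w ≡ 0 → β ≡ covol (χ ⊕ w) + deg w
    covol-insert {w} χw≡0 = trans (∑-cong m λ e _ →
        trans (cong₂ _+_ (insert-outside χw≡0 (src e)) (insert-outside χw≡0 (tgt e)))
              (interchange (outside (χ (src e) + _)) _ (outside (χ (tgt e) + _)) _))
      (∑-+ m _ _)

    missing-insert : ∀ {w} → w < n → χ w ≡ 0 → k ≡ suc (missing (χ ⊕ w))
    missing-insert {w} w<n χw≡0 = begin
      k                                            ≡⟨ ∑-cong n (λ v _ → insert-outside χw≡0 v) ⟩
      ∑ n _                                        ≡⟨ ∑-+ n _ _ ⟩
      missing (χ ⊕ w) + ∑ n (λ v → δ v w)          ≡⟨ cong (missing (χ ⊕ w) +_) (∑-cong n λ v _ →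
                                                        trans (δ-sym v w) (sym (*-identityˡ (δ w v)))) ⟩
      missing (χ ⊕ w) + ∑ n (λ v → 1 * δ w v)      ≡⟨ cong (missing (χ ⊕ w) +_) (∑-δ n (λ _ → 1) w<n) ⟩
      missing (χ ⊕ w) + 1                          ≡⟨ +-comm _ 1 ⟩
      suc (missing (χ ⊕ w))                        ∎
      where
      open ≡-Reasoning
      δ-sym : ∀ v w → δ v w ≡ δ w v
      δ-sym v w = cong (1 ∸_) (+-comm (v ∸ w) (w ∸ v))

    -- An edge inside the set is never cut. A cut edge is spoiled by exactly one insertion, that of
    -- its outer endpoint, and the extra summand on the left repays it. An edge outside becomes cut
    -- by exactly two insertions, because its endpoints are distinct.
    edge-cuts : ∀ {u v} → u < n → v < n → u ≢ v →
      ∑ n (λ w → o w * cut (χ u + δ u w) (χ v + δ v w)) + cut (χ u) (χ v)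
        ≡ k * cut (χ u) (χ v) + 2 * neither (χ u) (χ v)
    edge-cuts {u} {v} u<n v<n u≢v with χ u in χu | χ v in χv
    ... | suc _ | suc _ = begin
      ∑ n (λ w → o w * 0) + 0   ≡⟨ +-identityʳ _ ⟩
      ∑ n (λ w → o w * 0)       ≡⟨ ∑-zero n (λ w _ → *-zeroʳ (o w)) ⟩
      0                         ≡⟨ trans (+-identityʳ _) (*-zeroʳ k) ⟨
      k * 0 + 0                 ∎
      where open ≡-Reasoning
    ... | suc _ | zero = begin
      ∑ n (λ w → o w * (1 * outside (δ v w) + 0)) + 1
        ≡⟨ cong₂ _+_ refl (trans (sym (cong outside χv)) (sym (∑-δ n o v<n))) ⟩
      ∑ n (λ w → o w * (1 * outside (δ v w) + 0)) + ∑ n (λ w → o w * δ v w)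
        ≡⟨ ∑-+ n _ _ ⟨
      ∑ n (λ w → o w * (1 * outside (δ v w) + 0) + o w * δ v w)
        ≡⟨ ∑-cong n (λ w _ → trans (sym (*-distribˡ-+ (o w) _ _)) (trans (cong (o w *_) (pointwise w)) (*-identityʳ (o w)))) ⟩
      k ≡⟨ trans (+-identityʳ _) (*-identityʳ k) ⟨
      k * 1 + 0 ∎
      where
      open ≡-Reasoning
      pointwise : ∀ w → 1 * outside (δ v w) + 0 + δ v w ≡ 1
      pointwise w with v ≟ w
      ... | yes refl rewrite δ-refl v = refl
      ... | no v≢w rewrite δ-≢ v≢w = refl
    ... | zero | suc _ = begin
      ∑ n (λ w → o w * (inside (δ u w) * 0 + outside (δ u w) * 1)) + 1
        ≡⟨ cong₂ _+_ refl (trans (sym (cong outside χu)) (sym (∑-δ n o u<n))) ⟩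
      ∑ n (λ w → o w * (inside (δ u w) * 0 + outside (δ u w) * 1)) + ∑ n (λ w → o w * δ u w)
        ≡⟨ ∑-+ n _ _ ⟨
      ∑ n (λ w → o w * (inside (δ u w) * 0 + outside (δ u w) * 1) + o w * δ u w)
        ≡⟨ ∑-cong n (λ w _ → trans (sym (*-distribˡ-+ (o w) _ _)) (trans (cong (o w *_) (pointwise w)) (*-identityʳ (o w)))) ⟩
      k ≡⟨ trans (+-identityʳ _) (*-identityʳ k) ⟨
      k * 1 + 0 ∎
      where
      open ≡-Reasoning
      pointwise : ∀ w → inside (δ u w) * 0 + outside (δ u w) * 1 + δ u w ≡ 1
      pointwise w with u ≟ w
      ... | yes refl rewrite δ-refl u = refl
      ... | no u≢w rewrite δ-≢ u≢w = refl
    ... | zero | zero = begin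
      ∑ n (λ w → o w * cut (δ u w) (δ v w)) + 0
        ≡⟨ +-identityʳ _ ⟩
      ∑ n (λ w → o w * cut (δ u w) (δ v w))
        ≡⟨ ∑-cong n (λ w _ → trans (cong (o w *_) (pointwise w)) (*-distribˡ-+ (o w) _ _)) ⟩
      ∑ n (λ w → o w * δ u w + o w * δ v w)
        ≡⟨ ∑-+ n _ _ ⟩
      ∑ n (λ w → o w * δ u w) + ∑ n (λ w → o w * δ v w)
        ≡⟨ cong₂ _+_ (trans (∑-δ n o u<n) (cong outside χu)) (trans (∑-δ n o v<n) (cong outside χv)) ⟩
      2 ≡⟨ cong (_+ 2) (*-zeroʳ k) ⟨
      k * 0 + 2 ∎
      where
      open ≡-Reasoning
      pointwise : ∀ w → cut (δ u w) (δ v w) ≡ δ u w + δ v w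
      pointwise w with u ≟ w | v ≟ w
      ... | yes refl | yes refl = ⊥-elim (u≢v refl)
      ... | yes refl | no v≢w rewrite δ-refl u | δ-≢ v≢w = refl
      ... | no u≢w | yes refl rewrite δ-refl v | δ-≢ u≢w = refl
      ... | no u≢w | no v≢w rewrite δ-≢ u≢w | δ-≢ v≢w = refl

    cuts : ∑ n (λ w → o w * across (χ ⊕ w)) + z ≡ k * z + 2 * y
    cuts = begin
      ∑ n (λ w → o w * across (χ ⊕ w)) + z
        ≡⟨ cong (_+ z) (trans (∑-cong n λ w _ → sym (∑-*ˡ m (o w) _)) (∑-swap n m _)) ⟩
      ∑ m (λ e → ∑ n λ w → o w * cut ((χ ⊕ w) (src e)) ((χ ⊕ w) (tgt e))) + z
        ≡⟨ ∑-+ m _ _ ⟨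
      ∑ m (λ e → (∑ n λ w → o w * cut ((χ ⊕ w) (src e)) ((χ ⊕ w) (tgt e))) + cut (χ (src e)) (χ (tgt e)))
        ≡⟨ ∑-cong m (λ e e<m → edge-cuts (src< e e<m) (tgt< e e<m) (src≢tgt e e<m)) ⟩
      ∑ m (λ e → k * cut (χ (src e)) (χ (tgt e)) + 2 * neither (χ (src e)) (χ (tgt e)))
        ≡⟨ ∑-+ m _ _ ⟩
      _ ≡⟨ cong₂ _+_ (∑-*ˡ m k _) (∑-*ˡ m 2 _) ⟩
      k * z + 2 * y ∎
      where open ≡-Reasoning

    squares : ℕ
    squares = ∑ n λ w → o w * (deg w * deg w)

    squares≤ : ∀ d → (∀ v → v < n → deg v ≤ d) → squares ≤ d * (m + m)
    squares≤ d deg≤d = begin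
      squares                          ≤⟨ ∑-mono n (λ w w<n → *-monoʳ-≤ (o w) (*-monoˡ-≤ (deg w) (deg≤d w w<n))) ⟩
      ∑ n (λ w → o w * (d * deg w))    ≡⟨ ∑-cong n (λ w _ → swap (o w) d (deg w)) ⟩
      ∑ n (λ w → d * (o w * deg w))    ≡⟨ ∑-*ˡ n d _ ⟩
      d * ∑ n (λ w → o w * deg w)      ≡⟨ cong (d *_) degrees ⟩
      d * β                            ≤⟨ *-monoʳ-≤ d (≤-trans (m≤n+m β α) (≤-reflexive (vol+covol χ))) ⟩
      d * (m + m)                      ∎
      where
      open ≤-Reasoning
      swap : ∀ a b c → a * (b * c) ≡ b * (a * c)
      swap = solve-∀

    -- Expand (α + D)(β - D) = αβ - αD + βD - D² and sum with ΣD = β; the negative terms stand on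
    -- the left.
    products : ∑ n (λ w → o w * (vol (χ ⊕ w) * covol (χ ⊕ w))) + α * β + squares ≡ k * (α * β) + β * β
    products = begin
      P + α * β + squares
        ≡⟨ cong (λ b → P + α * b + squares) degrees ⟨
      P + α * ∑ n (λ w → o w * deg w) + squares
        ≡⟨ cong (λ b → P + b + squares) (∑-*ˡ n α _) ⟨
      P + ∑ n (λ w → α * (o w * deg w)) + squares
        ≡⟨ cong (_+ squares) (∑-+ n _ _) ⟨
      ∑ n (λ w → o w * (vol (χ ⊕ w) * covol (χ ⊕ w)) + α * (o w * deg w)) + squares
        ≡⟨ ∑-+ n _ _ ⟨
      ∑ n (λ w → o w * (vol (χ ⊕ w) * covol (χ ⊕ w)) + α * (o w * deg w) + o w * (deg w * deg w))
        ≡⟨ ∑-cong n (λ w _ → pointwise w) ⟩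
      ∑ n (λ w → o w * (α * β) + (o w * deg w) * β)
        ≡⟨ ∑-+ n _ _ ⟩
      ∑ n (λ w → o w * (α * β)) + ∑ n (λ w → (o w * deg w) * β)
        ≡⟨ cong₂ _+_ (∑-*ʳ n (α * β) o) (trans (∑-*ʳ n β _) (cong (_* β) degrees)) ⟩
      k * (α * β) + β * β ∎
      where
      open ≡-Reasoning
      P = ∑ n (λ w → o w * (vol (χ ⊕ w) * covol (χ ⊕ w)))
      identity : ∀ a D b → 1 * ((a + D) * b) + a * (1 * D) + 1 * (D * D) ≡ 1 * (a * (b + D)) + (1 * D) * (b + D)
      identity = solve-∀
      pointwise : ∀ w → o w * (vol (χ ⊕ w) * covol (χ ⊕ w)) + α * (o w * deg w) + o w * (deg w * deg w)
        ≡ o w * (α * β) + (o w * deg w) * β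
      pointwise w with χ w in χw
      ... | suc _ rewrite *-zeroʳ α = refl
      ... | zero rewrite vol-insert χw | covol-insert χw = identity α (deg w) (covol (χ ⊕ w))

    -- The averaging argument in contrapositive form: if every insertion misses its goal, each by at
    -- least 1, the totals differ by at least the number of vertices outside.
    strict-sum : ∀ {f g : ℕ → ℕ} → (∀ w → w < n → χ w ≡ 0 → f w < g w) →
      ∑ n (λ w → o w * f w) + k ≤ ∑ n (λ w → o w * g w)
    strict-sum {f} {g} lt = begin
      ∑ n (λ w → o w * f w) + k      ≡⟨ ∑-+ n _ _ ⟨
      ∑ n (λ w → o w * f w + o w)    ≤⟨ ∑-mono n pointwise ⟩
      ∑ n (λ w → o w * g w)          ∎
      where
      open ≤-Reasoning
      pointwise : ∀ w → w < n → o w * f w + o w ≤ o w * g w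
      pointwise w w<n with χ w in χw
      ... | suc _ = z≤n
      ... | zero rewrite +-identityʳ (f w) | +-identityʳ (g w) | +-comm (f w) 1 = lt w w<n χw

-- The two greedy invariants

-- Up to a constant, the two keys are Ψ and - Ψ for Ψ = 2mz - αβ, where z is the
-- number of edges across and α, β are the volumes of the two sides.
cutKey uncutKey : ℕ → ℕ → ℕ → ℕ
cutKey   m x y = (m ∸ x ∸ y) * (m + m) + dist x y * dist x y
uncutKey m x y = (x + y) * (m + m) ∸ dist x y * dist x y

dist≤+ : ∀ x y → dist x y ≤ x + y
dist≤+ x y = +-mono-≤ (m∸n≤m x y) (m∸n≤m y x)

exchange-≤ : ∀ {a b c d} → a + b ≡ c + d → d ≤ a → b ≤ c
exchange-≤ {a} {b} {c} {d} eq d≤a = +-cancelˡ-≤ d b c (begin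
  d + b ≤⟨ +-monoˡ-≤ b d≤a ⟩
  a + b ≡⟨ eq ⟩
  c + d ≡⟨ +-comm c d ⟩
  d + c ∎)
  where open ≤-Reasoning

module Invariants (n m : ℕ) (src tgt : ℕ → ℕ)
  (src< : ∀ e → e < m → src e < n) (tgt< : ∀ e → e < m → tgt e < n)
  (src≢tgt : ∀ e → e < m → src e ≢ tgt e) where

  open Edges n m src tgt src< tgt< src≢tgt public

  Good : (ℕ → ℕ → ℕ) → ℕ → (ℕ → ℕ) → Set
  Good key slack χ = m * m ≤ key (within χ) (avoiding χ) + slack

  -- With at most one vertex left, inserting it makes χ everything.
  Improvable : (ℕ → ℕ → ℕ) → ℕ → Set
  Improvable key slack = ∀ χ → 2 ≤ missing χ → Good key slack χ →
    (∀ w → w < n → χ w ≡ 0 → ¬ Good key slack (χ ⊕ w)) → ⊥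

  across-∸ : ∀ χ → m ∸ within χ ∸ avoiding χ ≡ across χ
  across-∸ χ = begin
    m ∸ x ∸ y            ≡⟨ ∸-+-assoc m x y ⟩
    m ∸ (x + y)          ≡⟨ cong (_∸ (x + y)) (size-split χ) ⟨
    x + y + z ∸ (x + y)  ≡⟨ m+n∸m≡n (x + y) z ⟩
    z                    ∎
    where
    open ≡-Reasoning
    x = within χ
    y = avoiding χ
    z = across χ

  -- In other words `cutKey` is m² + Ψ, so `Good (cutKey m) 0` says that Ψ ≥ 0.
  cutKey-identity : ∀ χ → cutKey m (within χ) (avoiding χ) + vol χ * covol χ ≡ across χ * (m + m) + m * m
  cutKey-identity χ = begin
    cutKey m x y + ab              ≡⟨ cong (λ z → z * (m + m) + D + ab) (across-∸ χ) ⟩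
    z * (m + m) + D + ab           ≡⟨ +-assoc (z * (m + m)) D ab ⟩
    z * (m + m) + (D + ab)         ≡⟨ cong (z * (m + m) +_) (trans (+-comm D ab) (vol-*-covol χ)) ⟩
    z * (m + m) + m * m            ∎
    where
    open ≡-Reasoning
    x = within χ
    y = avoiding χ
    z = across χ
    ab = vol χ * covol χ
    D = dist x y * dist x y

  within+avoiding≤size : ∀ χ → within χ + avoiding χ ≤ m
  within+avoiding≤size χ = ≤-trans (m≤m+n _ (across χ)) (≤-reflexive (size-split χ))

  -- In other words `uncutKey` is m² - Ψ, so `Good (uncutKey m) s` says that Ψ ≤ s. The truncated
  -- subtraction in the key is exact, because (x - y)² ≤ (x + y) 2m.
  uncutKey-identity : ∀ χ → uncutKey m (within χ) (avoiding χ) + across χ * (m + m) ≡ m * m + vol χ * covol χ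
  uncutKey-identity χ = +-cancelʳ-≡ D _ _ (begin
    uncutKey m x y + z * (m + m) + D     ≡⟨ xy∙z≈xz∙y (uncutKey m x y) (z * (m + m)) D ⟩
    uncutKey m x y + D + z * (m + m)     ≡⟨ cong (_+ z * (m + m)) (m∸n+n≡m D≤) ⟩
    (x + y) * (m + m) + z * (m + m)      ≡⟨ *-distribʳ-+ (m + m) (x + y) z ⟨
    (x + y + z) * (m + m)                ≡⟨ cong (_* (m + m)) (size-split χ) ⟩
    m * (m + m)                          ≡⟨ *-distribˡ-+ m m m ⟩
    m * m + m * m                        ≡⟨ cong (m * m +_) (vol-*-covol χ) ⟨
    m * m + (ab + D)                     ≡⟨ +-assoc (m * m) ab D ⟨
    m * m + ab + D                       ∎)
    where
    open ≡-Reasoning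
    x = within χ
    y = avoiding χ
    z = across χ
    ab = vol χ * covol χ
    D = dist x y * dist x y
    D≤ : D ≤ (x + y) * (m + m)
    D≤ = *-mono-≤ (dist≤+ x y) (≤-trans (dist≤+ x y) (≤-trans (within+avoiding≤size χ) (m≤m+n m m)))

  good-cut⇒ : ∀ {χ} → Good (cutKey m) 0 χ → vol χ * covol χ ≤ across χ * (m + m)
  good-cut⇒ {χ} good = exchange-≤ (cutKey-identity χ) (≤-trans good (≤-reflexive (+-identityʳ _)))

  ⇒good-cut : ∀ {χ} → vol χ * covol χ ≤ across χ * (m + m) → Good (cutKey m) 0 χ
  ⇒good-cut {χ} le = ≤-trans (exchange-≤ {across χ * (m + m)} {d = vol χ * covol χ}
    (trans (sym (cutKey-identity χ)) refl) le) (m≤m+n _ 0)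

  good-uncut⇒ : ∀ {χ s} → Good (uncutKey m) s χ → across χ * (m + m) ≤ vol χ * covol χ + s
  good-uncut⇒ {χ} {s} good = exchange-≤ {uncutKey m (within χ) (avoiding χ) + s} (begin
      K + s + C      ≡⟨ xy∙z≈xz∙y K s C ⟩
      K + C + s      ≡⟨ cong (_+ s) (uncutKey-identity χ) ⟩
      m * m + P + s  ≡⟨ xy∙z≈yz∙x (m * m) P s ⟩
      P + s + m * m  ∎) good
    where
    open ≡-Reasoning
    K = uncutKey m (within χ) (avoiding χ)
    C = across χ * (m + m)
    P = vol χ * covol χ

  ⇒good-uncut : ∀ {χ s} → across χ * (m + m) ≤ vol χ * covol χ + s → Good (uncutKey m) s χ
  ⇒good-uncut {χ} {s} le = exchange-≤ {vol χ * covol χ + s} (begin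
      P + s + m * m ≡⟨ xy∙z≈zx∙y P s (m * m) ⟩
      m * m + P + s ≡⟨ cong (_+ s) (uncutKey-identity χ) ⟨
      K + C + s     ≡⟨ xy∙z≈xz∙y K C s ⟩
      K + s + C     ∎) le
    where
    open ≡-Reasoning
    K = uncutKey m (within χ) (avoiding χ)
    C = across χ * (m + m)
    P = vol χ * covol χ

  module _ (χ : ℕ → ℕ) {k : ℕ} (missing≡ : missing χ ≡ 2 + k) where
    open Averaging χ

    private
      α = vol χ
      β = covol χ
      z = across χ
      y = avoiding χ
      o : ℕ → ℕ
      o w = outside (χ w)
      S = ∑ n λ w → o w * (vol (χ ⊕ w) * covol (χ ⊕ w))
      A = ∑ n λ w → o w * across (χ ⊕ w)

    -- With 2 + k vertices outside, this total and `total-product` share the remainder 2αβ + β².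
    -- Their difference is therefore kΨ plus the squares, where k is a natural number.
    total-cut : A * (m + m) + α * β + squares ≡ k * (z * (m + m)) + (2 * (α * β) + β * β) + squares
    total-cut = cong (_+ squares) (begin
      A * (m + m) + α * β
        ≡⟨ cong₂ (λ a t → a * t + α * β) A≡ (sym (vol+covol χ)) ⟩
      (k * z + (y + y + z)) * (α + β) + α * β
        ≡⟨ cong (λ b → (k * z + b) * (α + β) + α * β) (covol-split χ) ⟨
      (k * z + β) * (α + β) + α * β
        ≡⟨ identity k z α β ⟩
      k * (z * (α + β)) + (2 * (α * β) + β * β)
        ≡⟨ cong (λ t → k * (z * t) + (2 * (α * β) + β * β)) (vol+covol χ) ⟩
      k * (z * (m + m)) + (2 * (α * β) + β * β) ∎)
      where
      open ≡-Reasoning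
      identity : ∀ k z α β → (k * z + β) * (α + β) + α * β ≡ k * (z * (α + β)) + (2 * (α * β) + β * β)
      identity = solve-∀
      regroup : ∀ k z y → (2 + k) * z + 2 * y ≡ k * z + (y + y + z) + z
      regroup = solve-∀
      A≡ : A ≡ k * z + (y + y + z)
      A≡ = +-cancelʳ-≡ z _ _ (trans cuts (trans (cong (λ j → j * z + 2 * y) missing≡) (regroup k z y)))

    total-product : S + α * β + squares ≡ k * (α * β) + (2 * (α * β) + β * β)
    total-product = trans products (trans (cong (λ j → j * (α * β) + β * β) missing≡) (regroup k (α * β) (β * β)))
      where
      regroup : ∀ k p q → (2 + k) * p + q ≡ k * p + (2 * p + q)
      regroup = solve-∀

    cut-gain : α * β ≤ z * (m + m) → S ≤ A * (m + m)
    cut-gain le = +-cancelʳ-≤ (α * β + squares) S (A * (m + m)) (begin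
      S + (α * β + squares)                                    ≡⟨ +-assoc S _ _ ⟨
      S + α * β + squares                                      ≡⟨ total-product ⟩
      k * (α * β) + (2 * (α * β) + β * β)                      ≤⟨ +-monoˡ-≤ _ (*-monoʳ-≤ k le) ⟩
      k * (z * (m + m)) + (2 * (α * β) + β * β)                ≤⟨ m≤m+n _ squares ⟩
      k * (z * (m + m)) + (2 * (α * β) + β * β) + squares      ≡⟨ total-cut ⟨
      A * (m + m) + α * β + squares                            ≡⟨ +-assoc (A * (m + m)) _ _ ⟩
      A * (m + m) + (α * β + squares)                          ∎)
      where open ≤-Reasoning

    -- The hypothesis supplies k shares of the slack dm, and the squares, being at most d times 2m,
    -- account for two more: one share for each of the 2 + k vertices outside.
    uncut-gain : ∀ d → (∀ v → v < n → deg v ≤ d) → z * (m + m) ≤ α * β + d * m →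
      A * (m + m) ≤ S + missing χ * (d * m)
    uncut-gain d deg≤d le = +-cancelʳ-≤ (α * β + squares) (A * (m + m)) _ (begin
      A * (m + m) + (α * β + squares)                          ≡⟨ +-assoc (A * (m + m)) _ _ ⟨
      A * (m + m) + α * β + squares                            ≡⟨ total-cut ⟩
      k * (z * (m + m)) + (2 * (α * β) + β * β) + squares      ≤⟨ +-mono-≤ (+-monoˡ-≤ _ (*-monoʳ-≤ k le)) (squares≤ d deg≤d) ⟩
      k * (α * β + d * m) + (2 * (α * β) + β * β) + d * (m + m) ≡⟨ regroup k (α * β) (β * β) d m ⟩
      k * (α * β) + (2 * (α * β) + β * β) + (2 + k) * (d * m)  ≡⟨ cong₂ (λ p j → p + j * (d * m)) total-product missing≡ ⟨
      S + α * β + squares + missing χ * (d * m)                ≡⟨ shuffle S (α * β) squares _ ⟩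
      S + missing χ * (d * m) + (α * β + squares)              ∎)
      where
      open ≤-Reasoning
      regroup : ∀ k p q d m → k * (p + d * m) + (2 * p + q) + d * (m + m) ≡ k * p + (2 * p + q) + (2 + k) * (d * m)
      regroup = solve-∀
      shuffle : ∀ s p q r → s + p + q + r ≡ s + r + (p + q)
      shuffle = solve-∀

  private
    drop-k : ∀ {a b k} → 2 ≤ k → a + k ≤ b → a < b
    drop-k {a} 2≤k le = ≤-trans (≤-trans (≤-reflexive (+-comm 1 a)) (+-monoʳ-≤ a (≤-trans (n≤1+n 1) 2≤k))) le

  cut-improvable : Improvable (cutKey m) 0
  cut-improvable χ 2≤k good bad with k , eq ← m≤n⇒∃[o]m+o≡n 2≤k =
    <⇒≱ (drop-k 2≤k (strict-sum λ w w<n χw → ≰⇒> λ le → bad w w<n χw (⇒good-cut {χ ⊕ w} le)))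
        (≤-trans (cut-gain χ (sym eq) (good-cut⇒ {χ} good))
          (≤-reflexive (trans (sym (∑-*ʳ n (m + m) _)) (∑-cong n λ w _ → *-assoc (outside (χ w)) _ _))))
    where open Averaging χ

  uncut-improvable : ∀ d → (∀ v → v < n → deg v ≤ d) → Improvable (uncutKey m) (d * m)
  uncut-improvable d deg≤d χ 2≤k good bad with k , eq ← m≤n⇒∃[o]m+o≡n 2≤k =
    <⇒≱ (drop-k 2≤k (strict-sum λ w w<n χw → ≰⇒> λ le → bad w w<n χw (⇒good-uncut {χ ⊕ w} le)))
        (begin
          ∑ n (λ w → outside (χ w) * (across (χ ⊕ w) * (m + m)))
            ≡⟨ trans (∑-cong n λ w _ → sym (*-assoc (outside (χ w)) _ _)) (∑-*ʳ n (m + m) _) ⟩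
          ∑ n (λ w → outside (χ w) * across (χ ⊕ w)) * (m + m)
            ≤⟨ uncut-gain χ (sym eq) d deg≤d (good-uncut⇒ {χ} good) ⟩
          ∑ n (λ w → outside (χ w) * (vol (χ ⊕ w) * covol (χ ⊕ w))) + missing χ * (d * m)
            ≡⟨ cong₂ _+_ refl (∑-*ʳ n (d * m) _) ⟨
          ∑ n (λ w → outside (χ w) * (vol (χ ⊕ w) * covol (χ ⊕ w))) + ∑ n (λ w → outside (χ w) * (d * m))
            ≡⟨ ∑-+ n _ _ ⟨
          ∑ n (λ w → outside (χ w) * (vol (χ ⊕ w) * covol (χ ⊕ w)) + outside (χ w) * (d * m))
            ≡⟨ ∑-cong n (λ w _ → *-distribˡ-+ (outside (χ w)) _ _) ⟨
          ∑ n (λ w → outside (χ w) * (vol (χ ⊕ w) * covol (χ ⊕ w) + d * m)) ∎)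
    where
    open Averaging χ
    open ≤-Reasoning

  avoiding-all : ∀ {χ} → (∀ v → v < n → outside (χ v) ≡ 1) → avoiding χ ≡ m
  avoiding-all all = trans (∑-cong m λ e e<m → cong₂ _*_ (all _ (src< e e<m)) (all _ (tgt< e e<m)))
    (trans (∑-const m 1) (*-identityʳ m))

  avoiding-none : ∀ {χ} → (∀ v → v < n → outside (χ v) ≡ 0) → avoiding χ ≡ 0
  avoiding-none none = ∑-zero m λ e e<m → cong (_* _) (none _ (src< e e<m))

  across-none : ∀ {χ} → (∀ v → v < n → outside (χ v) ≡ 0) → across χ ≡ 0
  across-none {χ} none = ∑-zero m λ e e<m →
    trans (cong₂ (λ a b → inside (χ (src e)) * b + a * inside (χ (tgt e))) (none _ (src< e e<m)) (none _ (tgt< e e<m)))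
          (trans (+-identityʳ _) (*-zeroʳ (inside (χ (src e)))))

  covol-none : ∀ {χ} → (∀ v → v < n → outside (χ v) ≡ 0) → covol χ ≡ 0
  covol-none none = ∑-zero m λ e e<m → cong₂ _+_ (none _ (src< e e<m)) (none _ (tgt< e e<m))

  within-none : ∀ {χ} → (∀ v → v < n → outside (χ v) ≡ 0) → within χ ≡ m
  within-none {χ} none = begin
    within χ                           ≡⟨ trans (+-identityʳ _) (+-identityʳ _) ⟨
    within χ + 0 + 0                   ≡⟨ cong₂ (λ y z → within χ + y + z) (avoiding-none {χ} none) (across-none {χ} none) ⟨
    within χ + avoiding χ + across χ   ≡⟨ size-split χ ⟩
    m                                  ∎
    where open ≡-Reasoning

  within-all : ∀ {χ} → (∀ v → v < n → outside (χ v) ≡ 1) → within χ ≡ 0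
  within-all {χ} all = ∑-zero m λ e e<m → cong (_* _)
    (inside≡0 (χ (src e)) (all _ (src< e e<m)))
    where
    inside≡0 : ∀ a → outside a ≡ 1 → inside a ≡ 0
    inside≡0 zero _ = refl

  good-cut-none : ∀ {χ} → (∀ v → v < n → outside (χ v) ≡ 0) → Good (cutKey m) 0 χ
  good-cut-none {χ} none = ⇒good-cut {χ} (≤-trans (≤-reflexive
    (trans (cong (vol χ *_) (covol-none {χ} none)) (*-zeroʳ (vol χ)))) z≤n)

  good-uncut-none : ∀ {χ} s → (∀ v → v < n → outside (χ v) ≡ 0) → Good (uncutKey m) s χ
  good-uncut-none {χ} s none = ⇒good-uncut {χ} (≤-trans (≤-reflexive (cong (_* (m + m)) (across-none {χ} none))) z≤n)

  private
    square-gap : m * (m + m) ∸ m * m ≡ m * m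
    square-gap = trans (cong (_∸ m * m) (*-distribˡ-+ m m m)) (m+n∸m≡n (m * m) (m * m))

  good-cut-all : ∀ {χ} → (∀ v → v < n → outside (χ v) ≡ 1) → Good (cutKey m) 0 χ
  good-cut-all {χ} all rewrite within-all {χ} all | avoiding-all {χ} all | n∸n≡0 m | 0∸n≡0 m = m≤m+n _ 0

  good-uncut-all : ∀ {χ} s → (∀ v → v < n → outside (χ v) ≡ 1) → Good (uncutKey m) s χ
  good-uncut-all {χ} s all rewrite within-all {χ} all | avoiding-all {χ} all | 0∸n≡0 m | square-gap = m≤m+n _ s

  -- Since Ψ = z² - 4xy ≥ 0, values of x and y above m/4 would force z > m/2, and the three would
  -- sum to more than m. Deciding first whether 2z ≤ m avoids square roots.
  good-cut⇒unsaturated : ∀ {χ} → Good (cutKey m) 0 χ → m < 4 * within χ → m < 4 * avoiding χ → ⊥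
  good-cut⇒unsaturated {χ} good m<4x m<4y with (z + z) ≤? m
    where z = across χ
  ... | yes 2z≤m = <-irrefl refl (begin-strict
    m * m                    <⟨ *-mono-< m<4x m<4y ⟩
    (4 * x) * (4 * y)        ≡⟨ regroup x y ⟩
    4 * (4 * (x * y))        ≤⟨ *-monoʳ-≤ 4 4xy≤z² ⟩
    4 * (z * z)              ≡⟨ double z ⟩
    (z + z) * (z + z)        ≤⟨ *-mono-≤ 2z≤m 2z≤m ⟩
    m * m                    ∎)
    where
    open ≤-Reasoning
    x = within χ
    y = avoiding χ
    z = across χ
    regroup : ∀ x y → (4 * x) * (4 * y) ≡ 4 * (4 * (x * y))
    regroup = solve-∀
    double : ∀ z → 4 * (z * z) ≡ (z + z) * (z + z)
    double = solve-∀
    left : ∀ x y z → 4 * (x * y) + (2 * (x * z) + 2 * (y * z) + z * z) ≡ (x + x + z) * (y + y + z)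
    left = solve-∀
    right : ∀ x y z → z * (x + y + z + (x + y + z)) ≡ z * z + (2 * (x * z) + 2 * (y * z) + z * z)
    right = solve-∀
    4xy≤z² : 4 * (x * y) ≤ z * z
    4xy≤z² = +-cancelʳ-≤ (2 * (x * z) + 2 * (y * z) + z * z) _ _ (begin
      4 * (x * y) + (2 * (x * z) + 2 * (y * z) + z * z)   ≡⟨ left x y z ⟩
      (x + x + z) * (y + y + z)                           ≡⟨ cong₂ _*_ (vol-split χ) (covol-split χ) ⟨
      vol χ * covol χ                                     ≤⟨ good-cut⇒ {χ} good ⟩
      z * (m + m)                                         ≡⟨ cong (λ s → z * (s + s)) (size-split χ) ⟨
      z * (x + y + z + (x + y + z))                       ≡⟨ right x y z ⟩
      z * z + (2 * (x * z) + 2 * (y * z) + z * z)         ∎)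
  ... | no 2z≰m = <-irrefl refl (begin-strict
    m + m + (m + m)                       <⟨ +-mono-< (+-mono-< m<4x m<4y) (+-mono-< (≰⇒> 2z≰m) (≰⇒> 2z≰m)) ⟩
    4 * x + 4 * y + (z + z + (z + z))     ≡⟨ regroup x y z ⟩
    4 * (x + y + z)                       ≡⟨ cong (4 *_) (size-split χ) ⟩
    4 * m                                 ≡⟨ quadruple m ⟩
    m + m + (m + m)                       ∎)
    where
    open ≤-Reasoning
    x = within χ
    y = avoiding χ
    z = across χ
    regroup : ∀ x y z → 4 * x + 4 * y + (z + z + (z + z)) ≡ 4 * (x + y + z)
    regroup = solve-∀
    quadruple : ∀ m → 4 * m ≡ m + m + (m + m)
    quadruple = solve-∀

  -- By αβ ≤ m², the bound Ψ ≤ dm becomes 2mz ≤ m² + dm. It remains to divide by m, which is why m =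
  -- 0 is treated apart, and to replace z by m - x - y.
  good-uncut⇒ample : ∀ {χ} d → Good (uncutKey m) (d * m) χ → m ≤ 2 * (within χ + avoiding χ) + d
  good-uncut⇒ample {χ} d good with m ≟ 0
  ... | yes m≡0 = ≤-trans (≤-reflexive m≡0) z≤n
  ... | no m≢0 = +-cancelʳ-≤ m m _ (begin
    m + m                           ≡⟨ cong (λ s → s + s) (size-split χ) ⟨
    x + y + z + (x + y + z)         ≡⟨ regroup x y z ⟩
    2 * (x + y) + (z + z)           ≤⟨ +-monoʳ-≤ (2 * (x + y)) 2z≤ ⟩
    2 * (x + y) + (d + m)           ≡⟨ +-assoc (2 * (x + y)) d m ⟨
    2 * (x + y) + d + m             ∎)
    where
    open ≤-Reasoning
    x = within χ
    y = avoiding χ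
    z = across χ
    regroup : ∀ x y z → x + y + z + (x + y + z) ≡ 2 * (x + y) + (z + z)
    regroup = solve-∀
    twice : ∀ m z → (z + z) * m ≡ z * (m + m)
    twice = solve-∀
    2z≤ : z + z ≤ d + m
    2z≤ = *-cancelʳ-≤ (z + z) (d + m) m ⦃ ≢-nonZero m≢0 ⦄ (begin
      (z + z) * m               ≡⟨ twice m z ⟩
      z * (m + m)               ≤⟨ good-uncut⇒ {χ} good ⟩
      vol χ * covol χ + d * m   ≤⟨ +-monoˡ-≤ (d * m) (≤-trans (m≤m+n _ _) (≤-reflexive (vol-*-covol χ))) ⟩
      m * m + d * m             ≡⟨ +-comm (m * m) (d * m) ⟩
      d * m + m * m             ≡⟨ *-distribʳ-+ m d m ⟨
      (d + m) * m               ∎)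

-- The discrete intermediate value argument

-- The two ways of stopping are kept apart because they call for different facts about the grid: at
-- the border `N` there is no next cell to compare with.
greatest : ∀ {P : ℕ → Set} → Decidable P → ∀ {i₀} N → i₀ ≤ N → P i₀ →
  ∃[ i ] i₀ ≤ i × i ≤ N × P i × (i ≡ N ⊎ ¬ P (suc i))
greatest P? {i₀} N i₀≤N p with P? N
... | yes pN = N , i₀≤N , ≤-refl , pN , inj₁ refl
... | no ¬pN with m≤n⇒m<n∨m≡n i₀≤N
...   | inj₂ refl = contradiction p ¬pN
greatest P? {i₀} (suc N) i₀≤N p | no ¬pN | inj₁ (s≤s i₀≤N′) with greatest P? N i₀≤N′ p
... | i , i₀≤i , i≤N , pi , inj₁ refl = i , i₀≤i , m≤n⇒m≤1+n i≤N , pi , inj₂ ¬pN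
... | i , i₀≤i , i≤N , pi , inj₂ ¬p = i , i₀≤i , m≤n⇒m≤1+n i≤N , pi , inj₂ ¬p

record Near (m d x y : ℕ) : Set where
  constructor near
  field
    x-large : m ≤ 4 * x + 2 * d
    x-small : 4 * x ≤ m + 2 * d
    y-large : m ≤ 4 * y + 2 * d
    y-small : 4 * y ≤ m + 2 * d

-- For each j let i be greatest with m ≤ 4 x i j + 2 d.  As j descends, y drops by at
-- most d between these frontier cells, so it cannot jump over the target interval;
-- it starts above the interval's lower end and ends at 0.
module Grid (n m d : ℕ) (x y : ℕ → ℕ → ℕ)
  (x-antiᵢ : ∀ {i i′} j → i ≤ i′ → x i′ j ≤ x i j)
  (x-antiⱼ : ∀ i j → x i (suc j) ≤ x i j)
  (y-monoᵢ : ∀ {i i′} j → i ≤ i′ → y i j ≤ y i′ j)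
  (stepᵢ : ∀ i j → x i j + y (suc i) j ≤ x (suc i) j + y i j + d)
  (stepⱼ : ∀ i j → x i j + y i (suc j) ≤ x i (suc j) + y i j + d)
  (x-full : x 0 n ≡ m) (y-full : ∀ i → y i 0 ≡ 0)
  (x-empty : x n n ≡ 0) (y-empty : y n n ≡ m)
  (ample : ∀ i → i ≤ n → m ≤ 2 * (x i n + y i n) + d)
  (unsaturated : ∀ j → j ≤ n → m < 4 * x n j → m < 4 * y n j → ⊥) where

  private
    Large : ℕ → ℕ → Set
    Large j i = m ≤ 4 * x i j + 2 * d

    large? : ∀ j → Decidable (Large j)
    large? j i = m ≤? 4 * x i j + 2 * d

    Hit : Set
    Hit = ∃[ i ] ∃[ j ] i ≤ n × j ≤ n × Near m d (x i j) (y i j)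

    -- A cell that fails to be a hit only because y is too large.
    Frontier : ℕ → Set
    Frontier j = ∃[ i ] i ≤ n × Large j i × 4 * x i j ≤ m + 2 * d × m + 2 * d < 4 * y i j

    x-step : ∀ i j → x i j ≤ x (suc i) j + d
    x-step i j = +-cancelʳ-≤ (y (suc i) j) _ _ (begin
      x i j + y (suc i) j             ≤⟨ stepᵢ i j ⟩
      x (suc i) j + y i j + d         ≤⟨ +-monoˡ-≤ d (+-monoʳ-≤ (x (suc i) j) (y-monoᵢ j (n≤1+n i))) ⟩
      x (suc i) j + y (suc i) j + d   ≡⟨ xy∙z≈xz∙y (x (suc i) j) _ d ⟩
      x (suc i) j + d + y (suc i) j   ∎)
      where
      open ≤-Reasoning

    y-step : ∀ i j → y i (suc j) ≤ y i j + d
    y-step i j = +-cancelˡ-≤ (x i j) _ _ (begin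
      x i j + y i (suc j)             ≤⟨ stepⱼ i j ⟩
      x i (suc j) + y i j + d         ≤⟨ +-monoˡ-≤ d (+-monoˡ-≤ (y i j) (x-antiⱼ i j)) ⟩
      x i j + y i j + d               ≡⟨ +-assoc (x i j) _ d ⟩
      x i j + (y i j + d)             ∎)
      where open ≤-Reasoning

    -- The window for 4x, from m - 2d to m + 2d, has width 4d, and one step changes 4x by at most
    -- 4d. So the last cell that is not below the window is not above it either.
    small-next : ∀ {j i} → ¬ Large j (suc i) → 4 * x i j ≤ m + 2 * d
    small-next {j} {i} ¬large = begin
      4 * x i j                       ≤⟨ *-monoʳ-≤ 4 (x-step i j) ⟩
      4 * (x (suc i) j + d)           ≡⟨ regroup (x (suc i) j) d ⟩
      4 * x (suc i) j + 2 * d + 2 * d ≤⟨ +-monoˡ-≤ (2 * d) (<⇒≤ (≰⇒> ¬large)) ⟩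
      m + 2 * d                       ∎
      where
      open ≤-Reasoning
      regroup : ∀ a d → 4 * (a + d) ≡ 4 * a + 2 * d + 2 * d
      regroup = solve-∀

    settle : ∀ {i j} → i ≤ n → j ≤ n → Large j i → 4 * x i j ≤ m + 2 * d → m ≤ 4 * y i j + 2 * d →
      Hit ⊎ Frontier j
    settle {i} {j} i≤n j≤n large small y-large with 4 * y i j ≤? m + 2 * d
    ... | yes y-small = inj₁ (i , j , i≤n , j≤n , near large small y-large y-small)
    ... | no  y-big   = inj₂ (i , i≤n , large , small , ≰⇒> y-big)

    -- Using `ample` at the cell `i` alone would lose an extra d/2. The sum of `ample` at `i` and at
    -- `suc i` contains x i + y (suc i), which the joint step bound replaces by x (suc i) + y i + d.
    -- If x (suc i) and y i were both below the window, this would be too small.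
    start-large : ∀ i → suc i ≤ n → ¬ Large n (suc i) → m ≤ 4 * y i n + 2 * d
    start-large i i<n ¬large with m ≤? 4 * y i n + 2 * d
    ... | yes le = le
    ... | no  gt = contradiction (begin-strict
      (x₁ + y₁) * 4 + 2 * d + ((x₀ + y₀) * 4 + 2 * d)
        ≡⟨ regroup x₀ y₀ x₁ y₁ d ⟩
      4 * (x₁ + y₀) + (4 * x₀ + 2 * d + (4 * y₁ + 2 * d))
        <⟨ +-mono-≤-< (*-monoʳ-≤ 4 (stepᵢ i n)) (+-mono-< (≰⇒> ¬large) (≰⇒> gt)) ⟩
      4 * (x₀ + y₁ + d) + (m + m)
        ≡⟨ regroup′ x₀ y₁ d m ⟩
      (4 * x₀ + 2 * d) + (4 * y₁ + 2 * d) + (m + m)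
        <⟨ +-monoˡ-< (m + m) (+-mono-< (≰⇒> ¬large) (≰⇒> gt)) ⟩
      m + m + (m + m)
        ≤⟨ +-mono-≤ (double x₁ y₁ (ample i (<⇒≤ i<n))) (double x₀ y₀ (ample (suc i) i<n)) ⟩
      (x₁ + y₁) * 4 + 2 * d + ((x₀ + y₀) * 4 + 2 * d) ∎) (<-irrefl refl)
      where
      open ≤-Reasoning
      x₀ = x (suc i) n
      y₀ = y (suc i) n
      x₁ = x i n
      y₁ = y i n
      regroup : ∀ x₀ y₀ x₁ y₁ d → (x₁ + y₁) * 4 + 2 * d + ((x₀ + y₀) * 4 + 2 * d)
        ≡ 4 * (x₁ + y₀) + (4 * x₀ + 2 * d + (4 * y₁ + 2 * d))
      regroup = solve-∀
      regroup′ : ∀ x₀ y₁ d m → 4 * (x₀ + y₁ + d) + (m + m) ≡ (4 * x₀ + 2 * d) + (4 * y₁ + 2 * d) + (m + m)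
      regroup′ = solve-∀
      expand : ∀ s d → 2 * s + d + (2 * s + d) ≡ s * 4 + 2 * d
      expand = solve-∀
      double : ∀ a b → m ≤ 2 * (a + b) + d → m + m ≤ (a + b) * 4 + 2 * d
      double a b le = ≤-trans (+-mono-≤ le le) (≤-reflexive (expand (a + b) d))

    start : Hit ⊎ Frontier n
    start with greatest (large? n) n z≤n (≤-trans (m≤n*m m 4) (≤-trans (≤-reflexive (cong (4 *_) (sym x-full))) (m≤m+n _ (2 * d))))
    ... | i , _ , i≤n , large , inj₁ refl = settle i≤n ≤-refl large
      (≤-trans (≤-reflexive (cong (4 *_) x-empty)) z≤n)
      (≤-trans (m≤n*m m 4) (≤-trans (≤-reflexive (cong (4 *_) (sym y-empty))) (m≤m+n _ (2 * d))))
    ... | i , _ , i≤n , large , inj₂ ¬large with m≤n⇒m<n∨m≡n i≤n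
    ...   | inj₁ i<n = settle i≤n ≤-refl large (small-next ¬large) (start-large i i<n ¬large)
    ...   | inj₂ refl = settle i≤n ≤-refl large
      (≤-trans (≤-reflexive (cong (4 *_) x-empty)) z≤n)
      (≤-trans (m≤n*m m 4) (≤-trans (≤-reflexive (cong (4 *_) (sym y-empty))) (m≤m+n _ (2 * d))))

    -- On the border `i = n`, a value above m/4 forces its partner to be at most m/4. If x at `j`
    -- and y at `suc j` both exceeded m/4 + d/2, then y at `j` and x at `suc j` would be at most
    -- m/4, and a single step would change the two by more than d in total.
    no-overshoot : ∀ {i j} → i ≤ n → suc j ≤ n → 4 * x i (suc j) ≤ m + 2 * d → m + 2 * d < 4 * y i (suc j) →
      ¬ (m + 2 * d < 4 * x n j)
    no-overshoot {i} {j} i≤n j<n x₁≤ <y₁ <x₂ = <-irrefl refl (begin-strict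
      m + 2 * d + (m + 2 * d)          <⟨ +-mono-< <x₂ <y₁′ ⟩
      4 * x n j + 4 * y n (suc j)      ≡⟨ *-distribˡ-+ 4 (x n j) (y n (suc j)) ⟨
      4 * (x n j + y n (suc j))        ≤⟨ *-monoʳ-≤ 4 (stepⱼ n j) ⟩
      4 * (x n (suc j) + y n j + d)    ≡⟨ expand (x n (suc j)) (y n j) d ⟩
      4 * x n (suc j) + 4 * y n j + 4 * d ≤⟨ +-monoˡ-≤ (4 * d) (+-mono-≤ x₁-low y₂-low) ⟩
      m + m + 4 * d                    ≡⟨ regroup m d ⟩
      m + 2 * d + (m + 2 * d)          ∎)
      where
      open ≤-Reasoning
      expand : ∀ a b d → 4 * (a + b + d) ≡ 4 * a + 4 * b + 4 * d
      expand = solve-∀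
      regroup : ∀ m d → m + m + 4 * d ≡ m + 2 * d + (m + 2 * d)
      regroup = solve-∀
      <y₁′ : m + 2 * d < 4 * y n (suc j)
      <y₁′ = ≤-trans <y₁ (*-monoʳ-≤ 4 (y-monoᵢ (suc j) i≤n))
      x₁-low : 4 * x n (suc j) ≤ m
      x₁-low = ≮⇒≥ λ m<4x₁ → unsaturated (suc j) j<n m<4x₁ (≤-<-trans (m≤m+n m _) <y₁′)
      y₂-low : 4 * y n j ≤ m
      y₂-low = ≮⇒≥ λ m<4y₂ → unsaturated j (<⇒≤ j<n) (≤-<-trans (m≤m+n m _) <x₂) m<4y₂

    descend : ∀ j → j ≤ n → Frontier j → Hit
    descend zero    _   (i , _ , _ , _ , <y) rewrite y-full i = contradiction <y λ ()
    descend (suc j) j<n (i , i≤n , large , x≤ , <y)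
      -- The old index `i` is still large in row `j`, where x is at least as big. The search
      -- therefore starts at `i` and yields `i ≤ i′`, so that y cannot decrease through the change
      -- of index.
      with greatest (large? j) n i≤n (≤-trans large (+-monoˡ-≤ (2 * d) (*-monoʳ-≤ 4 (x-antiⱼ i j))))
    ... | i′ , i≤i′ , i′≤n , large′ , top with 4 * x i′ j ≤? m + 2 * d
    -- Moving right from `i` to `i′` does not lower y, and going down one row lowers it by at most
    -- d. So 4y, which exceeded m + 2d, is still at least m - 2d.
    ...   | yes small = continue (settle i′≤n (<⇒≤ j<n) large′ small (+-cancelʳ-≤ (2 * d) _ _ (begin
        m + 2 * d                        ≤⟨ <⇒≤ <y ⟩
        4 * y i (suc j)                  ≤⟨ *-monoʳ-≤ 4 (≤-trans (y-monoᵢ (suc j) i≤i′) (y-step i′ j)) ⟩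
        4 * (y i′ j + d)                 ≡⟨ expand (y i′ j) d ⟩
        4 * y i′ j + 2 * d + 2 * d       ∎)))
      where
      open ≤-Reasoning
      expand : ∀ a d → 4 * (a + d) ≡ 4 * a + 2 * d + 2 * d
      expand = solve-∀
      continue : Hit ⊎ Frontier j → Hit
      continue (inj₁ hit)      = hit
      continue (inj₂ frontier) = descend j (<⇒≤ j<n) frontier
    ...   | no big with top
    ...     | inj₁ refl   = contradiction (≰⇒> big) (no-overshoot i≤n j<n x≤ <y)
    ...     | inj₂ ¬large = contradiction (small-next ¬large) big

  hit : ∃[ i ] ∃[ j ] i ≤ n × j ≤ n × Near m d (x i j) (y i j)
  hit with start
  ... | inj₁ h = h
  ... | inj₂ f = descend n ≤-refl f

-- Greedy chains as rankings of the vertices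

-- Raising the threshold to `suc i` can expel only the rank `suc i`. The summand `h` stands for
-- membership through other terms of a union.
outside-∸-suc : ∀ a i h → a ≢ suc i → outside ((a ∸ i) + h) ≡ outside ((a ∸ suc i) + h)
outside-∸-suc zero          zero    h _  = refl
outside-∸-suc (suc zero)    zero    h ≢1 = contradiction refl ≢1
outside-∸-suc (suc (suc a)) zero    h _  = refl
outside-∸-suc zero          (suc i) h _  = refl
outside-∸-suc (suc a)       (suc i) h ≢  = outside-∸-suc a i h (λ eq → ≢ (cong suc eq))

outside-antimono : ∀ {a b} → a ≤ b → outside b ≤ outside a
outside-antimono {zero}  {zero}  _ = ≤-refl
outside-antimono {zero}  {suc b} _ = z≤n
outside-antimono {suc a} {suc b} _ = ≤-refl

outside≤1 : ∀ a → outside a ≤ 1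
outside≤1 zero    = ≤-refl
outside≤1 (suc _) = z≤n

∑-positive⇒∃ : ∀ n (χ : ℕ → ℕ) → 0 < ∑ n (λ v → outside (χ v)) → ∃[ v ] v < n × χ v ≡ 0
∑-positive⇒∃ (suc n) χ pos with χ n in eq
... | zero  = n , ≤-refl , eq
... | suc _ with v , v<n , χv ← ∑-positive⇒∃ n χ pos = v , m<n⇒m<1+n v<n , χv

module Chains (n m : ℕ) (src tgt : ℕ → ℕ)
  (src< : ∀ e → e < m → src e < n) (tgt< : ∀ e → e < m → tgt e < n)
  (src≢tgt : ∀ e → e < m → src e ≢ tgt e) where

  open Invariants n m src tgt src< tgt< src≢tgt public

  score : (ℕ → ℕ → ℕ) → (ℕ → ℕ) → ℕ
  score key χ = key (within χ) (avoiding χ)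

  _≈_ : (ℕ → ℕ) → (ℕ → ℕ) → Set
  χ ≈ χ′ = ∀ v → v < n → outside (χ v) ≡ outside (χ′ v)

  score-cong : ∀ key {χ χ′} → χ ≈ χ′ → score key χ ≡ score key χ′
  score-cong key {χ} {χ′} eq = cong₂ key (within-cong {χ} {χ′} eq) (avoiding-cong {χ} {χ′} eq)

  -- The sets above r i shrink from all vertices to none as i runs from 0 to n.
  above : (ℕ → ℕ) → ℕ → (ℕ → ℕ)
  above r i v = r v ∸ i

  record Choice (key : ℕ → ℕ → ℕ) (r : ℕ → ℕ) (i : ℕ) : Set where
    field
      chosen  : ℕ
      chosen< : chosen < n
      ranked  : r chosen ≡ suc i
      unique  : ∀ v → v < n → r v ≡ suc i → v ≡ chosen
      maximal : ∀ v → v < n → above r (suc i) v ≡ 0 →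
                score key (above r (suc i) ⊕ v) ≤ score key (above r (suc i) ⊕ chosen)

    above-chosen : ∀ h v → v < n → outside (above r i v + h) ≡ outside (above r (suc i) v + δ v chosen + h)
    above-chosen h v v<n with v ≟ chosen
    ... | yes refl rewrite ranked | m+n∸n≡m 1 i | n∸n≡0 i | δ-refl chosen = refl
    ... | no v≢ rewrite δ-≢ v≢ | +-identityʳ (r v ∸ suc i) =
      outside-∸-suc (r v) i h λ rv → v≢ (unique v v<n rv)

    above≈ : above r i ≈ (above r (suc i) ⊕ chosen)
    above≈ v v<n = subst₂ (λ a b → outside a ≡ outside b) (+-identityʳ _) (+-identityʳ _) (above-chosen 0 v v<n)

  -- r ranks, from n downwards, the vertices in the order of the greedy choices; those
  -- with rank 0 are yet to be chosen.
  record Greedy (key : ℕ → ℕ → ℕ) (r : ℕ → ℕ) (j : ℕ) : Set where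
    field
      bounded  : ∀ v → v < n → r v ≤ n
      cleared  : ∀ v → v < n → 0 < r v → j < r v
      choice   : ∀ i → j ≤ i → i < n → Choice key r i

    above-top : ∀ v → v < n → outside (above r n v) ≡ 1
    above-top v v<n = cong outside (m≤n⇒m∸n≡0 (bounded v v<n))

    -- Descends from the threshold `n`, above which there is nothing; every choice fills one place.
    -- At threshold 0 it follows that all vertices have been ranked.
    missing-above : ∀ k i → j ≤ i → k + i ≡ n → missing (above r i) ≡ i
    missing-above zero    i j≤i refl = trans (∑-cong n above-top) (trans (∑-const n 1) (*-identityʳ n))
    missing-above (suc k) i j≤i k+i≡n = suc-injective (begin
      suc (missing (above r i))                       ≡⟨ cong suc (missing-cong above≈) ⟩
      suc (missing (above r (suc i) ⊕ chosen))        ≡⟨ Averaging.missing-insert (above r (suc i)) chosen< (m≤n⇒m∸n≡0 (≤-reflexive ranked)) ⟨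
      missing (above r (suc i))                       ≡⟨ missing-above k (suc i) (m≤n⇒m≤1+n j≤i) (trans (+-suc k i) k+i≡n) ⟩
      suc i                                           ∎)
      where
      open ≡-Reasoning
      open Choice (choice i j≤i (≤-trans (s≤s (m≤n+m i k)) (≤-reflexive k+i≡n)))

    missing≡ : ∀ i → j ≤ i → i ≤ n → missing (above r i) ≡ i
    missing≡ i j≤i i≤n = missing-above (n ∸ i) i j≤i (m∸n+n≡m i≤n)

  greedy-start : ∀ key r → (∀ v → v < n → r v ≡ 0) → Greedy key r n
  greedy-start key r zeros = record
    { bounded = λ v v<n → ≤-trans (≤-reflexive (zeros v v<n)) z≤n
    ; cleared = λ v v<n 0<rv → contradiction (subst (0 <_) (zeros v v<n) 0<rv) λ ()
    ; choice  = λ i n≤i i<n → contradiction i<n (≤⇒≯ n≤i)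
    }

  -- Ranks are given in decreasing order, so the sets above `suc i` with j ≤ i do not notice the new
  -- rank `suc j`, and the earlier choices keep their maximality.
  greedy-step : ∀ {key r r′ j} w → suc j ≤ n → Greedy key r (suc j) → w < n → above r (suc j) w ≡ 0 →
    (∀ v → v < n → above r (suc j) v ≡ 0 →
       score key (above r (suc j) ⊕ v) ≤ score key (above r (suc j) ⊕ w)) →
    r′ w ≡ suc j → (∀ v → v < n → v ≢ w → r′ v ≡ r v) → Greedy key r′ j
  greedy-step {key} {r} {r′} {j} w j<n g w<n aw≡0 max r′w r′≡r = record
    { bounded = bounded′ ; cleared = cleared′ ; choice = choice′ }
    where
    open Greedy g

    -- Not lying above `suc j` leaves only rank 0, because `cleared` says that the ranks from 1 to
    -- `suc j` have not been given out.
    rw≡0 : r w ≡ 0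
    rw≡0 with r w in eq
    ... | zero  = refl
    ... | suc a = contradiction aw≡0 (m>n⇒m∸n≢0 (subst (suc j <_) eq (cleared w w<n (subst (0 <_) (sym eq) (s≤s z≤n)))))

    bounded′ : ∀ v → v < n → r′ v ≤ n
    bounded′ v v<n with v ≟ w
    ... | yes refl = ≤-trans (≤-reflexive r′w) j<n
    ... | no v≢w   = ≤-trans (≤-reflexive (r′≡r v v<n v≢w)) (bounded v v<n)

    cleared′ : ∀ v → v < n → 0 < r′ v → j < r′ v
    cleared′ v v<n pos with v ≟ w
    ... | yes refl = ≤-reflexive (sym r′w)
    ... | no v≢w rewrite r′≡r v v<n v≢w = <-trans (n<1+n j) (cleared v v<n pos)

    above-old : ∀ i → j ≤ i → ∀ v → v < n → above r′ (suc i) v ≡ above r (suc i) v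
    above-old i j≤i v v<n with v ≟ w
    ... | yes refl rewrite r′w | rw≡0 = m≤n⇒m∸n≡0 j≤i
    ... | no v≢w rewrite r′≡r v v<n v≢w = refl

    maximal-old : ∀ i → j ≤ i → ∀ c →
      (∀ v → v < n → above r (suc i) v ≡ 0 → score key (above r (suc i) ⊕ v) ≤ score key (above r (suc i) ⊕ c)) →
      (∀ v → v < n → above r′ (suc i) v ≡ 0 → score key (above r′ (suc i) ⊕ v) ≤ score key (above r′ (suc i) ⊕ c))
    maximal-old i j≤i c old v v<n v∉ =
      subst₂ _≤_ (transfer v) (transfer c) (old v v<n (trans (sym (above-old i j≤i v v<n)) v∉))
      where
      transfer : ∀ c → score key (above r (suc i) ⊕ c) ≡ score key (above r′ (suc i) ⊕ c)
      transfer c = score-cong key λ u u<n → cong (λ a → outside (a + δ u c)) (sym (above-old i j≤i u u<n))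

    choice′ : ∀ i → j ≤ i → i < n → Choice key r′ i
    choice′ i j≤i i<n with m≤n⇒m<n∨m≡n j≤i
    ... | inj₂ refl = record
      { chosen = w ; chosen< = w<n ; ranked = r′w ; unique = unique
      ; maximal = maximal-old j ≤-refl w max }
      where
      unique : ∀ v → v < n → r′ v ≡ suc j → v ≡ w
      unique v v<n eq with v ≟ w
      ... | yes v≡w = v≡w
      ... | no v≢w with rv ← trans (sym (r′≡r v v<n v≢w)) eq =
        contradiction (cleared v v<n (subst (0 <_) (sym rv) (s≤s z≤n))) (≤⇒≯ (≤-reflexive rv))
    ... | inj₁ j<i = record
      { chosen = c ; chosen< = Choice.chosen< old
      ; ranked = trans (r′≡r c (Choice.chosen< old) c≢w) (Choice.ranked old)
      ; unique = unique ; maximal = maximal-old i j≤i c (Choice.maximal old) }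
      where
      old = choice i j<i i<n
      c = Choice.chosen old
      c≢w : c ≢ w
      c≢w refl = contradiction (trans (sym rw≡0) (Choice.ranked old)) λ ()
      unique : ∀ v → v < n → r′ v ≡ suc i → v ≡ c
      unique v v<n eq with v ≟ w
      ... | yes refl = contradiction (suc-injective (trans (sym r′w) eq)) (<⇒≢ j<i)
      ... | no v≢w = Choice.unique old v v<n (trans (sym (r′≡r v v<n v≢w)) eq)

  module Finished {key : ℕ → ℕ → ℕ} {r : ℕ → ℕ} (g : Greedy key r 0) where
    open Greedy g public

    everything : ∀ v → v < n → outside (above r 0 v) ≡ 0
    everything v v<n = n≤0⇒n≡0 (≤-trans (term≤∑ n (λ w → outside (above r 0 w)) v<n) (≤-reflexive (missing≡ 0 z≤n z≤n)))

    -- The chosen insertion scores at least as well as any other. If it were not good, no insertion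
    -- would be, which `Improvable` excludes.
    good-above : ∀ {s} → Improvable key s →
      (∀ {χ} → (∀ v → v < n → outside (χ v) ≡ 1) → Good key s χ) →
      (∀ {χ} → (∀ v → v < n → outside (χ v) ≡ 0) → Good key s χ) →
      ∀ i → i ≤ n → Good key s (above r i)
    good-above {s} improvable all none = λ i i≤n → go (n ∸ i) i (m∸n+n≡m i≤n)
      where
      go : ∀ k i → k + i ≡ n → Good key s (above r i)
      go zero    i       refl = all {above r i} above-top
      go (suc k) zero    _    = none {above r 0} everything
      go (suc k) (suc i) k+i≡n with m * m ≤? score key (above r (2 + i) ⊕ Choice.chosen c) + s
        where c = choice (suc i) z≤n (≤-trans (s≤s (m≤n+m (suc i) k)) (≤-reflexive k+i≡n))
      ... | yes good = subst (λ t → m * m ≤ t + s) (sym (score-cong key (Choice.above≈ c))) good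
        where c = choice (suc i) z≤n (≤-trans (s≤s (m≤n+m (suc i) k)) (≤-reflexive k+i≡n))
      ... | no ¬good = ⊥-elim (improvable (above r (2 + i))
          (≤-trans (s≤s (s≤s z≤n)) (≤-reflexive (sym (missing≡ (2 + i) z≤n i<n))))
          (go k (2 + i) (trans (+-suc k (suc i)) k+i≡n))
          λ w w<n w∉ good → ¬good (≤-trans good (+-monoˡ-≤ s (Choice.maximal c w w<n w∉))))
        where
        i<n : suc i < n
        i<n = ≤-trans (s≤s (m≤n+m (suc i) k)) (≤-reflexive k+i≡n)
        c = choice (suc i) z≤n i<n

    -- The function `h` is the part of a union that comes from the other chain. Thresholds from `n`
    -- on are included because `Grid` wants the bound for all indices; there nothing changes.
    step : ∀ d → (∀ v → v < n → deg v ≤ d) → ∀ (h : ℕ → ℕ) i →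
      within (λ v → (r v ∸ i) + h v) + avoiding (λ v → (r v ∸ suc i) + h v)
        ≤ within (λ v → (r v ∸ suc i) + h v) + avoiding (λ v → (r v ∸ i) + h v) + d
    step d deg≤d h i with i <? n
    ... | yes i<n = ≤-trans (one-vertex-step {χ} {χ′} chosen up down) (+-monoʳ-≤ _ (deg≤d chosen chosen<))
      where
      open Choice (choice i z≤n i<n)
      χ χ′ : ℕ → ℕ
      χ v = (r v ∸ suc i) + h v
      χ′ v = (r v ∸ i) + h v
      down : ∀ v → v < n → outside (χ′ v) ≤ outside (χ v)
      down v _ = outside-antimono (+-monoˡ-≤ (h v) (∸-monoʳ-≤ (r v) (n≤1+n i)))
      up : ∀ v → v < n → outside (χ v) ≤ outside (χ′ v) + δ v chosen
      up v v<n with v ≟ chosen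
      ... | yes refl = ≤-trans (outside≤1 (χ v)) (≤-trans (≤-reflexive (sym (δ-refl v))) (m≤n+m _ _))
      ... | no v≢ = ≤-trans (≤-reflexive (sym (outside-∸-suc (r v) i (h v) λ eq → v≢ (unique v v<n eq)))) (m≤m+n _ _)
    ... | no i≮n = ≤-trans (≤-reflexive (cong₂ _+_
          (within-cong {λ v → (r v ∸ i) + h v} {λ v → (r v ∸ suc i) + h v} same)
          (sym (avoiding-cong {λ v → (r v ∸ i) + h v} {λ v → (r v ∸ suc i) + h v} same)))) (m≤m+n _ d)
      where
      same : ∀ v → v < n → outside ((r v ∸ i) + h v) ≡ outside ((r v ∸ suc i) + h v)
      same v v<n = outside-∸-suc (r v) i (h v) λ eq → i≮n (≤-trans (≤-reflexive (sym eq)) (bounded v v<n))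

  union : (ℕ → ℕ) → (ℕ → ℕ) → ℕ → ℕ → (ℕ → ℕ)
  union r r′ i j v = (r v ∸ i) + (r′ v ∸ j)

  -- The index `i` belongs to the chain with small Ψ and `j` to the one with large Ψ. Threshold `n`
  -- switches a chain off, so `ample` holds along `j = n` and `unsaturated` along `i = n`.
  balanced-union : ∀ {r r′} → Greedy (uncutKey m) r 0 → Greedy (cutKey m) r′ 0 →
    ∀ d → (∀ v → v < n → deg v ≤ d) →
    ∃[ i ] ∃[ j ] i ≤ n × j ≤ n × Near m d (within (union r r′ i j)) (avoiding (union r r′ i j))
  balanced-union {r} {r′} g g′ d deg≤d = Grid.hit n m d
    (λ i j → within (union r r′ i j)) (λ i j → avoiding (union r r′ i j))
    (λ {i} {i′} j i≤i′ → within-mono {union r r′ i′ j} {union r r′ i j} λ v _ →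
       outside-antimono (+-monoˡ-≤ (r′ v ∸ j) (∸-monoʳ-≤ (r v) i≤i′)))
    (λ i j → within-mono {union r r′ i (suc j)} {union r r′ i j} λ v _ →
       outside-antimono (+-monoʳ-≤ (r v ∸ i) (∸-monoʳ-≤ (r′ v) (n≤1+n j))))
    (λ {i} {i′} j i≤i′ → avoiding-antimono {union r r′ i′ j} {union r r′ i j} λ v _ →
       outside-antimono (+-monoˡ-≤ (r′ v ∸ j) (∸-monoʳ-≤ (r v) i≤i′)))
    (λ i j → F.step d deg≤d (λ v → r′ v ∸ j) i)
    (λ i j → subst₂ _≤_
       (cong₂ _+_ (within-cong (flip i j)) (avoiding-cong (flip i (suc j))))
       (cong (_+ d) (cong₂ _+_ (within-cong (flip i (suc j))) (avoiding-cong (flip i j))))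
       (F′.step d deg≤d (λ v → r v ∸ i) j))
    (within-none {union r r′ 0 n} λ v v<n → n≤0⇒n≡0 (≤-trans (outside-antimono (m≤m+n (r v) (r′ v ∸ n))) (≤-reflexive (F.everything v v<n))))
    (λ i → avoiding-none {union r r′ i 0} λ v v<n → n≤0⇒n≡0 (≤-trans (outside-antimono (m≤n+m (r′ v) (r v ∸ i))) (≤-reflexive (F′.everything v v<n))))
    (within-all {union r r′ n n} all) (avoiding-all {union r r′ n n} all)
    (λ i i≤n → subst (λ t → m ≤ 2 * t + d)
       (cong₂ _+_ (within-cong (rightmost i)) (avoiding-cong (rightmost i)))
       (good-uncut⇒ample {above r i} d (F.good-above (uncut-improvable d deg≤d)
         (λ {χ} → good-uncut-all {χ} (d * m)) (λ {χ} → good-uncut-none {χ} (d * m)) i i≤n)))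
    (λ j j≤n m<4x m<4y → good-cut⇒unsaturated {above r′ j}
       (F′.good-above cut-improvable (λ {χ} → good-cut-all {χ}) (λ {χ} → good-cut-none {χ}) j j≤n)
       (subst (λ t → m < 4 * t) (within-cong (topmost j)) m<4x)
       (subst (λ t → m < 4 * t) (avoiding-cong (topmost j)) m<4y))
    where
    module F = Finished g
    module F′ = Finished g′

    flip : ∀ i j → (λ v → (r′ v ∸ j) + (r v ∸ i)) ≈ union r r′ i j
    flip i j v _ = cong outside (+-comm (r′ v ∸ j) (r v ∸ i))

    all : ∀ v → v < n → outside (union r r′ n n v) ≡ 1
    all v v<n rewrite m≤n⇒m∸n≡0 (F.bounded v v<n) | m≤n⇒m∸n≡0 (F′.bounded v v<n) = refl

    rightmost : ∀ i → above r i ≈ union r r′ i n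
    rightmost i v v<n rewrite m≤n⇒m∸n≡0 (F′.bounded v v<n) | +-identityʳ (r v ∸ i) = refl

    topmost : ∀ j → union r r′ n j ≈ above r′ j
    topmost j v v<n rewrite m≤n⇒m∸n≡0 (F.bounded v v<n) = refl

-- Counting-loop programs

one : Reg
one = 4

infixr 10 _▹_

-- Programs whose only loops are counting loops: for c k b runs b with c = k - 1, …, 0.
-- The register one is reset to 1 at the start of every iteration.
data Code : Set where
  nop        : Code
  set        : Reg → ℕ → Code
  plus minus : Reg → Reg → Reg → Code
  get put    : Reg → Reg → Code
  _▹_        : Code → Code → Code
  branch     : Reg → Code → Code → Code
  for        : Reg → Reg → Code → Code

compile : Code → Program
compile nop            = skip
compile (set x a)      = x ≔ a
compile (plus x y z)   = x ≔[ y ⊞ z ]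
compile (minus x y z)  = x ≔[ y ⊟ z ]
compile (get x y)      = x ≔mem[ y ]
compile (put x y)      = mem[ x ]≔ y
compile (p ▹ q)        = compile p ⨾ compile q
compile (branch x p q) = ifNonzero x (compile p) (compile q)
-- A register is copied by adding it to 0; the same idiom with `set tᵣ 0` recurs in the algorithm.
compile (for c k b)    = c ≔ 0 ⨾ c ≔[ k ⊞ c ] ⨾
  whileNonzero c (one ≔ 1 ⨾ c ≔[ c ⊟ one ] ⨾ compile b)

ifZero : {A : Set} → ℕ → A → A → A
ifZero zero    a b = a
ifZero (suc _) a b = b

enter : Reg → ℕ → State → State
enter c j s = setReg c j (setReg one 1 s)

prepare : Reg → Reg → State → State
prepare c k s = setReg c (reg s₁ k + reg s₁ c) s₁
  where s₁ = setReg c 0 s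

repeat : (State → State) → Reg → ℕ → State → State
repeat f c zero    s = s
repeat f c (suc j) s = repeat f c j (f (enter c j s))

-- Kept opaque, as composite programs would otherwise unfold into huge terms.
opaque
  ⟦_⟧ : Code → State → State
  ⟦ nop ⟧          s = s
  ⟦ set x a ⟧      s = setReg x a s
  ⟦ plus x y z ⟧   s = setReg x (reg s y + reg s z) s
  ⟦ minus x y z ⟧  s = setReg x (reg s y ∸ reg s z) s
  ⟦ get x y ⟧      s = setReg x (mem s (reg s y)) s
  ⟦ put x y ⟧      s = setMem (reg s x) (reg s y) s
  ⟦ p ▹ q ⟧        s = ⟦ q ⟧ (⟦ p ⟧ s)
  ⟦ branch x p q ⟧ s = ifZero (reg s x) (⟦ q ⟧ s) (⟦ p ⟧ s)
  ⟦ for c k b ⟧    s = repeat ⟦ b ⟧ c (reg (prepare c k s) c) (prepare c k s)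

-- Stated through the Boolean test so that it computes to `⊤` for concrete registers. Side
-- conditions such as `Fresh` and `Capped` can then be left to `_`.
_≠_ : Reg → Reg → Set
x ≠ y = T (not (x ≡ᵇ y))

Fresh : Reg → Code → Set
Fresh r nop            = ⊤
Fresh r (set x a)      = r ≠ x
Fresh r (plus x y z)   = r ≠ x
Fresh r (minus x y z)  = r ≠ x
Fresh r (get x y)      = r ≠ x
Fresh r (put x y)      = ⊤
Fresh r (p ▹ q)        = Fresh r p × Fresh r q
Fresh r (branch x p q) = Fresh r p × Fresh r q
Fresh r (for c k b)    = (r ≠ c) × (r ≠ one) × Fresh r b

StoreFree : Code → Set
StoreFree (put x y)      = ⊥
StoreFree (p ▹ q)        = StoreFree p × StoreFree q
StoreFree (branch x p q) = StoreFree p × StoreFree q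
StoreFree (for c k b)    = StoreFree b
StoreFree _              = ⊤

update-other : ∀ f {r x} a → r ≠ x → (f [ x ↦ a ]) r ≡ f r
update-other f {r} {x} a r≠x with r ≡ᵇ x
... | false = refl

update-same : ∀ f x a → (f [ x ↦ a ]) x ≡ a
update-same f x a with x ≡ᵇ x in eq
... | true  = refl
... | false = ⊥-elim (subst T eq (≡⇒≡ᵇ x x refl))

prepare-counter : ∀ c k s → k ≠ c → reg (prepare c k s) c ≡ reg s k
prepare-counter c k s k≠c = trans (update-same (reg (setReg c 0 s)) c _)
  (trans (cong₂ _+_ (update-other (reg s) 0 k≠c) (update-same (reg s) c 0)) (+-identityʳ _))

opaque
  unfolding ⟦_⟧

  frame : ∀ c {r} s → Fresh r c → reg (⟦ c ⟧ s) r ≡ reg s r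
  frame-repeat : ∀ b c {r} j s → Fresh r b → r ≠ c → r ≠ one → reg (repeat ⟦ b ⟧ c j s) r ≡ reg s r

  frame nop s _ = refl
  frame (set x a) s r≠x = update-other (reg s) _ r≠x
  frame (plus x y z) s r≠x = update-other (reg s) _ r≠x
  frame (minus x y z) s r≠x = update-other (reg s) _ r≠x
  frame (get x y) s r≠x = update-other (reg s) _ r≠x
  frame (put x y) s _ = refl
  frame (p ▹ q) s (fp , fq) = trans (frame q (⟦ p ⟧ s) fq) (frame p s fp)
  frame (branch x p q) s (fp , fq) with reg s x
  ... | zero  = frame q s fq
  ... | suc _ = frame p s fp
  frame (for c k b) s (r≠c , r≠one , fb) =
    trans (frame-repeat b c (reg (prepare c k s) c) (prepare c k s) fb r≠c r≠one)
      (trans (update-other (reg (setReg c 0 s)) _ r≠c) (update-other (reg s) 0 r≠c))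

  frame-repeat b c zero    s fb r≠c r≠one = refl
  frame-repeat b c (suc j) s fb r≠c r≠one =
    trans (frame-repeat b c j _ fb r≠c r≠one)
      (trans (frame b (enter c j s) fb)
        (trans (update-other (reg (setReg one 1 s)) j r≠c) (update-other (reg s) 1 r≠one)))

  memory : ∀ c s → StoreFree c → mem (⟦ c ⟧ s) ≡ mem s
  memory-repeat : ∀ b c j s → StoreFree b → mem (repeat ⟦ b ⟧ c j s) ≡ mem s

  memory nop s _ = refl
  memory (set x a) s _ = refl
  memory (plus x y z) s _ = refl
  memory (minus x y z) s _ = refl
  memory (get x y) s _ = refl
  memory (p ▹ q) s (pp , pq) = trans (memory q (⟦ p ⟧ s) pq) (memory p s pp)
  memory (branch x p q) s (pp , pq) with reg s x
  ... | zero  = memory q s pq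
  ... | suc _ = memory p s pp
  memory (for c k b) s pb = memory-repeat b c (reg (prepare c k s) c) (prepare c k s) pb

  memory-repeat b c zero    s pb = refl
  memory-repeat b c (suc j) s pb = trans (memory-repeat b c j _ pb) (memory b (enter c j s) pb)

Framed : Code → State → State → Set
Framed c s t = (∀ r → Fresh r c → reg t r ≡ reg s r) × (StoreFree c → mem t ≡ mem s)

opaque
  unfolding ⟦_⟧

  -- This and the next two rules are the only access to composite programs from outside the opaque
  -- blocks; each exposes a single level of the semantics.
  ▹-intro : ∀ (P : State → Set) {p q s} → P (⟦ q ⟧ (⟦ p ⟧ s)) → P (⟦ p ▹ q ⟧ s)
  ▹-intro P x = x

  branch-intro : ∀ (P : State → Set) {x p q s} → (reg s x ≡ 0 → P (⟦ q ⟧ s)) → (reg s x ≢ 0 → P (⟦ p ⟧ s)) →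
    P (⟦ branch x p q ⟧ s)
  branch-intro P {x} {s = s} z nz with reg s x
  ... | zero  = z refl
  ... | suc _ = nz λ ()

  -- The invariant is indexed by the number of iterations still to come. `Framed` supplies whatever
  -- the loop never writes, so that an invariant has to mention only what changes.
  for-rule : ∀ c k b s (P : ℕ → State → Set) → k ≠ c →
    P (reg s k) (prepare c k s) →
    (∀ j t → j < reg s k → Framed (for c k b) s t → P (suc j) t → P j (⟦ b ⟧ (enter c j t))) →
    P 0 (⟦ for c k b ⟧ s)
  for-rule c k b s P k≠c base step =
    subst (λ j → P 0 (repeat ⟦ b ⟧ c j (prepare c k s))) (sym (prepare-counter c k s k≠c))
      (go (reg s k) (prepare c k s) ≤-refl
        ((λ r (r≠c , _) → trans (update-other (reg (setReg c 0 s)) _ r≠c) (update-other (reg s) 0 r≠c)) , λ _ → refl)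
        base)
    where
    go : ∀ j t → j ≤ reg s k → Framed (for c k b) s t → P j t → P 0 (repeat ⟦ b ⟧ c j t)
    go zero    t _   _  p = p
    go (suc j) t j<k fr p = go j _ (<⇒≤ j<k)
      ( (λ r fr′@(r≠c , r≠one , fb) → trans (frame b (enter c j t) fb)
          (trans (update-other (reg (setReg one 1 t)) j r≠c)
            (trans (update-other (reg t) 1 r≠one) (proj₁ fr r fr′))))
      , (λ pb → trans (memory b (enter c j t) pb) (proj₂ fr pb)) )
      (step j t j<k fr p)

-- Compiled programs: exact running times and a polynomial bound

WellFormed : Code → Set
WellFormed (p ▹ q)        = WellFormed p × WellFormed q
WellFormed (branch x p q) = WellFormed p × WellFormed q
WellFormed (for c k b)    = (c ≠ one) × Fresh c b × WellFormed b
WellFormed _              = ⊤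

repeatTime : (State → State) → (State → ℕ) → Reg → ℕ → State → ℕ
repeatTime f t c zero    s = 1
repeatTime f t c (suc j) s = suc ((1 + (1 + t (enter c j s))) + repeatTime f t c j (f (enter c j s)))

time : Code → State → ℕ
time nop            s = 0
time (p ▹ q)        s = time p s + time q (⟦ p ⟧ s)
time (branch x p q) s = suc (ifZero (reg s x) (time q s) (time p s))
time (for c k b)    s = 1 + (1 + repeatTime ⟦ b ⟧ (time b) c (reg (prepare c k s) c) (prepare c k s))
time _              s = 1

opaque
  unfolding ⟦_⟧

  -- `WellFormed` keeps the body of a loop from touching its counter. The number of iterations is
  -- thus fixed on entry, and the while loop agrees with `repeat`.
  simulate : ∀ c → WellFormed c → ∀ s → ⟪ compile c , s ⟫⇓[ time c s ] ⟦ c ⟧ s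
  simulate-repeat : ∀ c b → c ≠ one → Fresh c b → WellFormed b → ∀ j s → reg s c ≡ j →
    ⟪ whileNonzero c (one ≔ 1 ⨾ c ≔[ c ⊟ one ] ⨾ compile b) , s ⟫⇓[ repeatTime ⟦ b ⟧ (time b) c j s ] repeat ⟦ b ⟧ c j s

  simulate nop wf s = skip
  simulate (set x a) wf s = const
  simulate (plus x y z) wf s = add
  simulate (minus x y z) wf s = sub
  simulate (get x y) wf s = load
  simulate (put x y) wf s = store
  simulate (p ▹ q) (wp , wq) s = seq (simulate p wp s) (simulate q wq (⟦ p ⟧ s))
  simulate (branch x p q) (wp , wq) s with reg s x in eq
  ... | zero  = if≡0 eq (simulate q wq s)
  ... | suc _ = if≢0 (λ x≡0 → 1+n≢0 (trans (sym eq) x≡0)) (simulate p wp s)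
  simulate (for c k b) (c≠one , fb , wb) s =
    seq const (seq add (simulate-repeat c b c≠one fb wb _ (prepare c k s) refl))

  simulate-repeat c b c≠one fb wb zero    s eq = exit eq
  simulate-repeat c b c≠one fb wb (suc j) s eq =
    loop (λ c≡0 → 1+n≢0 (trans (sym eq) c≡0))
      (seq const (seq (subst (λ a → ⟪ c ≔[ c ⊟ one ] , setReg one 1 s ⟫⇓[ 1 ] setReg c a (setReg one 1 s)) counter sub)
        (simulate b wb (enter c j s))))
      (simulate-repeat c b c≠one fb wb j _ (trans (frame b (enter c j s) fb) entered))
    where
    counter : reg (setReg one 1 s) c ∸ 1 ≡ j
    counter = cong (_∸ 1) (trans (update-other (reg s) 1 c≠one) eq)
    entered : reg (enter c j s) c ≡ j
    entered = update-same (reg (setReg one 1 s)) c j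

-- The registers below 4 serve as loop bounds and are never written.
Capped : Code → Set
Capped nop            = ⊤
Capped (set x a)      = T (3 <ᵇ x)
Capped (plus x y z)   = T (3 <ᵇ x)
Capped (minus x y z)  = T (3 <ᵇ x)
Capped (get x y)      = T (3 <ᵇ x)
Capped (put x y)      = ⊤
Capped (p ▹ q)        = Capped p × Capped q
Capped (branch x p q) = Capped p × Capped q
Capped (for c k b)    = T (3 <ᵇ c) × T (k <ᵇ 4) × Capped b

low≠high : ∀ {r x} → r < 4 → T (3 <ᵇ x) → r ≠ x
low≠high {r} {x} r<4 3<x with r ≡ᵇ x in eq
... | false = tt
... | true  with refl ← ≡ᵇ⇒≡ r x (subst T (sym eq) tt) = contradiction (<ᵇ⇒< 3 x 3<x) (≤⇒≯ (≤-pred r<4))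

capped-fresh : ∀ c {r} → r < 4 → Capped c → Fresh r c
capped-fresh nop            lt _ = tt
capped-fresh (set x a)      lt x> = low≠high lt x>
capped-fresh (plus x y z)   lt x> = low≠high lt x>
capped-fresh (minus x y z)  lt x> = low≠high lt x>
capped-fresh (get x y)      lt x> = low≠high lt x>
capped-fresh (put x y)      lt _ = tt
capped-fresh (p ▹ q)        lt (cp , cq) = capped-fresh p lt cp , capped-fresh q lt cq
capped-fresh (branch x p q) lt (cp , cq) = capped-fresh p lt cp , capped-fresh q lt cq
capped-fresh (for c k b)    lt (c> , _ , cb) = low≠high lt c> , low≠high {x = one} lt tt , capped-fresh b lt cb

weight depth : Code → ℕ
weight (p ▹ q)        = weight p + weight q
weight (branch x p q) = suc (weight p + weight q)
-- Each iteration pays 3 for the test, the reset of `one` and the decrement. Another 3 pay for the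
-- two initial assignments and the final test; they fit in because the bound has a factor `suc W`
-- rather than `W`.
weight (for c k b)    = 3 + weight b
weight _              = 1
depth (p ▹ q)        = depth p ⊔ depth q
depth (branch x p q) = depth p ⊔ depth q
depth (for c k b)    = suc (depth b)
depth _              = 0

module _ {W : ℕ} where

  Within : State → Set
  Within s = ∀ {k} → k < 4 → reg s k ≤ W

  private
    budget : ℕ → ℕ → ℕ
    budget w e = w * suc W ^ e

    1≤pow : ∀ e → 1 ≤ suc W ^ e
    1≤pow e = m^n>0 (suc W) e

    budget-mono : ∀ w {e e′} → e ≤ e′ → budget w e ≤ budget w e′
    budget-mono w e≤e′ = *-monoʳ-≤ w (^-monoʳ-≤ (suc W) e≤e′)

    w≤budget : ∀ w e → w ≤ budget w e
    w≤budget w e = ≤-trans (≤-reflexive (sym (*-identityʳ w))) (*-monoʳ-≤ w (1≤pow e))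

    within-step : ∀ c {s} → Capped c → Within s → Within (⟦ c ⟧ s)
    within-step c {s} cap w lt = ≤-trans (≤-reflexive (frame c s (capped-fresh c lt cap))) (w lt)

    within-enter : ∀ c {j s} → T (3 <ᵇ c) → Within s → Within (enter c j s)
    within-enter c {j} {s} c> w lt = ≤-trans (≤-reflexive
      (trans (update-other (reg (setReg one 1 s)) j (low≠high lt c>)) (update-other (reg s) 1 (low≠high {x = one} lt tt)))) (w lt)

  time-bound : ∀ c → Capped c → ∀ s → Within s → time c s ≤ weight c * suc W ^ depth c
  repeat-bound : ∀ c b → T (3 <ᵇ c) → Capped b → ∀ j s → Within s →
    repeatTime ⟦ b ⟧ (time b) c j s ≤ 1 + j * (3 + weight b * suc W ^ depth b)

  time-bound nop            _ s w = z≤n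
  time-bound (set x a)      _ s w = ≤-refl
  time-bound (plus x y z)   _ s w = ≤-refl
  time-bound (minus x y z)  _ s w = ≤-refl
  time-bound (get x y)      _ s w = ≤-refl
  time-bound (put x y)      _ s w = ≤-refl
  time-bound (p ▹ q) (cp , cq) s w = begin
    time p s + time q (⟦ p ⟧ s)
      ≤⟨ +-mono-≤ (time-bound p cp s w) (time-bound q cq (⟦ p ⟧ s) (within-step p cp w)) ⟩
    budget (weight p) (depth p) + budget (weight q) (depth q)
      ≤⟨ +-mono-≤ (budget-mono (weight p) (m≤m⊔n (depth p) (depth q))) (budget-mono (weight q) (m≤n⊔m (depth p) (depth q))) ⟩
    budget (weight p) (depth p ⊔ depth q) + budget (weight q) (depth p ⊔ depth q)
      ≡⟨ *-distribʳ-+ (suc W ^ (depth p ⊔ depth q)) (weight p) (weight q) ⟨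
    budget (weight p + weight q) (depth p ⊔ depth q) ∎
    where open ≤-Reasoning
  time-bound (branch x p q) (cp , cq) s w = begin
    suc (ifZero (reg s x) (time q s) (time p s))
      ≤⟨ s≤s (either (reg s x)) ⟩
    suc (time p s + time q s)
      ≤⟨ s≤s (+-mono-≤ (time-bound p cp s w) (time-bound q cq s w)) ⟩
    suc (budget (weight p) (depth p) + budget (weight q) (depth q))
      ≤⟨ +-mono-≤ (1≤pow e) (+-mono-≤ (budget-mono (weight p) (m≤m⊔n (depth p) (depth q))) (budget-mono (weight q) (m≤n⊔m (depth p) (depth q)))) ⟩
    suc W ^ e + (budget (weight p) e + budget (weight q) e)
      ≡⟨ cong (suc W ^ e +_) (*-distribʳ-+ (suc W ^ e) (weight p) (weight q)) ⟨
    budget (suc (weight p + weight q)) e ∎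
    where
    open ≤-Reasoning
    e = depth p ⊔ depth q
    either : ∀ a → ifZero a (time q s) (time p s) ≤ time p s + time q s
    either zero    = m≤n+m _ _
    either (suc _) = m≤m+n _ _
  time-bound (for c k b) (c> , k< , cb) s w = begin
    2 + repeatTime ⟦ b ⟧ (time b) c j s′
      ≤⟨ +-monoʳ-≤ 2 (repeat-bound c b c> cb j s′ w′) ⟩
    3 + j * (3 + B)
      ≤⟨ +-monoʳ-≤ 3 (*-monoˡ-≤ (3 + B) j≤W) ⟩
    3 + W * (3 + B)
      ≤⟨ +-monoˡ-≤ (W * (3 + B)) (m≤m+n 3 B) ⟩
    suc W * (3 + B)
      ≤⟨ *-monoʳ-≤ (suc W) (+-monoˡ-≤ B (w≤budget 3 (depth b))) ⟩
    suc W * (budget 3 (depth b) + B)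
      ≡⟨ regroup (suc W) (suc W ^ depth b) (weight b) ⟩
    (3 + weight b) * (suc W * suc W ^ depth b) ∎
    where
    open ≤-Reasoning
    B = budget (weight b) (depth b)
    s′ = prepare c k s
    j = reg s′ c
    regroup : ∀ V p w → V * (3 * p + w * p) ≡ (3 + w) * (V * p)
    regroup = solve-∀
    w′ : Within s′
    w′ lt = ≤-trans (≤-reflexive (trans (update-other (reg (setReg c 0 s)) _ (low≠high lt c>)) (update-other (reg s) 0 (low≠high lt c>)))) (w lt)
    k≠c : k ≠ c
    k≠c = low≠high (<ᵇ⇒< k 4 k<) c>
    j≤W : j ≤ W
    j≤W = ≤-trans (≤-reflexive (prepare-counter c k s k≠c)) (w (<ᵇ⇒< k 4 k<))

  repeat-bound c b c> cb zero    s w = ≤-refl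
  repeat-bound c b c> cb (suc j) s w = begin
    3 + time b s₁ + repeatTime ⟦ b ⟧ (time b) c j (⟦ b ⟧ s₁)
      ≤⟨ +-mono-≤ (+-monoʳ-≤ 3 (time-bound b cb s₁ w₁)) (repeat-bound c b c> cb j (⟦ b ⟧ s₁) (within-step b cb w₁)) ⟩
    3 + B + (1 + j * (3 + B))
      ≡⟨ +-suc (3 + B) _ ⟩
    1 + suc j * (3 + B) ∎
    where
    open ≤-Reasoning
    B = weight b * suc W ^ depth b
    s₁ = enter c j s
    w₁ : Within s₁
    w₁ {k} lt = within-enter c {j} {s} c> w {k} lt

-- The algorithm

lenᵣ nᵣ mᵣ n⁺ᵣ : Reg
lenᵣ = 0
nᵣ = 1
mᵣ = 2
n⁺ᵣ = 3

loᵣ hiᵣ iᵣ jᵣ wᵣ vᵣ bᵣ b′ᵣ tᵣ uᵣ eᵣ pᵣ xᵣ yᵣ sᵣ dᵣ kᵣ k′ᵣ cᵣ rᵣ bestᵣ argᵣ arg′ᵣ qᵣ modeᵣ : Reg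
loᵣ = 5
hiᵣ = 6
iᵣ = 7
jᵣ = 8
wᵣ = 9
vᵣ = 10
bᵣ = 11
b′ᵣ = 12
tᵣ = 13
uᵣ = 14
eᵣ = 15
pᵣ = 16
xᵣ = 17
yᵣ = 18
sᵣ = 19
dᵣ = 20
kᵣ = 21
k′ᵣ = 22
cᵣ = 23
rᵣ = 24
bestᵣ = 25
argᵣ = 26
arg′ᵣ = 27
qᵣ = 28
modeᵣ = 29

-- b := a number that is nonzero iff v lies in the current set, consisting of w, of the
-- vertices ranked above i by the array at lo, and of those ranked above j by the one at hi.
member : Reg → Code
member b = plus tᵣ loᵣ vᵣ ▹ get tᵣ tᵣ ▹ minus b tᵣ iᵣ ▹
  plus tᵣ hiᵣ vᵣ ▹ get tᵣ tᵣ ▹ minus tᵣ tᵣ jᵣ ▹ plus b b tᵣ ▹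
  minus tᵣ vᵣ wᵣ ▹ minus uᵣ wᵣ vᵣ ▹ plus tᵣ tᵣ uᵣ ▹ minus tᵣ one tᵣ ▹ plus b b tᵣ

tally : Code
tally = branch bᵣ (branch b′ᵣ (plus xᵣ xᵣ one) nop) (branch b′ᵣ nop (plus yᵣ yᵣ one))

-- Behind the order and the size, edge `e` occupies the addresses 2e + 2 and 2e + 3; the first is
-- computed by doubling e + 1.
source target edge clear evaluate : Code
source = plus pᵣ eᵣ one ▹ plus pᵣ pᵣ pᵣ ▹ get vᵣ pᵣ
target = plus pᵣ pᵣ one ▹ get vᵣ pᵣ
edge = source ▹ member bᵣ ▹ target ▹ member b′ᵣ ▹ tally
clear = set xᵣ 0 ▹ set yᵣ 0
evaluate = clear ▹ for eᵣ mᵣ edge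

-- k := s * r, provided s ≤ m
multiply addend : Code
addend = minus uᵣ sᵣ cᵣ ▹ branch uᵣ (plus kᵣ kᵣ rᵣ) nop
multiply = set kᵣ 0 ▹ for cᵣ mᵣ addend

-- Keys are compared after adding 1, so that 0 in `bestᵣ` means that no candidate has been seen,
-- even if all keys are 0.
better : Code
better = set tᵣ 1 ▹ plus kᵣ kᵣ tᵣ ▹ minus tᵣ kᵣ bestᵣ ▹
  branch tᵣ (set tᵣ 0 ▹ plus bestᵣ kᵣ tᵣ ▹ plus argᵣ wᵣ tᵣ) nop

-- Mode 0 makes Ψ small, the other modes make it large.
keyOf : ℕ → ℕ → ℕ → ℕ → ℕ
keyOf mode = ifZero mode uncutKey cutKey

value : (ℕ → ℕ) → ℕ → ℕ → ℕ → ℕ → ℕ → ℕ → ℕ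
value μ lo hi i j w v = (μ (lo + v) ∸ i) + (μ (hi + v) ∸ j) + δ v w

memberValue : State → ℕ → ℕ
memberValue s = value (mem s) (reg s loᵣ) (reg s hiᵣ) (reg s iᵣ) (reg s jᵣ) (reg s wᵣ)

-- Correctness of the evaluation of a single candidate

record Same (s t : State) : Set where
  field
    lo≡ : reg t loᵣ ≡ reg s loᵣ
    hi≡ : reg t hiᵣ ≡ reg s hiᵣ
    i≡  : reg t iᵣ ≡ reg s iᵣ
    j≡  : reg t jᵣ ≡ reg s jᵣ
    w≡  : reg t wᵣ ≡ reg s wᵣ
    mem≡ : mem t ≡ mem s

value-cong : ∀ {lo lo′ hi hi′ i i′ j j′ w w′ μ μ′} → lo ≡ lo′ → hi ≡ hi′ → i ≡ i′ → j ≡ j′ → w ≡ w′ → μ ≡ μ′ →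
  ∀ v → value μ lo hi i j w v ≡ value μ′ lo′ hi′ i′ j′ w′ v
value-cong refl refl refl refl refl refl v = refl

memberValue-same : ∀ {s t} → Same s t → ∀ v → memberValue t v ≡ memberValue s v
memberValue-same same = value-cong lo≡ hi≡ i≡ j≡ w≡ mem≡
  where open Same same

opaque
  unfolding ⟦_⟧

  -- Holds by symbolic execution once the content of `one` is replaced by 1, as `value` was written
  -- to match the instructions.
  member-spec : ∀ s → reg s one ≡ 1 → reg (⟦ member bᵣ ⟧ s) bᵣ ≡ memberValue s (reg s vᵣ)
  member-spec s one≡ = cong (λ o → (mem s (reg s loᵣ + reg s vᵣ) ∸ reg s iᵣ) + (mem s (reg s hiᵣ + reg s vᵣ) ∸ reg s jᵣ)
    + (o ∸ dist (reg s vᵣ) (reg s wᵣ))) one≡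

  member-spec′ : ∀ s → reg s one ≡ 1 → reg (⟦ member b′ᵣ ⟧ s) b′ᵣ ≡ memberValue s (reg s vᵣ)
  member-spec′ s one≡ = cong (λ o → (mem s (reg s loᵣ + reg s vᵣ) ∸ reg s iᵣ) + (mem s (reg s hiᵣ + reg s vᵣ) ∸ reg s jᵣ)
    + (o ∸ dist (reg s vᵣ) (reg s wᵣ))) one≡

  source-v : ∀ s → reg s one ≡ 1 → reg (⟦ source ⟧ s) vᵣ ≡ mem s (reg s eᵣ + 1 + (reg s eᵣ + 1))
  source-v s one≡ = cong (λ o → mem s (reg s eᵣ + o + (reg s eᵣ + o))) one≡

  source-p : ∀ s → reg s one ≡ 1 → reg (⟦ source ⟧ s) pᵣ ≡ reg s eᵣ + 1 + (reg s eᵣ + 1)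
  source-p s one≡ = cong (λ o → reg s eᵣ + o + (reg s eᵣ + o)) one≡

  target-v : ∀ s → reg s one ≡ 1 → reg (⟦ target ⟧ s) vᵣ ≡ mem s (reg s pᵣ + 1)
  target-v s one≡ = cong (λ o → mem s (reg s pᵣ + o)) one≡

  tally-x : ∀ s → reg s one ≡ 1 → reg (⟦ tally ⟧ s) xᵣ ≡ reg s xᵣ + both (reg s bᵣ) (reg s b′ᵣ)
  tally-x s one≡ with reg s bᵣ | reg s b′ᵣ
  ... | zero  | zero  = sym (+-identityʳ _)
  ... | zero  | suc _ = sym (+-identityʳ _)
  ... | suc _ | zero  = sym (+-identityʳ _)
  ... | suc _ | suc _ = cong (reg s xᵣ +_) one≡

  tally-y : ∀ s → reg s one ≡ 1 → reg (⟦ tally ⟧ s) yᵣ ≡ reg s yᵣ + neither (reg s bᵣ) (reg s b′ᵣ)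
  tally-y s one≡ with reg s bᵣ | reg s b′ᵣ
  ... | zero  | zero  = cong (reg s yᵣ +_) one≡
  ... | zero  | suc _ = sym (+-identityʳ _)
  ... | suc _ | zero  = sym (+-identityʳ _)
  ... | suc _ | suc _ = sym (+-identityʳ _)

edge-spec : ∀ s → reg s one ≡ 1 → ∀ {u v} →
  mem s (reg s eᵣ + 1 + (reg s eᵣ + 1)) ≡ u → mem s (reg s eᵣ + 1 + (reg s eᵣ + 1) + 1) ≡ v →
  reg (⟦ edge ⟧ s) xᵣ ≡ reg s xᵣ + both (memberValue s u) (memberValue s v)
  × reg (⟦ edge ⟧ s) yᵣ ≡ reg s yᵣ + neither (memberValue s u) (memberValue s v)
edge-spec s one≡ {u} {v} src≡ tgt≡ = ▹-intro P (▹-intro P (▹-intro P (▹-intro P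
  ( trans (tally-x s₄ one≡₄) (cong₂ _+_ (earlier _ _) (cong₂ both b≡ b′≡))
  , trans (tally-y s₄ one≡₄) (cong₂ _+_ (earlier _ _) (cong₂ neither b≡ b′≡))))))
  where
  P : State → Set
  P t = reg t xᵣ ≡ reg s xᵣ + both (memberValue s u) (memberValue s v)
      × reg t yᵣ ≡ reg s yᵣ + neither (memberValue s u) (memberValue s v)
  s₁ = ⟦ source ⟧ s
  s₂ = ⟦ member bᵣ ⟧ s₁
  s₃ = ⟦ target ⟧ s₂
  s₄ = ⟦ member b′ᵣ ⟧ s₃
  until₃ : ∀ {r} → Fresh r (source ▹ member bᵣ) → Fresh r target → reg s₃ r ≡ reg s r
  until₃ (f₁ , f₂) f₃ = trans (frame target s₂ f₃) (trans (frame (member bᵣ) s₁ f₂) (frame source s f₁))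
  earlier : ∀ {r} → Fresh r (source ▹ member bᵣ ▹ target) → Fresh r (member b′ᵣ) → reg s₄ r ≡ reg s r
  earlier (f₁ , f₂ , f₃) f₄ = trans (frame (member b′ᵣ) s₃ f₄) (until₃ (f₁ , f₂) f₃)
  one≡₄ : reg s₄ one ≡ 1
  one≡₄ = trans (earlier _ _) one≡
  same₁ : Same s s₁
  same₁ = record
    { lo≡ = frame source s _ ; hi≡ = frame source s _ ; i≡ = frame source s _ ; j≡ = frame source s _
    ; w≡ = frame source s _ ; mem≡ = memory source s _ }
  same₃ : Same s s₃
  same₃ = record
    { lo≡ = until₃ _ _ ; hi≡ = until₃ _ _ ; i≡ = until₃ _ _ ; j≡ = until₃ _ _ ; w≡ = until₃ _ _
    ; mem≡ = trans (memory target s₂ _) (trans (memory (member bᵣ) s₁ _) (memory source s _)) }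
  b≡ : reg s₄ bᵣ ≡ memberValue s u
  b≡ = begin
    reg s₄ bᵣ                    ≡⟨ frame (member b′ᵣ) s₃ _ ⟩
    reg s₃ bᵣ                    ≡⟨ frame target s₂ _ ⟩
    reg s₂ bᵣ                    ≡⟨ member-spec s₁ (trans (frame source s _) one≡) ⟩
    memberValue s₁ (reg s₁ vᵣ)   ≡⟨ memberValue-same same₁ (reg s₁ vᵣ) ⟩
    memberValue s (reg s₁ vᵣ)    ≡⟨ cong (memberValue s) (trans (source-v s one≡) src≡) ⟩
    memberValue s u              ∎
    where open ≡-Reasoning
  v≡ : reg s₃ vᵣ ≡ v
  v≡ = begin
    reg s₃ vᵣ                    ≡⟨ target-v s₂ (trans (frame (member bᵣ) s₁ _) (trans (frame source s _) one≡)) ⟩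
    mem s₂ (reg s₂ pᵣ + 1)       ≡⟨ cong₂ (λ μ p → μ (p + 1)) (trans (memory (member bᵣ) s₁ _) (memory source s _))
                                      (trans (frame (member bᵣ) s₁ _) (source-p s one≡)) ⟩
    mem s (reg s eᵣ + 1 + (reg s eᵣ + 1) + 1) ≡⟨ tgt≡ ⟩
    v                            ∎
    where open ≡-Reasoning
  b′≡ : reg s₄ b′ᵣ ≡ memberValue s v
  b′≡ = begin
    reg s₄ b′ᵣ                   ≡⟨ member-spec′ s₃ (trans (until₃ _ _) one≡) ⟩
    memberValue s₃ (reg s₃ vᵣ)   ≡⟨ memberValue-same same₃ (reg s₃ vᵣ) ⟩
    memberValue s (reg s₃ vᵣ)    ≡⟨ cong (memberValue s) v≡ ⟩
    memberValue s v              ∎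
    where open ≡-Reasoning

∑-below : ∀ n a → a ≤ n → ∑ n (λ c → inside (a ∸ c)) ≡ a
∑-below n       zero    _       = ∑-zero n λ c _ → cong inside (0∸n≡0 c)
∑-below (suc n) (suc a) (s≤s a≤n) = trans (∑-head n (λ c → inside (suc a ∸ c))) (cong suc (∑-below n a a≤n))

opaque
  unfolding ⟦_⟧

  set-same : ∀ x a s → reg (⟦ set x a ⟧ s) x ≡ a
  set-same x a s = update-same (reg s) x a

  addend-spec : ∀ s → reg (⟦ addend ⟧ s) kᵣ ≡ reg s kᵣ + inside (reg s sᵣ ∸ reg s cᵣ) * reg s rᵣ
  addend-spec s with reg s sᵣ ∸ reg s cᵣ
  ... | zero  = sym (+-identityʳ _)
  ... | suc _ = cong (reg s kᵣ +_) (sym (+-identityʳ _))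

-- The loop must be bounded by a register that is never written, so it always runs m times and adds
-- `r` only while the counter is below `s`. This suffices, since each product in a key has a factor
-- that is at most m.
multiply-spec : ∀ s → reg s sᵣ ≤ reg s mᵣ → reg (⟦ multiply ⟧ s) kᵣ ≡ reg s sᵣ * reg s rᵣ
multiply-spec s s≤m = ▹-intro (λ t → reg t kᵣ ≡ a * r) (trans (sym (+-identityʳ _)) (for-rule cᵣ mᵣ addend s₀
  (λ j t → reg t kᵣ + ∑ j f ≡ a * r) _
  (trans (cong₂ (λ k b → k + ∑ b f) (set-same kᵣ 0 s) (frame (set kᵣ 0) s _))
    (trans (∑-*ʳ (reg s mᵣ) r _) (cong (_* r) (∑-below (reg s mᵣ) a s≤m))))
  λ j t _ (fr , _) p → trans (trans (cong (_+ ∑ j f) (addend-spec (enter cᵣ j t)))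
    (trans (cong₂ (λ a r → reg t kᵣ + inside (a ∸ j) * r + ∑ j f)
       (trans (fr sᵣ _) (frame (set kᵣ 0) s _)) (trans (fr rᵣ _) (frame (set kᵣ 0) s _)))
     (+-assoc (reg t kᵣ) (f j) (∑ j f)))) p))
  where
  s₀ = ⟦ set kᵣ 0 ⟧ s
  a = reg s sᵣ
  r = reg s rᵣ
  f : ℕ → ℕ
  f c = inside (a ∸ c) * r

gapRegs cutRegs uncutRegs copyGap : Code
gapRegs = minus sᵣ xᵣ yᵣ ▹ minus tᵣ yᵣ xᵣ ▹ plus sᵣ sᵣ tᵣ ▹ set tᵣ 0 ▹ plus rᵣ sᵣ tᵣ
copyGap = set tᵣ 0 ▹ plus k′ᵣ kᵣ tᵣ
cutRegs = minus sᵣ mᵣ xᵣ ▹ minus sᵣ sᵣ yᵣ ▹ plus rᵣ mᵣ mᵣ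
uncutRegs = plus sᵣ xᵣ yᵣ ▹ plus rᵣ mᵣ mᵣ

squareGap cutTerm uncutTerm keyCode : Code
squareGap = gapRegs ▹ multiply ▹ copyGap
cutTerm = cutRegs ▹ multiply ▹ plus kᵣ kᵣ k′ᵣ
uncutTerm = uncutRegs ▹ multiply ▹ minus kᵣ kᵣ k′ᵣ
keyCode = squareGap ▹ branch modeᵣ cutTerm uncutTerm

opaque
  unfolding ⟦_⟧

  gapRegs-s : ∀ s → reg (⟦ gapRegs ⟧ s) sᵣ ≡ dist (reg s xᵣ) (reg s yᵣ)
  gapRegs-s s = refl
  gapRegs-r : ∀ s → reg (⟦ gapRegs ⟧ s) rᵣ ≡ dist (reg s xᵣ) (reg s yᵣ)
  gapRegs-r s = +-identityʳ _
  copyGap-k′ : ∀ s → reg (⟦ copyGap ⟧ s) k′ᵣ ≡ reg s kᵣ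
  copyGap-k′ s = +-identityʳ _
  cutRegs-s : ∀ s → reg (⟦ cutRegs ⟧ s) sᵣ ≡ reg s mᵣ ∸ reg s xᵣ ∸ reg s yᵣ
  cutRegs-s s = refl
  cutRegs-r : ∀ s → reg (⟦ cutRegs ⟧ s) rᵣ ≡ reg s mᵣ + reg s mᵣ
  cutRegs-r s = refl
  uncutRegs-s : ∀ s → reg (⟦ uncutRegs ⟧ s) sᵣ ≡ reg s xᵣ + reg s yᵣ
  uncutRegs-s s = refl
  uncutRegs-r : ∀ s → reg (⟦ uncutRegs ⟧ s) rᵣ ≡ reg s mᵣ + reg s mᵣ
  uncutRegs-r s = refl
  plus-k : ∀ s → reg (⟦ plus kᵣ kᵣ k′ᵣ ⟧ s) kᵣ ≡ reg s kᵣ + reg s k′ᵣ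
  plus-k s = refl
  minus-k : ∀ s → reg (⟦ minus kᵣ kᵣ k′ᵣ ⟧ s) kᵣ ≡ reg s kᵣ ∸ reg s k′ᵣ
  minus-k s = refl

squareGap-spec : ∀ s → reg s xᵣ + reg s yᵣ ≤ reg s mᵣ →
  reg (⟦ squareGap ⟧ s) k′ᵣ ≡ dist (reg s xᵣ) (reg s yᵣ) * dist (reg s xᵣ) (reg s yᵣ)
squareGap-spec s x+y≤m = ▹-intro P (▹-intro P (begin
  reg (⟦ copyGap ⟧ (⟦ multiply ⟧ s₀)) k′ᵣ   ≡⟨ copyGap-k′ _ ⟩
  reg (⟦ multiply ⟧ s₀) kᵣ                  ≡⟨ multiply-spec s₀ small ⟩
  reg s₀ sᵣ * reg s₀ rᵣ                     ≡⟨ cong₂ _*_ (gapRegs-s s) (gapRegs-r s) ⟩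
  dist (reg s xᵣ) (reg s yᵣ) * dist (reg s xᵣ) (reg s yᵣ) ∎))
  where
  open ≡-Reasoning
  P : State → Set
  P t = reg t k′ᵣ ≡ dist (reg s xᵣ) (reg s yᵣ) * dist (reg s xᵣ) (reg s yᵣ)
  s₀ = ⟦ gapRegs ⟧ s
  small : reg s₀ sᵣ ≤ reg s₀ mᵣ
  small = subst₂ _≤_ (sym (gapRegs-s s)) (sym (frame gapRegs s _)) (≤-trans (dist≤+ (reg s xᵣ) (reg s yᵣ)) x+y≤m)

cutTerm-spec : ∀ s → reg (⟦ cutTerm ⟧ s) kᵣ ≡ (reg s mᵣ ∸ reg s xᵣ ∸ reg s yᵣ) * (reg s mᵣ + reg s mᵣ) + reg s k′ᵣ
cutTerm-spec s = ▹-intro P (▹-intro P (begin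
  reg (⟦ plus kᵣ kᵣ k′ᵣ ⟧ (⟦ multiply ⟧ s₀)) kᵣ            ≡⟨ plus-k _ ⟩
  reg (⟦ multiply ⟧ s₀) kᵣ + reg (⟦ multiply ⟧ s₀) k′ᵣ     ≡⟨ cong₂ _+_
      (trans (multiply-spec s₀ small) (cong₂ _*_ (cutRegs-s s) (cutRegs-r s)))
      (trans (frame multiply s₀ _) (frame cutRegs s _)) ⟩
  (reg s mᵣ ∸ reg s xᵣ ∸ reg s yᵣ) * (reg s mᵣ + reg s mᵣ) + reg s k′ᵣ ∎))
  where
  open ≡-Reasoning
  P : State → Set
  P t = reg t kᵣ ≡ (reg s mᵣ ∸ reg s xᵣ ∸ reg s yᵣ) * (reg s mᵣ + reg s mᵣ) + reg s k′ᵣ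
  s₀ = ⟦ cutRegs ⟧ s
  small : reg s₀ sᵣ ≤ reg s₀ mᵣ
  small = subst₂ _≤_ (sym (cutRegs-s s)) (sym (frame cutRegs s _))
    (≤-trans (m∸n≤m (reg s mᵣ ∸ reg s xᵣ) (reg s yᵣ)) (m∸n≤m (reg s mᵣ) (reg s xᵣ)))

uncutTerm-spec : ∀ s → reg s xᵣ + reg s yᵣ ≤ reg s mᵣ →
  reg (⟦ uncutTerm ⟧ s) kᵣ ≡ (reg s xᵣ + reg s yᵣ) * (reg s mᵣ + reg s mᵣ) ∸ reg s k′ᵣ
uncutTerm-spec s x+y≤m = ▹-intro P (▹-intro P (begin
  reg (⟦ minus kᵣ kᵣ k′ᵣ ⟧ (⟦ multiply ⟧ s₀)) kᵣ           ≡⟨ minus-k _ ⟩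
  reg (⟦ multiply ⟧ s₀) kᵣ ∸ reg (⟦ multiply ⟧ s₀) k′ᵣ     ≡⟨ cong₂ _∸_
      (trans (multiply-spec s₀ small) (cong₂ _*_ (uncutRegs-s s) (uncutRegs-r s)))
      (trans (frame multiply s₀ _) (frame uncutRegs s _)) ⟩
  (reg s xᵣ + reg s yᵣ) * (reg s mᵣ + reg s mᵣ) ∸ reg s k′ᵣ ∎))
  where
  open ≡-Reasoning
  P : State → Set
  P t = reg t kᵣ ≡ (reg s xᵣ + reg s yᵣ) * (reg s mᵣ + reg s mᵣ) ∸ reg s k′ᵣ
  s₀ = ⟦ uncutRegs ⟧ s
  small : reg s₀ sᵣ ≤ reg s₀ mᵣ
  small = subst₂ _≤_ (sym (uncutRegs-s s)) (sym (frame uncutRegs s _)) x+y≤m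

keyCode-spec : ∀ s → reg s xᵣ + reg s yᵣ ≤ reg s mᵣ →
  reg (⟦ keyCode ⟧ s) kᵣ ≡ keyOf (reg s modeᵣ) (reg s mᵣ) (reg s xᵣ) (reg s yᵣ)
keyCode-spec s x+y≤m = ▹-intro P (branch-intro P
  (λ mode≡0 → begin
    reg (⟦ uncutTerm ⟧ s₁) kᵣ                              ≡⟨ uncutTerm-spec s₁ (subst₂ _≤_ (sym (cong₂ _+_ x≡ y≡)) (sym m≡) x+y≤m) ⟩
    (reg s₁ xᵣ + reg s₁ yᵣ) * (reg s₁ mᵣ + reg s₁ mᵣ) ∸ reg s₁ k′ᵣ ≡⟨ cong₂ _∸_ (cong₂ _*_ (cong₂ _+_ x≡ y≡) (cong₂ _+_ m≡ m≡)) (squareGap-spec s x+y≤m) ⟩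
    uncutKey (reg s mᵣ) (reg s xᵣ) (reg s yᵣ)              ≡⟨ cong (λ o → keyOf o (reg s mᵣ) (reg s xᵣ) (reg s yᵣ)) (trans (sym mode≡) mode≡0) ⟨
    keyOf (reg s modeᵣ) (reg s mᵣ) (reg s xᵣ) (reg s yᵣ)   ∎)
  (λ mode≢0 → begin
    reg (⟦ cutTerm ⟧ s₁) kᵣ                                ≡⟨ cutTerm-spec s₁ ⟩
    (reg s₁ mᵣ ∸ reg s₁ xᵣ ∸ reg s₁ yᵣ) * (reg s₁ mᵣ + reg s₁ mᵣ) + reg s₁ k′ᵣ ≡⟨ cong₂ _+_ (cong₂ _*_ (cong₂ _∸_ (cong₂ _∸_ m≡ x≡) y≡) (cong₂ _+_ m≡ m≡)) (squareGap-spec s x+y≤m) ⟩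
    cutKey (reg s mᵣ) (reg s xᵣ) (reg s yᵣ)                ≡⟨ cong (λ key → key (reg s mᵣ) (reg s xᵣ) (reg s yᵣ)) (keyOf-≢0 λ mode≡0 → mode≢0 (trans mode≡ mode≡0)) ⟨
    keyOf (reg s modeᵣ) (reg s mᵣ) (reg s xᵣ) (reg s yᵣ)   ∎))
  where
  open ≡-Reasoning
  P : State → Set
  P t = reg t kᵣ ≡ keyOf (reg s modeᵣ) (reg s mᵣ) (reg s xᵣ) (reg s yᵣ)
  s₁ = ⟦ squareGap ⟧ s
  x≡ : reg s₁ xᵣ ≡ reg s xᵣ
  x≡ = frame squareGap s _
  y≡ : reg s₁ yᵣ ≡ reg s yᵣ
  y≡ = frame squareGap s _
  m≡ : reg s₁ mᵣ ≡ reg s mᵣ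
  m≡ = frame squareGap s _
  mode≡ : reg s₁ modeᵣ ≡ reg s modeᵣ
  mode≡ = frame squareGap s _
  keyOf-≢0 : ∀ {o} → o ≢ 0 → keyOf o ≡ cutKey
  keyOf-≢0 {zero}  o≢0 = contradiction refl o≢0
  keyOf-≢0 {suc _} o≢0 = refl

opaque
  unfolding ⟦_⟧

  better-spec : ∀ s →
    (suc (reg s kᵣ) ≤ reg s bestᵣ × reg (⟦ better ⟧ s) bestᵣ ≡ reg s bestᵣ × reg (⟦ better ⟧ s) argᵣ ≡ reg s argᵣ)
    ⊎ (reg s bestᵣ < suc (reg s kᵣ) × reg (⟦ better ⟧ s) bestᵣ ≡ suc (reg s kᵣ) × reg (⟦ better ⟧ s) argᵣ ≡ reg s wᵣ)
  better-spec s with (reg s kᵣ + 1) ∸ reg s bestᵣ in eq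
  ... | zero  = inj₁ (≤-trans (≤-reflexive (+-comm 1 (reg s kᵣ))) (m∸n≡0⇒m≤n eq) , refl , refl)
  ... | suc _ = inj₂ (≤-trans (m∸n≢0⇒n<m (λ ≡0 → 1+n≢0 (trans (sym eq) ≡0))) (≤-reflexive (+-comm (reg s kᵣ) 1))
      , trans (+-identityʳ _) (+-comm (reg s kᵣ) 1) , +-identityʳ _)

-- One greedy phase: ranking all vertices

prelude guard rate select choose record-choice round capOther phase : Code
prelude = set tᵣ 1 ▹ plus iᵣ qᵣ tᵣ ▹ set bestᵣ 0 ▹ set argᵣ 0
guard = plus tᵣ loᵣ wᵣ ▹ get tᵣ tᵣ ▹ minus tᵣ tᵣ iᵣ
rate = evaluate ▹ keyCode
select = guard ▹ branch tᵣ nop (rate ▹ better)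
choose = prelude ▹ for wᵣ nᵣ select
record-choice = plus tᵣ loᵣ argᵣ ▹ put tᵣ iᵣ
round = choose ▹ record-choice
-- Ranks are at most n, so with threshold n the array at `hiᵣ` contributes no members while the one
-- at `loᵣ` is being filled.
capOther = set tᵣ 0 ▹ plus jᵣ nᵣ tᵣ
phase = capOther ▹ for qᵣ nᵣ round

update-≢ : ∀ f {i x} a → x ≢ i → (f [ i ↦ a ]) x ≡ f x
update-≢ f {i} {x} a x≢i with x ≡ᵇ i in eq
... | false = refl
... | true  = contradiction (≡ᵇ⇒≡ x i (subst T (sym eq) tt)) x≢i

opaque
  unfolding ⟦_⟧

  clear-x : ∀ s → reg (⟦ clear ⟧ s) xᵣ ≡ 0
  clear-x s = refl
  clear-y : ∀ s → reg (⟦ clear ⟧ s) yᵣ ≡ 0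
  clear-y s = refl
  prelude-i : ∀ s → reg (⟦ prelude ⟧ s) iᵣ ≡ suc (reg s qᵣ)
  prelude-i s = +-comm (reg s qᵣ) 1
  prelude-best : ∀ s → reg (⟦ prelude ⟧ s) bestᵣ ≡ 0
  prelude-best s = refl
  guard-t : ∀ s → reg (⟦ guard ⟧ s) tᵣ ≡ mem s (reg s loᵣ + reg s wᵣ) ∸ reg s iᵣ
  guard-t s = refl
  record-choice-mem : ∀ s → mem (⟦ record-choice ⟧ s) ≡ mem s [ reg s loᵣ + reg s argᵣ ↦ reg s iᵣ ]
  record-choice-mem s = refl
  capOther-j : ∀ s → reg (⟦ capOther ⟧ s) jᵣ ≡ reg s nᵣ
  capOther-j s = +-identityʳ _

module Run (n m : ℕ) (src tgt : ℕ → ℕ)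
  (src< : ∀ e → e < m → src e < n) (tgt< : ∀ e → e < m → tgt e < n)
  (src≢tgt : ∀ e → e < m → src e ≢ tgt e) where

  open Chains n m src tgt src< tgt< src≢tgt public

  inputSize : ℕ
  inputSize = 2 + (m + m)

  record Env (s : State) : Set where
    field
      n≡   : reg s nᵣ ≡ n
      m≡   : reg s mᵣ ≡ m
      src≡ : ∀ e → e < m → mem s (e + 1 + (e + 1)) ≡ src e
      tgt≡ : ∀ e → e < m → mem s (e + 1 + (e + 1) + 1) ≡ tgt e

  env-same : ∀ {s t} → Env s → reg t nᵣ ≡ reg s nᵣ → reg t mᵣ ≡ reg s mᵣ → mem t ≡ mem s → Env t
  env-same env n≡′ m≡′ mem≡′ = record
    { n≡ = trans n≡′ n≡ ; m≡ = trans m≡′ m≡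
    ; src≡ = λ e e<m → trans (cong (λ μ → μ (e + 1 + (e + 1))) mem≡′) (src≡ e e<m)
    ; tgt≡ = λ e e<m → trans (cong (λ μ → μ (e + 1 + (e + 1) + 1)) mem≡′) (tgt≡ e e<m) }
    where open Env env

  evaluate-spec : ∀ s → Env s →
    reg (⟦ evaluate ⟧ s) xᵣ ≡ within (memberValue s) × reg (⟦ evaluate ⟧ s) yᵣ ≡ avoiding (memberValue s)
  evaluate-spec s env = ▹-intro (λ t → reg t xᵣ ≡ within χ × reg t yᵣ ≡ avoiding χ) (drop-zero (⟦ for eᵣ mᵣ edge ⟧ s₀)
    (for-rule eᵣ mᵣ edge s₀ P _
      ( cong₂ (λ a k → a + ∑ k f) (clear-x s) (trans (frame clear s _) m≡)
      , cong₂ (λ a k → a + ∑ k g) (clear-y s) (trans (frame clear s _) m≡))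
      step))
    where
    open Env env
    χ = memberValue s
    s₀ = ⟦ clear ⟧ s
    f g : ℕ → ℕ
    f e = both    (χ (src e)) (χ (tgt e))
    g e = neither (χ (src e)) (χ (tgt e))
    P : ℕ → State → Set
    P j t = reg t xᵣ + ∑ j f ≡ within χ × reg t yᵣ + ∑ j g ≡ avoiding χ
    drop-zero : ∀ t → P 0 t → reg t xᵣ ≡ within χ × reg t yᵣ ≡ avoiding χ
    drop-zero t (p , q) = trans (sym (+-identityʳ _)) p , trans (sym (+-identityʳ _)) q
    step : ∀ j t → j < reg s₀ mᵣ → Framed (for eᵣ mᵣ edge) s₀ t → P (suc j) t → P j (⟦ edge ⟧ (enter eᵣ j t))
    step j t j<m′ (fr , fm) (p , q) =
      trans (trans (cong (_+ ∑ j f) (trans (proj₁ ed) (cong (reg t xᵣ +_) (cong₂ both (χ≡ _) (χ≡ _)))))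
             (+-assoc (reg t xᵣ) (f j) (∑ j f))) p ,
      trans (trans (cong (_+ ∑ j g) (trans (proj₂ ed) (cong (reg t yᵣ +_) (cong₂ neither (χ≡ _) (χ≡ _)))))
             (+-assoc (reg t yᵣ) (g j) (∑ j g))) q
      where
      u = enter eᵣ j t
      j<m : j < m
      j<m = ≤-trans j<m′ (≤-reflexive (trans (frame clear s _) m≡))
      mem≡ : mem t ≡ mem s
      mem≡ = trans (fm _) (memory clear s _)
      χ≡ : ∀ v → memberValue u v ≡ χ v
      χ≡ = memberValue-same {s} {u} record
        { lo≡ = trans (fr loᵣ _) (frame clear s _) ; hi≡ = trans (fr hiᵣ _) (frame clear s _)
        ; i≡ = trans (fr iᵣ _) (frame clear s _) ; j≡ = trans (fr jᵣ _) (frame clear s _)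
        ; w≡ = trans (fr wᵣ _) (frame clear s _) ; mem≡ = mem≡ }
      ed = edge-spec u refl
        (trans (cong (λ μ → μ (j + 1 + (j + 1))) mem≡) (src≡ j j<m))
        (trans (cong (λ μ → μ (j + 1 + (j + 1) + 1)) mem≡) (tgt≡ j j<m))

  rate-spec : ∀ s → Env s → reg (⟦ rate ⟧ s) kᵣ ≡ score (keyOf (reg s modeᵣ) m) (memberValue s)
  rate-spec s env = ▹-intro (λ t → reg t kᵣ ≡ score (keyOf (reg s modeᵣ) m) χ)
    (trans (keyCode-spec s₁ small) (cong₂ (λ k xy → k (proj₁ xy) (proj₂ xy))
      (cong₂ keyOf (frame evaluate s _) m₁≡) (cong₂ _,_ (proj₁ ev) (proj₂ ev))))
    where
    open Env env
    χ = memberValue s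
    s₁ = ⟦ evaluate ⟧ s
    ev = evaluate-spec s env
    m₁≡ : reg s₁ mᵣ ≡ m
    m₁≡ = trans (frame evaluate s _) m≡
    small : reg s₁ xᵣ + reg s₁ yᵣ ≤ reg s₁ mᵣ
    small = subst₂ _≤_ (sym (cong₂ _+_ (proj₁ ev) (proj₂ ev))) (sym m₁≡) (within+avoiding≤size χ)

  module Choosing (s : State) (env : Env s) {o q : ℕ} (mode≡ : reg s modeᵣ ≡ o) (q≡ : reg s qᵣ ≡ q)
    (no-other : ∀ v → v < n → mem s (reg s hiᵣ + v) ∸ reg s jᵣ ≡ 0) where

    private
      A : ℕ → ℕ
      A = above (λ v → mem s (reg s loᵣ + v)) (suc q)

      sc : ℕ → ℕ
      sc v = score (keyOf o m) (A ⊕ v)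

      s₀ = ⟦ prelude ⟧ s

    -- The loop counter descends, so the candidates from `j` on are those already examined. The
    -- register `bestᵣ` holds a score plus 1, or 0 if none of them was free.
    BestFrom : ℕ → State → Set
    BestFrom j t = (∀ v → j ≤ v → v < n → A v ≡ 0 → suc (sc v) ≤ reg t bestᵣ)
      × (reg t bestᵣ ≡ 0 ⊎ (reg t bestᵣ ≡ suc (sc (reg t argᵣ)) × reg t argᵣ < n × A (reg t argᵣ) ≡ 0))

    BestFrom-same : ∀ {j} t u → reg u bestᵣ ≡ reg t bestᵣ → reg u argᵣ ≡ reg t argᵣ → BestFrom j t → BestFrom j u
    BestFrom-same t u best≡ arg≡ (p , inj₁ z) rewrite best≡ = p , inj₁ z
    BestFrom-same t u best≡ arg≡ (p , inj₂ z) rewrite best≡ | arg≡ = p , inj₂ z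

    try : ∀ j t → j < n → Framed (for wᵣ nᵣ select) s₀ t → BestFrom (suc j) t → BestFrom j (⟦ select ⟧ (enter wᵣ j t))
    try j t j<n (fr , fm) b@(p , arg) = ▹-intro (BestFrom j) (branch-intro (BestFrom j) candidate member-already)
      where
      u = enter wᵣ j t
      u₁ = ⟦ guard ⟧ u
      u₂ = ⟦ rate ⟧ u₁

      from-s : ∀ {r} → Fresh r (prelude ▹ for wᵣ nᵣ select) → reg t r ≡ reg s r
      from-s (f₁ , f₂) = trans (fr _ f₂) (frame prelude s f₁)

      mem≡ : mem t ≡ mem s
      mem≡ = trans (fm _) (memory prelude s _)

      i≡ : reg t iᵣ ≡ suc q
      i≡ = trans (fr iᵣ _) (trans (prelude-i s) (cong suc q≡))

      guard≡ : reg u₁ tᵣ ≡ A j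
      guard≡ = trans (guard-t u) (trans (cong₂ (λ μ l → μ (l + j) ∸ reg t iᵣ) mem≡ (from-s _))
        (cong (mem s (reg s loᵣ + j) ∸_) i≡))

      split : ∀ {v} → j ≤ v → v ≡ j ⊎ suc j ≤ v
      split j≤v with m≤n⇒m<n∨m≡n j≤v
      ... | inj₁ j<v  = inj₂ j<v
      ... | inj₂ refl = inj₁ refl

      member-already : reg u₁ tᵣ ≢ 0 → BestFrom j (⟦ nop ⟧ u₁)
      member-already t≢0 = BestFrom-same t (⟦ nop ⟧ u₁)
        (trans (frame nop u₁ _) (frame guard u _)) (trans (frame nop u₁ _) (frame guard u _)) (later , arg)
        where
        later : ∀ v → j ≤ v → v < n → A v ≡ 0 → suc (sc v) ≤ reg t bestᵣ
        later v j≤v v<n Av≡0 with split j≤v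
        ... | inj₁ refl = contradiction (trans guard≡ Av≡0) t≢0
        ... | inj₂ j<v  = p v j<v v<n Av≡0

      k≡ : reg u₂ kᵣ ≡ sc j
      k≡ = trans (rate-spec u₁ (env-same env (trans (frame guard u _) (from-s _)) (trans (frame guard u _) (from-s _))
                    (trans (memory guard u _) mem≡)))
        (trans (cong (λ o → score (keyOf o m) (memberValue u₁)) (trans (frame guard u _) (trans (from-s _) mode≡)))
          (score-cong (keyOf o m) λ v v<n → cong outside (trans
            (value-cong (trans (frame guard u _) (from-s _)) (trans (frame guard u _) (from-s _))
              (trans (frame guard u _) i≡) (trans (frame guard u _) (from-s _)) (frame guard u _)
              (trans (memory guard u _) mem≡) v)
            (cong (_+ δ v j) (trans (cong (A v +_) (no-other v v<n)) (+-identityʳ (A v)))))))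

      best≡ : reg u₂ bestᵣ ≡ reg t bestᵣ
      best≡ = trans (frame rate u₁ _) (frame guard u _)
      arg≡ : reg u₂ argᵣ ≡ reg t argᵣ
      arg≡ = trans (frame rate u₁ _) (frame guard u _)
      w≡ : reg u₂ wᵣ ≡ j
      w≡ = trans (frame rate u₁ _) (frame guard u _)

      candidate : reg u₁ tᵣ ≡ 0 → BestFrom j (⟦ rate ▹ better ⟧ u₁)
      candidate t≡0 = ▹-intro (BestFrom j) (outcome (better-spec u₂))
        where
        outcome : _ → BestFrom j (⟦ better ⟧ u₂)
        outcome (inj₁ (k<best , best′≡ , arg′≡)) =
          BestFrom-same t (⟦ better ⟧ u₂) (trans best′≡ best≡) (trans arg′≡ arg≡) (later , arg)
          where
          later : ∀ v → j ≤ v → v < n → A v ≡ 0 → suc (sc v) ≤ reg t bestᵣ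
          later v j≤v v<n Av≡0 with split j≤v
          ... | inj₁ refl = subst₂ (λ k b → suc k ≤ b) k≡ best≡ k<best
          ... | inj₂ j<v  = p v j<v v<n Av≡0
        outcome (inj₂ (best<k , best′≡ , arg′≡)) =
          (λ v j≤v v<n Av≡0 → ≤-trans (later v j≤v v<n Av≡0) (≤-reflexive (sym best″≡))) ,
          inj₂ (trans best″≡ (cong (λ a → suc (sc a)) (sym arg″≡)) , subst (_< n) (sym arg″≡) j<n ,
                subst (λ a → A a ≡ 0) (sym arg″≡) (trans (sym guard≡) t≡0))
          where
          best″≡ : reg (⟦ better ⟧ u₂) bestᵣ ≡ suc (sc j)
          best″≡ = trans best′≡ (cong suc k≡)
          arg″≡ : reg (⟦ better ⟧ u₂) argᵣ ≡ j
          arg″≡ = trans arg′≡ w≡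
          later : ∀ v → j ≤ v → v < n → A v ≡ 0 → suc (sc v) ≤ suc (sc j)
          later v j≤v v<n Av≡0 with split j≤v
          ... | inj₁ refl = ≤-refl
          ... | inj₂ j<v  = ≤-trans (p v j<v v<n Av≡0) (<⇒≤ (subst₂ (λ b k → b < suc k) best≡ k≡ best<k))

    chosen : ∃[ v ] v < n × A v ≡ 0 → let a = reg (⟦ choose ⟧ s) argᵣ in
      a < n × A a ≡ 0 × (∀ v → v < n → A v ≡ 0 → sc v ≤ sc a)
    chosen (v₀ , v₀<n , Av₀≡0) = ▹-intro
      (λ t → let a = reg t argᵣ in a < n × A a ≡ 0 × (∀ v → v < n → A v ≡ 0 → sc v ≤ sc a))
      (conclude (⟦ for wᵣ nᵣ select ⟧ s₀) (for-rule wᵣ nᵣ select s₀ BestFrom _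
        ((λ v n≤v v<n _ → contradiction (subst (_≤ v) n₀≡ n≤v) (<⇒≱ v<n)) , inj₁ (prelude-best s))
        λ j t j<n → try j t (subst (j <_) n₀≡ j<n)))
      where
      n₀≡ : reg s₀ nᵣ ≡ n
      n₀≡ = trans (frame prelude s _) (Env.n≡ env)
      conclude : ∀ t → BestFrom 0 t → let a = reg t argᵣ in
        a < n × A a ≡ 0 × (∀ v → v < n → A v ≡ 0 → sc v ≤ sc a)
      conclude t (p , inj₁ best≡0) = contradiction (subst (_ ≤_) best≡0 (p v₀ z≤n v₀<n Av₀≡0)) λ ()
      conclude t (p , inj₂ (best≡ , a<n , Aa≡0)) = a<n , Aa≡0 ,
        λ v v<n Av≡0 → ≤-pred (≤-trans (p v z≤n v<n Av≡0) (≤-reflexive best≡))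

    choose-i : reg (⟦ choose ⟧ s) iᵣ ≡ suc q
    choose-i = ▹-intro (λ t → reg t iᵣ ≡ suc q)
      (trans (frame (for wᵣ nᵣ select) s₀ _) (trans (prelude-i s) (cong suc q≡)))

  module Phase (s : State) (env : Env s) {lo hi o : ℕ}
    (lo≡ : reg s loᵣ ≡ lo) (hi≡ : reg s hiᵣ ≡ hi) (mode≡ : reg s modeᵣ ≡ o)
    (input≤lo : inputSize ≤ lo) (disjoint : ∀ v w → v < n → w < n → hi + v ≢ lo + w)
    (unranked : ∀ v → v < n → mem s (lo + v) ≡ 0) (bounded-other : ∀ v → v < n → mem s (hi + v) ≤ n) where

    Outside : ℕ → Set
    Outside x = ∀ v → v < n → x ≢ lo + v

    private
      s₀ = ⟦ capOther ⟧ s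

    -- The second component protects the input and the other ranking. The round with counter `j`
    -- gives out rank `suc j`, which matches the descending index of `Greedy`.
    Ranked : ℕ → State → Set
    Ranked j t = Greedy (keyOf o m) (λ v → mem t (lo + v)) j × (∀ x → Outside x → mem t x ≡ mem s x)

    below-input : ∀ {x} → x < inputSize → Outside x
    below-input x< v _ refl = <⇒≱ x< (≤-trans input≤lo (m≤m+n lo v))

    src-address : ∀ {e} → e < m → e + 1 + (e + 1) + 1 < inputSize
    src-address {e} e<m rewrite +-comm e 1 | +-comm (e + suc e) 1 = s≤s (s≤s (+-mono-≤ e<m e<m))

    env-outside : ∀ t → reg t nᵣ ≡ reg s nᵣ → reg t mᵣ ≡ reg s mᵣ → (∀ x → Outside x → mem t x ≡ mem s x) → Env t
    env-outside t n≡ m≡ outer = record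
      { n≡ = trans n≡ (Env.n≡ env) ; m≡ = trans m≡ (Env.m≡ env)
      ; src≡ = λ e e<m → trans (outer _ (below-input (≤-trans (s≤s (m≤m+n _ 1)) (src-address e<m)))) (Env.src≡ env e e<m)
      ; tgt≡ = λ e e<m → trans (outer _ (below-input (src-address e<m))) (Env.tgt≡ env e e<m) }

    round-step : ∀ j t → j < n → Framed (for qᵣ nᵣ round) s₀ t → Ranked (suc j) t → Ranked j (⟦ round ⟧ (enter qᵣ j t))
    round-step j t j<n (fr , _) (g , outer) = ▹-intro (Ranked j)
      ( greedy-step a j<n g a<n Aa≡0 maximal
          (trans (cong (λ μ → μ (lo + a)) mem≡) (update-same (mem u₁) (lo + a) (suc j)))
          (λ v v<n v≢a → trans (cong (λ μ → μ (lo + v)) mem≡)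
            (trans (update-≢ (mem u₁) (suc j) (λ eq → v≢a (+-cancelˡ-≡ lo v a eq))) (cong (λ μ → μ (lo + v)) mem₁≡)))
      , λ x out → trans (cong (λ μ → μ x) mem≡)
          (trans (update-≢ (mem u₁) (suc j) (out a a<n)) (trans (cong (λ μ → μ x) mem₁≡) (outer x out))) )
      where
      u = enter qᵣ j t
      u₁ = ⟦ choose ⟧ u
      a = reg u₁ argᵣ

      from-s : ∀ {r} → Fresh r (capOther ▹ for qᵣ nᵣ round) → reg t r ≡ reg s r
      from-s (f₁ , f₂) = trans (fr _ f₂) (frame capOther s f₁)

      env-u : Env u
      env-u = env-outside u (from-s _) (from-s _) outer

      lo-t : reg t loᵣ ≡ lo
      lo-t = trans (from-s _) lo≡

      no-other : ∀ v → v < n → mem t (reg t hiᵣ + v) ∸ reg t jᵣ ≡ 0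
      no-other v v<n = m≤n⇒m∸n≡0 (subst₂ _≤_
        (sym (trans (cong (λ h → mem t (h + v)) (trans (from-s _) hi≡)) (outer (hi + v) (λ w → disjoint v w v<n))))
        (sym (trans (fr jᵣ _) (trans (capOther-j s) (Env.n≡ env))))
        (bounded-other v v<n))

      module C = Choosing u env-u {o} {j} (trans (from-s _) mode≡) refl no-other

      free : ∃[ v ] v < n × above (λ v → mem t (lo + v)) (suc j) v ≡ 0
      -- Exactly `suc j` vertices lie outside the current set, so a candidate exists.
      free = ∑-positive⇒∃ n _ (≤-trans (s≤s z≤n) (≤-reflexive (sym (Greedy.missing≡ g (suc j) ≤-refl j<n))))

      Chosen : ℕ → Set
      Chosen l = let A = above (λ v → mem t (l + v)) (suc j) in
        a < n × A a ≡ 0 × (∀ v → v < n → A v ≡ 0 → score (keyOf o m) (A ⊕ v) ≤ score (keyOf o m) (A ⊕ a))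

      choice : Chosen lo
      choice = subst Chosen lo-t (C.chosen (subst
        (λ l → ∃[ v ] v < n × above (λ v → mem t (l + v)) (suc j) v ≡ 0) (sym lo-t) free))

      a<n = proj₁ choice
      Aa≡0 = proj₁ (proj₂ choice)
      maximal = proj₂ (proj₂ choice)

      mem₁≡ : mem u₁ ≡ mem t
      mem₁≡ = memory choose u _

      mem≡ : mem (⟦ record-choice ⟧ u₁) ≡ mem u₁ [ lo + a ↦ suc j ]
      mem≡ = trans (record-choice-mem u₁)
        (cong₂ (λ l i → mem u₁ [ l + a ↦ i ]) (trans (frame choose u _) lo-t) C.choose-i)

    ranked : Ranked 0 (⟦ phase ⟧ s)
    ranked = ▹-intro (Ranked 0) (for-rule qᵣ nᵣ round s₀ Ranked _
      (subst (λ k → Greedy (keyOf o m) _ k) (sym n₀≡)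
         (greedy-start (keyOf o m) _ λ v v<n → trans (cong (λ μ → μ (lo + v)) (memory capOther s _)) (unranked v v<n))
       , λ x _ → cong (λ μ → μ x) (memory capOther s _))
      λ j t j<n → round-step j t (subst (j <_) n₀≡ j<n))
      where
      n₀≡ : reg s₀ nᵣ ≡ n
      n₀≡ = trans (frame capOther s _) (Env.n≡ env)

-- The search for the best union, and the output

deviation better₂ trial reset search restore emit writeOut : Code
deviation = plus tᵣ xᵣ xᵣ ▹ plus tᵣ tᵣ tᵣ ▹ minus sᵣ tᵣ mᵣ ▹ minus uᵣ mᵣ tᵣ ▹ plus sᵣ sᵣ uᵣ ▹
  plus tᵣ yᵣ yᵣ ▹ plus tᵣ tᵣ tᵣ ▹ minus dᵣ tᵣ mᵣ ▹ minus uᵣ mᵣ tᵣ ▹ plus dᵣ dᵣ uᵣ ▹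
  minus tᵣ dᵣ sᵣ ▹ plus sᵣ sᵣ tᵣ ▹ plus kᵣ mᵣ mᵣ ▹ plus kᵣ kᵣ kᵣ ▹ minus kᵣ kᵣ sᵣ
better₂ = set tᵣ 1 ▹ plus kᵣ kᵣ tᵣ ▹ minus tᵣ kᵣ bestᵣ ▹
  branch tᵣ (set tᵣ 0 ▹ plus bestᵣ kᵣ tᵣ ▹ plus argᵣ iᵣ tᵣ ▹ plus arg′ᵣ jᵣ tᵣ) nop
trial = evaluate ▹ deviation ▹ better₂
-- The value n is no vertex, so with it in `wᵣ` the delta in `member` vanishes and no candidate is
-- added to the union.
reset = set tᵣ 0 ▹ plus wᵣ nᵣ tᵣ ▹ set bestᵣ 0 ▹ set argᵣ 0 ▹ set arg′ᵣ 0
search = reset ▹ for iᵣ n⁺ᵣ (for jᵣ n⁺ᵣ trial)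
restore = set tᵣ 0 ▹ plus iᵣ argᵣ tᵣ ▹ plus jᵣ arg′ᵣ tᵣ
emit = member bᵣ ▹ branch bᵣ (put vᵣ one) (put vᵣ bᵣ)
writeOut = restore ▹ for vᵣ nᵣ emit

-- The larger of |4x - m| and |4y - m|, as a + (b ∸ a) is the maximum of a and b.
discrepancy : ℕ → ℕ → ℕ → ℕ
discrepancy m x y = dist (x + x + (x + x)) m + (dist (y + y + (y + y)) m ∸ dist (x + x + (x + x)) m)

-- The complement in 4m turns the minimisation into a search for a maximum. By `discrepancy-bound`
-- the truncated subtraction loses nothing.
quality : ℕ → ℕ → ℕ → ℕ
quality m x y = (m + m + (m + m)) ∸ discrepancy m x y

fourfold : ∀ x → 4 * x ≡ x + x + (x + x)
fourfold x = trans (cong (λ t → x + (x + (x + t))) (+-identityʳ x)) (sym (+-assoc x x (x + x)))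

dist-≤ : ∀ {a b r} → a ≤ b + r → b ≤ a + r → dist a b ≤ r
dist-≤ {a} {b} {r} p q with ≤-total a b
... | inj₁ a≤b rewrite m≤n⇒m∸n≡0 a≤b = m≤n+o⇒m∸n≤o b a q
... | inj₂ b≤a rewrite m≤n⇒m∸n≡0 b≤a | +-identityʳ (a ∸ b) = m≤n+o⇒m∸n≤o a b p

dist-≤⁻¹ : ∀ {a b r} → dist a b ≤ r → a ≤ b + r × b ≤ a + r
dist-≤⁻¹ {a} {b} le =
  ≤-trans (m≤n+m∸n a b) (+-monoʳ-≤ b (≤-trans (m≤m+n (a ∸ b) (b ∸ a)) le)) ,
  ≤-trans (m≤n+m∸n b a) (+-monoʳ-≤ a (≤-trans (m≤n+m (b ∸ a) (a ∸ b)) le))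

-- Together with its converse below, this condenses the four inequalities for all values of d into
-- one number that does not depend on d.
near⇒discrepancy : ∀ {m d x y} → Near m d x y → discrepancy m x y ≤ 2 * d
near⇒discrepancy {m} {d} {x} {y} (near xl xs yl ys) = join
  (dist-≤ (subst (_≤ m + 2 * d) (fourfold x) xs) (subst (λ t → m ≤ t + 2 * d) (fourfold x) xl))
  (dist-≤ (subst (_≤ m + 2 * d) (fourfold y) ys) (subst (λ t → m ≤ t + 2 * d) (fourfold y) yl))
  where
  join : ∀ {a b c} → a ≤ c → b ≤ c → a + (b ∸ a) ≤ c
  join {a} {b} a≤c b≤c with ≤-total b a
  ... | inj₁ b≤a rewrite m≤n⇒m∸n≡0 b≤a | +-identityʳ a = a≤c
  ... | inj₂ a≤b rewrite m+[n∸m]≡n a≤b = b≤c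

discrepancy⇒near : ∀ {m d x y} → discrepancy m x y ≤ 2 * d → Near m d x y
discrepancy⇒near {m} {d} {x} {y} le
  with dist-≤⁻¹ {x + x + (x + x)} {m} (≤-trans (m≤m+n _ (dist (y + y + (y + y)) m ∸ dist (x + x + (x + x)) m)) le)
     | dist-≤⁻¹ {y + y + (y + y)} {m} (≤-trans (m≤n+m∸n _ (dist (x + x + (x + x)) m)) le)
... | xs , xl | ys , yl = near
  (subst (λ t → m ≤ t + 2 * d) (sym (fourfold x)) xl) (subst (_≤ m + 2 * d) (sym (fourfold x)) xs)
  (subst (λ t → m ≤ t + 2 * d) (sym (fourfold y)) yl) (subst (_≤ m + 2 * d) (sym (fourfold y)) ys)

discrepancy-bound : ∀ {m x y} → x + y ≤ m → discrepancy m x y ≤ m + m + (m + m)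
discrepancy-bound {m} {x} {y} x+y≤m = subst (discrepancy m x y ≤_) double
  -- Taking 2m for `d` makes the bound equal to 4m, and all four inequalities follow from x, y ≤ m.
  (near⇒discrepancy {m} {2 * m} {x} {y} (near (large x) (small x≤m) (large y) (small y≤m)))
  where
  x≤m = ≤-trans (m≤m+n x y) x+y≤m
  y≤m = ≤-trans (m≤n+m y x) x+y≤m
  double : 2 * (2 * m) ≡ m + m + (m + m)
  double = trans (sym (*-assoc 2 2 m)) (fourfold m)
  large : ∀ a → m ≤ 4 * a + 2 * (2 * m)
  large a = ≤-trans (≤-trans (m≤m+n m m) (m≤m+n (m + m) (m + m))) (≤-trans (≤-reflexive (sym double)) (m≤n+m _ (4 * a)))
  small : ∀ {a} → a ≤ m → 4 * a ≤ m + 2 * (2 * m)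
  small a≤m = ≤-trans (*-monoʳ-≤ 4 a≤m) (≤-trans (≤-reflexive (*-assoc 2 2 m)) (m≤n+m _ m))

∸-reflects-≤ : ∀ {a b c} → b ≤ c → c ∸ a ≤ c ∸ b → b ≤ a
∸-reflects-≤ {a} {b} {c} b≤c le = +-cancelʳ-≤ (c ∸ b) b a (begin
  b + (c ∸ b)  ≡⟨ m+[n∸m]≡n b≤c ⟩
  c            ≤⟨ m≤n+m∸n c a ⟩
  a + (c ∸ a)  ≤⟨ +-monoʳ-≤ a le ⟩
  a + (c ∸ b)  ∎)
  where open ≤-Reasoning

-- Here the unknown d is disposed of: a union of the best quality is near for every d for which some
-- union is.
near-transfer : ∀ {m d x y x′ y′} → Near m d x y → x′ + y′ ≤ m → quality m x y ≤ quality m x′ y′ → Near m d x′ y′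
near-transfer {m} {x′ = x′} {y′} nr small le = discrepancy⇒near
  (≤-trans (∸-reflects-≤ (discrepancy-bound {m} {x′} {y′} small) le) (near⇒discrepancy nr))

opaque
  unfolding ⟦_⟧

  deviation-k : ∀ s → reg (⟦ deviation ⟧ s) kᵣ ≡ quality (reg s mᵣ) (reg s xᵣ) (reg s yᵣ)
  deviation-k s = refl
  reset-w : ∀ s → reg (⟦ reset ⟧ s) wᵣ ≡ reg s nᵣ
  reset-w s = +-identityʳ _
  reset-best : ∀ s → reg (⟦ reset ⟧ s) bestᵣ ≡ 0
  reset-best s = refl
  restore-i : ∀ s → reg (⟦ restore ⟧ s) iᵣ ≡ reg s argᵣ
  restore-i s = +-identityʳ _
  restore-j : ∀ s → reg (⟦ restore ⟧ s) jᵣ ≡ reg s arg′ᵣ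
  restore-j s = +-identityʳ _
  put-mem : ∀ x y s → mem (⟦ put x y ⟧ s) ≡ mem s [ reg s x ↦ reg s y ]
  put-mem x y s = refl

  better₂-spec : ∀ s →
    (suc (reg s kᵣ) ≤ reg s bestᵣ × reg (⟦ better₂ ⟧ s) bestᵣ ≡ reg s bestᵣ
      × reg (⟦ better₂ ⟧ s) argᵣ ≡ reg s argᵣ × reg (⟦ better₂ ⟧ s) arg′ᵣ ≡ reg s arg′ᵣ)
    ⊎ (reg s bestᵣ < suc (reg s kᵣ) × reg (⟦ better₂ ⟧ s) bestᵣ ≡ suc (reg s kᵣ)
      × reg (⟦ better₂ ⟧ s) argᵣ ≡ reg s iᵣ × reg (⟦ better₂ ⟧ s) arg′ᵣ ≡ reg s jᵣ)
  better₂-spec s with (reg s kᵣ + 1) ∸ reg s bestᵣ in eq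
  ... | zero  = inj₁ (≤-trans (≤-reflexive (+-comm 1 (reg s kᵣ))) (m∸n≡0⇒m≤n eq) , refl , refl , refl)
  ... | suc _ = inj₂ (≤-trans (m∸n≢0⇒n<m (λ ≡0 → 1+n≢0 (trans (sym eq) ≡0))) (≤-reflexive (+-comm (reg s kᵣ) 1))
      , trans (+-identityʳ _) (+-comm (reg s kᵣ) 1) , +-identityʳ _ , +-identityʳ _)

module Finish (n m : ℕ) (src tgt : ℕ → ℕ)
  (src< : ∀ e → e < m → src e < n) (tgt< : ∀ e → e < m → tgt e < n)
  (src≢tgt : ∀ e → e < m → src e ≢ tgt e) where

  open Run n m src tgt src< tgt< src≢tgt public

  module Search (s : State) (env : Env s) (n⁺≡ : reg s n⁺ᵣ ≡ suc n) {lo hi : ℕ}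
    (lo≡ : reg s loᵣ ≡ lo) (hi≡ : reg s hiᵣ ≡ hi) where

    cell : ℕ → ℕ → (ℕ → ℕ)
    cell = union (λ v → mem s (lo + v)) (λ v → mem s (hi + v))

    worth : ℕ → ℕ → ℕ
    worth i j = quality m (within (cell i j)) (avoiding (cell i j))

    Best : (ℕ → ℕ → Set) → State → Set
    Best V t = (∀ i j → V i j → suc (worth i j) ≤ reg t bestᵣ)
      × (reg t bestᵣ ≡ 0 ⊎ reg t bestᵣ ≡ suc (worth (reg t argᵣ) (reg t arg′ᵣ)))

    record Ready (i j : ℕ) (u : State) : Set where
      field
        n≡′  : reg u nᵣ ≡ reg s nᵣ
        m≡′  : reg u mᵣ ≡ reg s mᵣ
        lo≡′ : reg u loᵣ ≡ reg s loᵣ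
        hi≡′ : reg u hiᵣ ≡ reg s hiᵣ
        w≡′  : reg u wᵣ ≡ n
        i≡′  : reg u iᵣ ≡ i
        j≡′  : reg u jᵣ ≡ j
        mem≡′ : mem u ≡ mem s

    try : ∀ (V V′ : ℕ → ℕ → Set) {i j} u → Ready i j u →
      (∀ a b → V′ a b → V a b ⊎ (a ≡ i × b ≡ j)) → Best V u → Best V′ (⟦ trial ⟧ u)
    try V V′ {i} {j} u ready split (p , arg) = ▹-intro (Best V′) (▹-intro (Best V′) (outcome (better₂-spec u₂)))
      where
      open Ready ready
      u₁ = ⟦ evaluate ⟧ u
      u₂ = ⟦ deviation ⟧ u₁

      from-u : ∀ {r} → Fresh r evaluate → Fresh r deviation → reg u₂ r ≡ reg u r
      from-u f₁ f₂ = trans (frame deviation u₁ f₂) (frame evaluate u f₁)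

      env-u : Env u
      env-u = env-same env n≡′ m≡′ mem≡′

      cell≈ : memberValue u ≈ cell i j
      cell≈ v v<n = cong outside (trans (value-cong (trans lo≡′ lo≡) (trans hi≡′ hi≡) i≡′ j≡′ w≡′ mem≡′ v)
        (trans (cong (cell i j v +_) (δ-≢ {v} {n} (<⇒≢ v<n))) (+-identityʳ _)))

      k≡ : reg u₂ kᵣ ≡ worth i j
      k≡ = begin
        reg u₂ kᵣ                                             ≡⟨ deviation-k u₁ ⟩
        quality (reg u₁ mᵣ) (reg u₁ xᵣ) (reg u₁ yᵣ)           ≡⟨ cong₂ (λ m xy → quality m (proj₁ xy) (proj₂ xy))
          (trans (frame evaluate u _) (Env.m≡ env-u))
          (cong₂ _,_ (trans (proj₁ (evaluate-spec u env-u)) (within-cong {memberValue u} {cell i j} cell≈))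
                     (trans (proj₂ (evaluate-spec u env-u)) (avoiding-cong {memberValue u} {cell i j} cell≈))) ⟩
        worth i j                                             ∎
        where open ≡-Reasoning

      outcome : _ → Best V′ (⟦ better₂ ⟧ u₂)
      outcome (inj₁ (k<best , best≡ , arg≡ , arg′≡)) =
        (λ a b v′ → ≤-trans (old a b v′) (≤-reflexive (sym best″≡))) ,
        arg-same arg
        where
        best″≡ : reg (⟦ better₂ ⟧ u₂) bestᵣ ≡ reg u bestᵣ
        best″≡ = trans best≡ (from-u _ _)
        old : ∀ a b → V′ a b → suc (worth a b) ≤ reg u bestᵣ
        old a b v′ with split a b v′
        ... | inj₁ v             = p a b v
        ... | inj₂ (refl , refl) = subst₂ (λ k b → suc k ≤ b) k≡ (from-u _ _) k<best
        arg-same : reg u bestᵣ ≡ 0 ⊎ reg u bestᵣ ≡ suc (worth (reg u argᵣ) (reg u arg′ᵣ)) → _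
        arg-same (inj₁ z) = inj₁ (trans best″≡ z)
        arg-same (inj₂ z) = inj₂ (trans best″≡ (trans z
          (cong₂ (λ a b → suc (worth a b)) (sym (trans arg≡ (from-u _ _))) (sym (trans arg′≡ (from-u _ _))))))
      outcome (inj₂ (best<k , best≡ , arg≡ , arg′≡)) =
        (λ a b v′ → ≤-trans (old a b v′) (≤-reflexive (sym best″≡))) ,
        inj₂ (trans best″≡ (cong₂ (λ a b → suc (worth a b))
          (sym (trans arg≡ (trans (from-u _ _) i≡′))) (sym (trans arg′≡ (trans (from-u _ _) j≡′)))))
        where
        best″≡ : reg (⟦ better₂ ⟧ u₂) bestᵣ ≡ suc (worth i j)
        best″≡ = trans best≡ (cong suc k≡)
        old : ∀ a b → V′ a b → suc (worth a b) ≤ suc (worth i j)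
        old a b v′ with split a b v′
        ... | inj₁ v             = ≤-trans (p a b v) (<⇒≤ (subst₂ (λ b k → b < suc k) (from-u _ _) k≡ best<k))
        ... | inj₂ (refl , refl) = ≤-refl

    private
      s₀ = ⟦ reset ⟧ s

    Rows : ℕ → ℕ → ℕ → Set
    Rows k i j = k ≤ i × i ≤ n × j ≤ n

    -- The cells examined in the middle of row `i₀`: all later rows, and this row from `k` on, since
    -- both loops descend. They run `suc n` times because thresholds go from 0 to n inclusive.
    Cells : ℕ → ℕ → ℕ → ℕ → Set
    Cells i₀ k i j = Rows (suc i₀) i j ⊎ (i ≡ i₀ × k ≤ j × j ≤ n)

    row : ∀ i₀ t → Framed (for iᵣ n⁺ᵣ (for jᵣ n⁺ᵣ trial)) s₀ t → Best (Rows (suc i₀)) t →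
      Best (Rows i₀) (⟦ for jᵣ n⁺ᵣ trial ⟧ (enter iᵣ i₀ t))
    row i₀ t (fr , fm) (p , arg) = forget (⟦ for jᵣ n⁺ᵣ trial ⟧ u) (for-rule jᵣ n⁺ᵣ trial u (λ k → Best (Cells i₀ k)) _
      (base , arg)
      λ j t′ _ (fr′ , fm′) b → try (Cells i₀ (suc j)) (Cells i₀ j) (enter jᵣ j t′) record
          { n≡′  = trans (fr′ nᵣ _) (trans (fr nᵣ _) (frame reset s _))
          ; m≡′  = trans (fr′ mᵣ _) (trans (fr mᵣ _) (frame reset s _))
          ; lo≡′ = trans (fr′ loᵣ _) (trans (fr loᵣ _) (frame reset s _))
          ; hi≡′ = trans (fr′ hiᵣ _) (trans (fr hiᵣ _) (frame reset s _))
          ; w≡′  = trans (fr′ wᵣ _) (trans (fr wᵣ _) (trans (reset-w s) (Env.n≡ env)))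
          ; i≡′  = fr′ iᵣ _
          ; j≡′  = refl
          ; mem≡′ = trans (fm′ _) (trans (fm _) (memory reset s _)) }
        (split j) b)
      where
      u = enter iᵣ i₀ t

      n⁺-u : reg u n⁺ᵣ ≡ suc n
      n⁺-u = trans (fr n⁺ᵣ _) (trans (frame reset s _) n⁺≡)

      base : ∀ i j → Cells i₀ (reg u n⁺ᵣ) i j → suc (worth i j) ≤ reg t bestᵣ
      base i j (inj₁ r) = p i j r
      base i j (inj₂ (_ , n⁺≤j , j≤n)) = contradiction (subst (_≤ j) n⁺-u n⁺≤j) (≤⇒≯ j≤n)

      split : ∀ j a b → Cells i₀ j a b → Cells i₀ (suc j) a b ⊎ (a ≡ i₀ × b ≡ j)
      split j a b (inj₁ r) = inj₁ (inj₁ r)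
      split j a b (inj₂ (a≡ , j≤b , b≤n)) with m≤n⇒m<n∨m≡n j≤b
      ... | inj₁ j<b = inj₁ (inj₂ (a≡ , j<b , b≤n))
      ... | inj₂ j≡b = inj₂ (a≡ , sym j≡b)

      forget : ∀ t → Best (Cells i₀ 0) t → Best (Rows i₀) t
      forget t (p , arg) = (λ i j r → p i j (enlarge r)) , arg
        where
        enlarge : ∀ {i j} → Rows i₀ i j → Cells i₀ 0 i j
        enlarge (i₀≤i , i≤n , j≤n) with m≤n⇒m<n∨m≡n i₀≤i
        ... | inj₁ i₀<i = inj₁ (i₀<i , i≤n , j≤n)
        ... | inj₂ i₀≡i = inj₂ (sym i₀≡i , z≤n , j≤n)

    optimal : let i* = reg (⟦ search ⟧ s) argᵣ ; j* = reg (⟦ search ⟧ s) arg′ᵣ in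
      ∀ i j → i ≤ n → j ≤ n → worth i j ≤ worth i* j*
    optimal = ▹-intro (λ t → ∀ i j → i ≤ n → j ≤ n → worth i j ≤ worth (reg t argᵣ) (reg t arg′ᵣ))
      (conclude (⟦ for iᵣ n⁺ᵣ (for jᵣ n⁺ᵣ trial) ⟧ s₀) (for-rule iᵣ n⁺ᵣ (for jᵣ n⁺ᵣ trial) s₀ (λ k → Best (Rows k)) _
        ( (λ i j → λ { (n⁺≤i , i≤n , _) → contradiction
            (subst (_≤ i) (trans (frame reset s _) n⁺≡) n⁺≤i) (≤⇒≯ i≤n) })
        , inj₁ (reset-best s))
        λ i t _ → row i t))
      where
      conclude : ∀ t → Best (Rows 0) t → ∀ i j → i ≤ n → j ≤ n → worth i j ≤ worth (reg t argᵣ) (reg t arg′ᵣ)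
      conclude t (p , inj₁ z) i j i≤n j≤n = contradiction (subst (_ ≤_) z (p i j (z≤n , i≤n , j≤n))) λ ()
      conclude t (p , inj₂ z) i j i≤n j≤n = ≤-pred (≤-trans (p i j (z≤n , i≤n , j≤n)) (≤-reflexive z))

  module Output (s : State) (n≡ : reg s nᵣ ≡ n) (w≡ : reg s wᵣ ≡ n) {lo hi : ℕ}
    (lo≡ : reg s loᵣ ≡ lo) (hi≡ : reg s hiᵣ ≡ hi) (n≤lo : n ≤ lo) (n≤hi : n ≤ hi) where

    selected : ℕ → ℕ
    selected = union (λ v → mem s (lo + v)) (λ v → mem s (hi + v)) (reg s argᵣ) (reg s arg′ᵣ)

    -- The output overwrites the input, but the rankings start at address n or later. The second
    -- component thus ensures that later membership tests still read the original ranks.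
    Written : ℕ → State → Set
    Written k t = (∀ v → k ≤ v → v < n → mem t v ≡ inside (selected v)) × (∀ x → n ≤ x → mem t x ≡ mem s x)

    private
      s₀ = ⟦ restore ⟧ s

    write-bit : ∀ k t → k < n → Framed (for vᵣ nᵣ emit) s₀ t → Written (suc k) t → Written k (⟦ emit ⟧ (enter vᵣ k t))
    write-bit k t k<n (fr , _) (done , rest) = ▹-intro (Written k) (branch-intro (Written k)
      (λ b≡0 → store-bit {⟦ put vᵣ bᵣ ⟧ u₁} (put-mem vᵣ bᵣ u₁) (trans b≡0 (cong inside (sym (trans (sym b≡) b≡0)))))
      (λ b≢0 → store-bit {⟦ put vᵣ one ⟧ u₁} (put-mem vᵣ one u₁) (trans (frame (member bᵣ) u _) (sym (inside-≢0 λ eq → b≢0 (trans b≡ eq))))))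
      where
      u = enter vᵣ k t
      u₁ = ⟦ member bᵣ ⟧ u

      b≡ : reg u₁ bᵣ ≡ selected k
      b≡ = trans (member-spec u refl) (trans
        (value-cong {μ = mem t} (trans (fr loᵣ _) (trans (frame restore s _) lo≡)) (trans (fr hiᵣ _) (trans (frame restore s _) hi≡))
          (trans (fr iᵣ _) (restore-i s)) (trans (fr jᵣ _) (restore-j s))
          (trans (fr wᵣ _) (trans (frame restore s _) w≡)) refl k)
        (trans (cong₂ _+_ (cong₂ (λ a b → (a ∸ reg s argᵣ) + (b ∸ reg s arg′ᵣ))
            (rest (lo + k) (≤-trans n≤lo (m≤m+n lo k))) (rest (hi + k) (≤-trans n≤hi (m≤m+n hi k))))
            (δ-≢ {k} {n} (<⇒≢ k<n)))
          (+-identityʳ _)))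

      inside-≢0 : ∀ {a} → a ≢ 0 → inside a ≡ 1
      inside-≢0 {zero}  a≢0 = contradiction refl a≢0
      inside-≢0 {suc _} _   = refl

      mem₁≡ : mem u₁ ≡ mem t
      mem₁≡ = memory (member bᵣ) u _

      store-bit : ∀ {t′ a} → mem t′ ≡ mem u₁ [ reg u₁ vᵣ ↦ a ] → a ≡ inside (selected k) → Written k t′
      store-bit {t′} {a} eq a≡ = bits , λ x n≤x → trans (cong (λ μ → μ x) mem′≡)
          (trans (update-≢ (mem t) a (λ { refl → <⇒≱ k<n n≤x })) (rest x n≤x))
        where
        mem′≡ : mem t′ ≡ mem t [ k ↦ a ]
        mem′≡ = trans eq (cong₂ (λ μ i → μ [ i ↦ a ]) mem₁≡ (frame (member bᵣ) u _))
        bits : ∀ v → k ≤ v → v < n → mem t′ v ≡ inside (selected v)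
        bits v k≤v v<n with m≤n⇒m<n∨m≡n k≤v
        ... | inj₁ k<v = trans (cong (λ μ → μ v) mem′≡)
                (trans (update-≢ (mem t) a (λ { refl → <-irrefl refl k<v })) (done v k<v v<n))
        ... | inj₂ refl = trans (cong (λ μ → μ v) mem′≡) (trans (update-same (mem t) k a) a≡)

    written : Written 0 (⟦ writeOut ⟧ s)
    written = ▹-intro (Written 0) (for-rule vᵣ nᵣ emit s₀ Written _
      ( (λ v n≤v v<n → contradiction (subst (_≤ v) n₀≡ n≤v) (<⇒≱ v<n))
      , λ x _ → cong (λ μ → μ x) (memory restore s _))
      λ k t k<n → write-bit k t (subst (k <_) n₀≡ k<n))
      where
      n₀≡ : reg s₀ nᵣ ≡ n
      n₀≡ = trans (frame restore s _) n≡

-- phase fills the array at lo, so the two arrays change places between the phases.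
setup layout₁ layout₂ main finish : Code
setup = set one 1 ▹ set tᵣ 0 ▹ get nᵣ tᵣ ▹ get mᵣ one ▹ plus n⁺ᵣ nᵣ one
layout₁ = set tᵣ 0 ▹ plus loᵣ lenᵣ tᵣ ▹ plus hiᵣ lenᵣ nᵣ ▹ set modeᵣ 0
layout₂ = set tᵣ 0 ▹ plus hiᵣ lenᵣ tᵣ ▹ plus loᵣ lenᵣ nᵣ ▹ set modeᵣ 1
main = layout₁ ▹ phase ▹ layout₂ ▹ phase ▹ search ▹ writeOut
finish = set tᵣ 0 ▹ plus lenᵣ nᵣ tᵣ

opaque
  unfolding ⟦_⟧

  setup-n : ∀ s → reg (⟦ setup ⟧ s) nᵣ ≡ mem s 0
  setup-n s = refl
  setup-m : ∀ s → reg (⟦ setup ⟧ s) mᵣ ≡ mem s 1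
  setup-m s = refl
  setup-n⁺ : ∀ s → reg (⟦ setup ⟧ s) n⁺ᵣ ≡ suc (mem s 0)
  setup-n⁺ s = +-comm (mem s 0) 1
  layout₁-lo : ∀ s → reg (⟦ layout₁ ⟧ s) loᵣ ≡ reg s lenᵣ
  layout₁-lo s = +-identityʳ _
  layout₁-hi : ∀ s → reg (⟦ layout₁ ⟧ s) hiᵣ ≡ reg s lenᵣ + reg s nᵣ
  layout₁-hi s = refl
  layout₁-mode : ∀ s → reg (⟦ layout₁ ⟧ s) modeᵣ ≡ 0
  layout₁-mode s = refl
  layout₂-hi : ∀ s → reg (⟦ layout₂ ⟧ s) hiᵣ ≡ reg s lenᵣ
  layout₂-hi s = +-identityʳ _
  layout₂-lo : ∀ s → reg (⟦ layout₂ ⟧ s) loᵣ ≡ reg s lenᵣ + reg s nᵣ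
  layout₂-lo s = refl
  layout₂-mode : ∀ s → reg (⟦ layout₂ ⟧ s) modeᵣ ≡ 1
  layout₂-mode s = refl
  finish-len : ∀ s → reg (⟦ finish ⟧ s) lenᵣ ≡ reg s nᵣ
  finish-len s = +-identityʳ _

module Main (n m : ℕ) (src tgt : ℕ → ℕ)
  (src< : ∀ e → e < m → src e < n) (tgt< : ∀ e → e < m → tgt e < n)
  (src≢tgt : ∀ e → e < m → src e ≢ tgt e) where

  open Finish n m src tgt src< tgt< src≢tgt public

  Solves : (ℕ → ℕ) → State → Set
  Solves χ t = (∀ v → v < n → mem t v ≡ inside (χ v))
    × (∀ d → (∀ v → v < n → deg v ≤ d) → Near m d (within χ) (avoiding χ))

  main-spec : ∀ s → Env s → reg s n⁺ᵣ ≡ suc n → reg s lenᵣ ≡ inputSize →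
    (∀ x → inputSize ≤ x → mem s x ≡ 0) → n ≤ inputSize → ∃[ χ ] Solves χ (⟦ main ⟧ s)
  main-spec s env n⁺≡ len≡ blank n≤ = χ ,
    ▹-intro (Solves χ) (▹-intro (Solves χ) (▹-intro (Solves χ) (▹-intro (Solves χ) (▹-intro (Solves χ)
      ((λ v v<n → proj₁ O.written v z≤n v<n) , balanced)))))
    where
    s₁ = ⟦ layout₁ ⟧ s
    s₂ = ⟦ phase ⟧ s₁
    s₃ = ⟦ layout₂ ⟧ s₂
    s₄ = ⟦ phase ⟧ s₃
    s₅ = ⟦ search ⟧ s₄

    to₂ : ∀ {r} → Fresh r (layout₁ ▹ phase) → reg s₂ r ≡ reg s r
    to₂ (f₁ , f₂) = trans (frame phase s₁ f₂) (frame layout₁ s f₁)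

    to₄ : ∀ {r} → Fresh r (layout₂ ▹ phase) → Fresh r (layout₁ ▹ phase) → reg s₄ r ≡ reg s r
    to₄ (f₃ , f₄) f = trans (frame phase s₃ f₄) (trans (frame layout₂ s₂ f₃) (to₂ f))

    ℓ = inputSize

    module P₁ = Phase s₁ (env-same env (frame layout₁ s _) (frame layout₁ s _) (memory layout₁ s _)) {ℓ} {ℓ + n} {0}
      (trans (layout₁-lo s) len≡) (trans (layout₁-hi s) (cong₂ _+_ len≡ (Env.n≡ env))) (layout₁-mode s) ≤-refl
      (λ v w _ w<n eq → <⇒≱ w<n (≤-trans (m≤m+n n v) (≤-reflexive (+-cancelˡ-≡ ℓ (n + v) w (trans (sym (+-assoc ℓ n v)) eq)))))
      (λ v _ → trans (cong (λ μ → μ (ℓ + v)) (memory layout₁ s _)) (blank _ (m≤m+n ℓ v)))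
      (λ v _ → ≤-trans (≤-reflexive (trans (cong (λ μ → μ (ℓ + n + v)) (memory layout₁ s _))
        (blank _ (≤-trans (m≤m+n ℓ n) (m≤m+n (ℓ + n) v))))) z≤n)

    greedy₁ = proj₁ P₁.ranked
    outer₁ = proj₂ P₁.ranked

    second-outside : ∀ v → P₁.Outside (ℓ + n + v)
    second-outside v w w<n eq =
      <⇒≱ w<n (≤-trans (m≤m+n n v) (≤-reflexive (+-cancelˡ-≡ ℓ (n + v) w (trans (sym (+-assoc ℓ n v)) eq))))

    env₃ : Env s₃
    env₃ = env-same (P₁.env-outside s₂ (frame phase s₁ _) (frame phase s₁ _) outer₁)
      (frame layout₂ s₂ _) (frame layout₂ s₂ _) (memory layout₂ s₂ _)

    module P₂ = Phase s₃ env₃ {ℓ + n} {ℓ} {1}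
      (trans (layout₂-lo s₂) (cong₂ _+_ (trans (to₂ _) len≡) (trans (to₂ _) (Env.n≡ env))))
      (trans (layout₂-hi s₂) (trans (to₂ _) len≡)) (layout₂-mode s₂) (m≤m+n ℓ n)
      (λ v w v<n _ eq → second-outside w v v<n (sym eq))
      (λ v _ → trans (cong (λ μ → μ (ℓ + n + v)) (memory layout₂ s₂ _))
        (trans (outer₁ _ (second-outside v)) (trans (cong (λ μ → μ (ℓ + n + v)) (memory layout₁ s _))
          (blank _ (≤-trans (m≤m+n ℓ n) (m≤m+n (ℓ + n) v))))))
      (λ v v<n → subst (λ μ → μ (ℓ + v) ≤ n) (sym (memory layout₂ s₂ _)) (Greedy.bounded greedy₁ v v<n))

    greedy₂ = proj₁ P₂.ranked
    outer₂ = proj₂ P₂.ranked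

    lo₄ : reg s₄ loᵣ ≡ ℓ + n
    lo₄ = trans (frame phase s₃ _) (trans (layout₂-lo s₂) (cong₂ _+_ (trans (to₂ _) len≡) (trans (to₂ _) (Env.n≡ env))))
    hi₄ : reg s₄ hiᵣ ≡ ℓ
    hi₄ = trans (frame phase s₃ _) (trans (layout₂-hi s₂) (trans (to₂ _) len≡))

    env₄ : Env s₄
    env₄ = P₂.env-outside s₄ (frame phase s₃ _) (frame phase s₃ _) outer₂

    module S = Search s₄ env₄ (trans (to₄ _ _) n⁺≡) {ℓ + n} {ℓ} lo₄ hi₄

    w₅ : reg s₅ wᵣ ≡ n
    w₅ = ▹-intro (λ t → reg t wᵣ ≡ n)
      (trans (frame (for iᵣ n⁺ᵣ (for jᵣ n⁺ᵣ trial)) (⟦ reset ⟧ s₄) _) (trans (reset-w s₄) (Env.n≡ env₄)))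

    module O = Output s₅ (trans (frame search s₄ _) (Env.n≡ env₄)) w₅ {ℓ + n} {ℓ}
      (trans (frame search s₄ _) lo₄) (trans (frame search s₄ _) hi₄) (≤-trans n≤ (m≤m+n ℓ n)) n≤

    χ : ℕ → ℕ
    χ = O.selected

    i* = reg s₅ argᵣ
    j* = reg s₅ arg′ᵣ

    grid : ℕ → ℕ → (ℕ → ℕ)
    grid = union (λ v → mem s₂ (ℓ + v)) (λ v → mem s₄ (ℓ + n + v))

    first-rank : ∀ v → v < n → mem s₄ (ℓ + v) ≡ mem s₂ (ℓ + v)
    first-rank v v<n = trans (outer₂ (ℓ + v) (λ w _ eq → second-outside w v v<n (sym eq)))
      (cong (λ μ → μ (ℓ + v)) (memory layout₂ s₂ _))

    -- After the second phase `loᵣ` points to the ranking of the cut chain, so the two indices of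
    -- the search come in the opposite order to those of `balanced-union`.
    flipped : ∀ i j → grid i j ≈ S.cell j i
    flipped i j v v<n = cong outside (trans (cong (λ a → (a ∸ i) + (mem s₄ (ℓ + n + v) ∸ j)) (sym (first-rank v v<n)))
      (+-comm (mem s₄ (ℓ + v) ∸ i) _))

    balanced : ∀ d → (∀ v → v < n → deg v ≤ d) → Near m d (within χ) (avoiding χ)
    balanced d deg≤d = let i , j , i≤n , j≤n , nr = balanced-union greedy₁ greedy₂ d deg≤d in transport i j i≤n j≤n nr
      where
      transport : ∀ i j → i ≤ n → j ≤ n → Near m d (within (grid i j)) (avoiding (grid i j)) → Near m d (within χ) (avoiding χ)
      transport i j i≤n j≤n nr = subst
        (λ μ → let A = union (λ v → μ (ℓ + n + v)) (λ v → μ (ℓ + v)) i* j* in Near m d (within A) (avoiding A))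
        (sym (memory search s₄ _))
        (near-transfer {x = within (S.cell j i)} {avoiding (S.cell j i)} {within (S.cell i* j*)} {avoiding (S.cell i* j*)}
          (subst₂ (Near m d) (within-cong {grid i j} {S.cell j i} (flipped i j)) (avoiding-cong {grid i j} {S.cell j i} (flipped i j)) nr)
          (within+avoiding≤size (S.cell i* j*)) (S.optimal j i j≤n i≤n))

-- Inputs, outputs and rational intervals

-- The operation `_/_` reduces to lowest terms. In unnormalised rationals, up to equivalence, the
-- inequality is a plain cross-multiplication.
fraction-≤ : ∀ a b c p q r → a * (suc q * suc r) ≤ (b * suc r + c * suc q) * suc p →
  ℤ.+ a / suc p ℚ.≤ ℤ.+ b / suc q ℚ.+ ℤ.+ c / suc r
fraction-≤ a b c p q r le = ℚₚ.toℚᵘ-cancel-≤ (begin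
  ℚ.toℚᵘ (ℤ.+ a / suc p)                             ≃⟨ ℚₚ.toℚᵘ-fromℚᵘ (mkℚᵘ (ℤ.+ a) p) ⟩
  mkℚᵘ (ℤ.+ a) p                                     ≤⟨ *≤* cross ⟩
  mkℚᵘ (ℤ.+ b) q ℚᵘ.+ mkℚᵘ (ℤ.+ c) r                   ≃⟨ ℚᵘₚ.+-cong (ℚₚ.toℚᵘ-fromℚᵘ (mkℚᵘ (ℤ.+ b) q)) (ℚₚ.toℚᵘ-fromℚᵘ (mkℚᵘ (ℤ.+ c) r)) ⟨
  ℚ.toℚᵘ (ℤ.+ b / suc q) ℚᵘ.+ ℚ.toℚᵘ (ℤ.+ c / suc r)   ≃⟨ ℚₚ.toℚᵘ-homo-+ (ℤ.+ b / suc q) (ℤ.+ c / suc r) ⟨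
  ℚ.toℚᵘ (ℤ.+ b / suc q ℚ.+ ℤ.+ c / suc r)             ∎)
  where
  open ℚᵘₚ.≤-Reasoning
  cross : ℤ.+ a ℤ.* ℤ.+ (suc q * suc r) ℤ.≤ (ℤ.+ b ℤ.* ℤ.+ suc r ℤ.+ ℤ.+ c ℤ.* ℤ.+ suc q) ℤ.* ℤ.+ suc p
  cross = subst₂ ℤ._≤_ (ℤₚ.pos-* a (suc q * suc r))
    (trans (ℤₚ.pos-* (b * suc r + c * suc q) (suc p))
      (cong (ℤ._* ℤ.+ suc p) (cong₂ ℤ._+_ (ℤₚ.pos-* b (suc r)) (ℤₚ.pos-* c (suc q)))))
    (ℤ.+≤+ le)

≤+⇒-≤ : ∀ p q r → p ℚ.≤ q ℚ.+ r → p ℚ.- r ℚ.≤ q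
≤+⇒-≤ p q r le = subst (p ℚ.- r ℚ.≤_)
  (trans (ℚₚ.+-assoc q r (ℚ.- r)) (trans (cong (q ℚ.+_) (ℚₚ.+-inverseʳ r)) (ℚₚ.+-identityʳ q)))
  (ℚₚ.+-monoˡ-≤ (ℚ.- r) le)

quarter-interval : ∀ m d k → m ≤ 4 * k + 2 * d → 4 * k ≤ m + 2 * d → k ∈[ ℤ.+ m / 4 ± ℤ.+ d / 2 ]
quarter-interval m d k lower upper =
  ≤+⇒-≤ (ℤ.+ m / 4) (ℤ.+ k / 1) (ℤ.+ d / 2) (fraction-≤ m k d 3 0 1 (begin
    m * (1 * 2)                  ≤⟨ *-monoˡ-≤ 2 lower ⟩
    (4 * k + 2 * d) * 2          ≡⟨ l k d ⟩
    (k * 2 + d * 1) * 4          ∎)) ,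
  fraction-≤ k m d 0 3 1 (begin
    k * (4 * 2)                  ≡⟨ u k ⟩
    (4 * k) * 2                  ≤⟨ *-monoˡ-≤ 2 upper ⟩
    (m + 2 * d) * 2              ≡⟨ u′ m d ⟩
    (m * 2 + d * 4) * 1          ∎)
  where
  open ≤-Reasoning
  l : ∀ k d → (4 * k + 2 * d) * 2 ≡ (k * 2 + d * 1) * 4
  l = solve-∀
  u : ∀ k → k * (4 * 2) ≡ (4 * k) * 2
  u = solve-∀
  u′ : ∀ m d → (m + 2 * d) * 2 ≡ (m * 2 + d * 4) * 1
  u′ = solve-∀

half-interval : ∀ m d k → m ≤ 2 * k + 2 * d → 2 * k ≤ m + 2 * d → k ∈[ ℤ.+ m / 2 ± ℤ.+ d / 1 ]
half-interval m d k lower upper =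
  ≤+⇒-≤ (ℤ.+ m / 2) (ℤ.+ k / 1) (ℤ.+ d / 1) (fraction-≤ m k d 1 0 0 (begin
    m * (1 * 1)                  ≡⟨ *-identityʳ m ⟩
    m                            ≤⟨ lower ⟩
    2 * k + 2 * d                ≡⟨ l k d ⟩
    (k * 1 + d * 1) * 2          ∎)) ,
  fraction-≤ k m d 0 1 0 (begin
    k * (2 * 1)                  ≡⟨ *-comm k 2 ⟩
    2 * k                        ≤⟨ upper ⟩
    m + 2 * d                    ≡⟨ u m d ⟩
    (m * 1 + d * 2) * 1          ∎)
  where
  open ≤-Reasoning
  l : ∀ k d → 2 * k + 2 * d ≡ (k * 1 + d * 1) * 2
  l = solve-∀
  u : ∀ m d → m + 2 * d ≡ (m * 1 + d * 2) * 1
  u = solve-∀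

-- As z = m - x - y, the two errors of at most d/2 add up to at most d.
near⇒across : ∀ {m d x y z} → x + y + z ≡ m → Near m d x y → m ≤ 2 * z + 2 * d × 2 * z ≤ m + 2 * d
near⇒across {m} {d} {x} {y} {z} refl (near xl xs yl ys) =
  *-cancelˡ-≤ 2 (+-cancelˡ-≤ (2 * m) _ _ (begin
    2 * m + 2 * m                              ≡⟨ e₁ x y z ⟩
    4 * x + 4 * y + 4 * z                      ≤⟨ +-monoˡ-≤ (4 * z) (+-mono-≤ xs ys) ⟩
    m + 2 * d + (m + 2 * d) + 4 * z            ≡⟨ e₂ m d z ⟩
    2 * m + 2 * (2 * z + 2 * d)                ∎)) ,
  *-cancelˡ-≤ 2 (+-cancelˡ-≤ (2 * m) _ _ (begin
    2 * m + 2 * (2 * z)                        ≡⟨ e₃ m z ⟩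
    m + m + 4 * z                              ≤⟨ +-monoˡ-≤ (4 * z) (+-mono-≤ xl yl) ⟩
    4 * x + 2 * d + (4 * y + 2 * d) + 4 * z    ≡⟨ e₄ x y z d ⟩
    2 * m + 2 * (m + 2 * d)                    ∎))
  where
  open ≤-Reasoning
  e₁ : ∀ x y z → 2 * (x + y + z) + 2 * (x + y + z) ≡ 4 * x + 4 * y + 4 * z
  e₁ = solve-∀
  e₂ : ∀ m d z → m + 2 * d + (m + 2 * d) + 4 * z ≡ 2 * m + 2 * (2 * z + 2 * d)
  e₂ = solve-∀
  e₃ : ∀ m z → 2 * m + 2 * (2 * z) ≡ m + m + 4 * z
  e₃ = solve-∀
  e₄ : ∀ x y z d → 4 * x + 2 * d + (4 * y + 2 * d) + 4 * z ≡ 2 * (x + y + z) + 2 * (x + y + z + 2 * d)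
  e₄ = solve-∀

-- Graphs as numbered sequences of edges

indicator : ∀ {ℓ} {P : Set ℓ} → Dec P → ℕ
indicator P? = if does P? then 1 else 0

endpoints : ∀ {n} → List (Fin n × Fin n) → ℕ → ℕ × ℕ
endpoints []             _       = 0 , 0
endpoints ((u , v) ∷ es) zero    = toℕ u , toℕ v
endpoints (e ∷ es)       (suc i) = endpoints es i

count : ∀ {n ℓ} {P : Fin n × Fin n → Set ℓ} (P? : Decidable P) (f : ℕ × ℕ → ℕ) →
  (∀ u v → f (toℕ u , toℕ v) ≡ indicator (P? (u , v))) →
  ∀ es → length (filter P? es) ≡ ∑ (length es) (λ e → f (endpoints es e))
count P? f f≡ []             = refl
count P? f f≡ ((u , v) ∷ es) = trans (step (count P? f f≡ es)) (sym (∑-head (length es) (λ e → f (endpoints ((u , v) ∷ es) e))))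
  where
  step : length (filter P? es) ≡ ∑ (length es) (λ e → f (endpoints es e)) →
    length (filter P? ((u , v) ∷ es)) ≡ f (toℕ u , toℕ v) + ∑ (length es) (λ e → f (endpoints es e))
  step ih rewrite f≡ u v with does (P? (u , v))
  ... | true  = cong suc ih
  ... | false = ih

endpoints-bound : ∀ {n} (es : List (Fin n × Fin n)) e → e < length es →
  proj₁ (endpoints es e) < n × proj₂ (endpoints es e) < n
endpoints-bound ((u , v) ∷ es) zero    _         = toℕ<n u , toℕ<n v
endpoints-bound (_ ∷ es)       (suc e) (s≤s e<m) = endpoints-bound es e e<m

endpoints-distinct : ∀ {n} {es : List (Fin n × Fin n)} → All (λ e → proj₁ e ≢ proj₂ e) es → ∀ e → e < length es →
  proj₁ (endpoints es e) ≢ proj₂ (endpoints es e)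
endpoints-distinct (u≢v ∷ _)  zero    _         eq = u≢v (toℕ-injective eq)
endpoints-distinct (_ ∷ rest) (suc e) (s≤s e<m) eq = endpoints-distinct rest e e<m eq

flatten : ∀ {n} → List (Fin n × Fin n) → List ℕ
flatten = concatMap (λ e → toℕ (proj₁ e) ∷ toℕ (proj₂ e) ∷ [])

length-flatten : ∀ {n} (es : List (Fin n × Fin n)) → length (flatten es) ≡ length es + length es
length-flatten []       = refl
length-flatten (e ∷ es) = cong suc (trans (cong suc (length-flatten es)) (sym (+-suc (length es) (length es))))

contents-flatten : ∀ {n} (es : List (Fin n × Fin n)) e →
  contents (flatten es) (e + e) ≡ proj₁ (endpoints es e) × contents (flatten es) (suc (e + e)) ≡ proj₂ (endpoints es e)
contents-flatten []             e       = refl , refl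
contents-flatten ((u , v) ∷ es) zero    = refl , refl
contents-flatten (_ ∷ es)       (suc e) rewrite +-suc e e = contents-flatten es e

contents-beyond : ∀ w x → length w ≤ x → contents w x ≡ 0
contents-beyond []      x       _         = refl
contents-beyond (a ∷ w) (suc x) (s≤s w≤x) = contents-beyond w x w≤x

indicator-δ : ∀ {n} (u v : Fin n) → δ (toℕ u) (toℕ v) ≡ indicator (u Fin.≟ v)
indicator-δ u v with u Fin.≟ v
... | yes refl = δ-refl (toℕ u)
... | no u≢v   = δ-≢ {toℕ u} {toℕ v} λ eq → u≢v (toℕ-injective eq)

nonzero : ℕ → Bool
nonzero zero    = false
nonzero (suc _) = true

side : ∀ n → (ℕ → ℕ) → Subset n
side n χ = tabulate λ v → nonzero (χ (toℕ v))

indicator-side : ∀ {n} χ (v : Fin n) → indicator (v ∈? side n χ) ≡ inside (χ (toℕ v))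
indicator-side {n} χ v with v ∈? side n χ | χ (toℕ v) in eq
... | yes _  | suc _ = refl
... | no _   | zero  = refl
... | yes v∈ | zero  = contradiction (trans (sym ([]=⇒lookup v∈)) (trans (lookup∘tabulate _ v) (cong nonzero eq))) λ ()
... | no v∉  | suc _ = contradiction (lookup⇒[]= v (side n χ) (trans (lookup∘tabulate _ v) (cong nonzero eq))) v∉

indicator-∁ : ∀ {n} χ (v : Fin n) → indicator (v ∈? ∁ (side n χ)) ≡ outside (χ (toℕ v))
indicator-∁ {n} χ v with v ∈? ∁ (side n χ) | v ∈? side n χ | indicator-side χ v
... | yes v∈∁ | yes v∈ | _  = contradiction v∈∁ (x∈p⇒x∉∁p v∈)
... | no v∉∁  | no v∉  | _  = contradiction (x∉p⇒x∈∁p v∉) v∉∁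
... | yes _   | no _   | eq = complement (χ (toℕ v)) eq
  where
  complement : ∀ a → 0 ≡ inside a → 1 ≡ outside a
  complement zero _ = refl
... | no _    | yes _  | eq = complement (χ (toℕ v)) eq
  where
  complement : ∀ a → 1 ≡ inside a → 0 ≡ outside a
  complement (suc _) _ = refl

encodeSide-side : ∀ n χ (f : ℕ → ℕ) → (∀ v → v < n → f v ≡ inside (χ v)) → applyUpTo f n ≡ encodeSide (side n χ)
encodeSide-side zero    χ f f≡ = refl
encodeSide-side (suc n) χ f f≡ = cong₂ _∷_ (trans (f≡ 0 (s≤s z≤n)) (bit (χ 0)))
  (encodeSide-side n (λ v → χ (suc v)) (λ v → f (suc v)) λ v v<n → f≡ (suc v) (s≤s v<n))
  where
  bit : ∀ a → inside a ≡ (if nonzero a then 1 else 0)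
  bit zero    = refl
  bit (suc _) = refl

indicator-× : ∀ {p q} {P : Set p} {Q : Set q} (P? : Dec P) (Q? : Dec Q) →
  indicator (P? ×-dec Q?) ≡ indicator P? * indicator Q?
indicator-× P? Q? with does P? | does Q?
... | true  | true  = refl
... | true  | false = refl
... | false | _     = refl

-- The combined decision computes to a Boolean expression in four membership bits; only four of
-- their combinations agree with the values of χ.
indicator-cut : ∀ {n} χ (u v : Fin n) →
  cut (χ (toℕ u)) (χ (toℕ v)) ≡
    indicator ((u ∈? side n χ) ×-dec (v ∈? ∁ (side n χ)) ⊎-dec (u ∈? ∁ (side n χ)) ×-dec (v ∈? side n χ))
indicator-cut {n} χ u v = combine
  (does (u ∈? side n χ)) (does (v ∈? side n χ)) (does (u ∈? ∁ (side n χ))) (does (v ∈? ∁ (side n χ)))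
  (χ (toℕ u)) (χ (toℕ v)) (indicator-side χ u) (indicator-side χ v) (indicator-∁ χ u) (indicator-∁ χ v)
  where
  bit : _ → ℕ
  bit b = if b then 1 else 0
  combine : ∀ u∈ v∈ u∉ v∉ a b → bit u∈ ≡ inside a → bit v∈ ≡ inside b → bit u∉ ≡ outside a → bit v∉ ≡ outside b →
    cut a b ≡ bit (u∈ ∧ v∉ ∨ u∉ ∧ v∈)
  combine true  true  false false (suc _) (suc _) _ _ _ _ = refl
  combine true  false false true  (suc _) zero    _ _ _ _ = refl
  combine false true  true  false zero    (suc _) _ _ _ _ = refl
  combine false false true  true  zero    zero    _ _ _ _ = refl

-- The whole algorithm: running time and correctness

algorithm : Code
algorithm = setup ▹ main ▹ finish

-- Only the middle part can be `Capped`, because `setup` and `finish` write the protected registers.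
-- Being straight-line code, they cost 5 and 2 steps.
wrapped-time : ∀ c {W} s → Capped c → Within {W} (⟦ setup ⟧ s) →
  time (setup ▹ c ▹ finish) s ≤ (7 + weight c) * suc W ^ depth c
wrapped-time c {W} s capped within = begin
  5 + (time c (⟦ setup ⟧ s) + 2)  ≡⟨ shift (time c (⟦ setup ⟧ s)) ⟩
  7 + time c (⟦ setup ⟧ s)        ≤⟨ +-mono-≤ (*-monoʳ-≤ 7 (m^n>0 (suc W) (depth c))) (time-bound c capped (⟦ setup ⟧ s) within) ⟩
  7 * V + weight c * V            ≡⟨ *-distribʳ-+ V 7 (weight c) ⟨
  (7 + weight c) * V              ∎
  where
  open ≤-Reasoning
  V = suc W ^ depth c
  shift : ∀ t → 5 + (t + 2) ≡ 7 + t
  shift = solve-∀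

module Instance (G : Multigraph) (loopless : Loopless G) (busy : NoIsolatedVertices G) where

  private
    n m : ℕ
    n = order G
    m = size G

    src tgt : ℕ → ℕ
    src e = proj₁ (endpoints (edges G) e)
    tgt e = proj₂ (endpoints (edges G) e)

  open Main n m src tgt
    (λ e e<m → proj₁ (endpoints-bound (edges G) e e<m)) (λ e e<m → proj₂ (endpoints-bound (edges G) e e<m))
    (endpoints-distinct loopless)

  degree≡deg : ∀ v → degree G v ≡ deg (toℕ v)
  degree≡deg v = trans
    (cong₂ _+_ (count (λ e → proj₁ e Fin.≟ v) (λ e → δ (proj₁ e) (toℕ v)) (λ u _ → indicator-δ u v) (edges G))
               (count (λ e → proj₂ e Fin.≟ v) (λ e → δ (proj₂ e) (toℕ v)) (λ _ u → indicator-δ u v) (edges G)))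
    (sym (∑-+ m _ _))

  deg≡degree : ∀ v (v<n : v < n) → deg v ≡ degree G (fromℕ< v<n)
  deg≡degree v v<n = trans (cong deg (sym (toℕ-fromℕ< v<n))) (sym (degree≡deg (fromℕ< v<n)))

  -- Every vertex has degree at least 1, and the degrees sum to 2m by `Averaging.degrees` for the
  -- empty set.
  order≤ : n ≤ m + m
  order≤ = begin
    n                                       ≡⟨ trans (∑-const n 1) (*-identityʳ n) ⟨
    ∑ n (λ _ → 1)                           ≤⟨ ∑-mono n (λ v v<n → subst (1 ≤_) (sym (trans (+-identityʳ _) (deg≡degree v v<n))) (busy (fromℕ< v<n))) ⟩
    ∑ n (λ v → 1 * deg v)                   ≡⟨ Averaging.degrees (λ _ → 0) ⟩
    ∑ m (λ _ → 2)                           ≡⟨ ∑-const m 2 ⟩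
    m * 2                                   ≡⟨ trans (*-comm m 2) (cong (m +_) (+-identityʳ m)) ⟩
    m + m                                   ∎
    where open ≤-Reasoning

  module _ (χ : ℕ → ℕ) where

    edgesWithin-side : edgesWithin G (side n χ) ≡ within χ
    edgesWithin-side = count _ (λ e → both (χ (proj₁ e)) (χ (proj₂ e)))
      (λ u v → trans (sym (cong₂ _*_ (indicator-side χ u) (indicator-side χ v)))
        (sym (indicator-× (u ∈? side n χ) (v ∈? side n χ)))) (edges G)

    edgesWithin-∁ : edgesWithin G (∁ (side n χ)) ≡ avoiding χ
    edgesWithin-∁ = count _ (λ e → neither (χ (proj₁ e)) (χ (proj₂ e)))
      (λ u v → trans (sym (cong₂ _*_ (indicator-∁ χ u) (indicator-∁ χ v)))
        (sym (indicator-× (u ∈? ∁ (side n χ)) (v ∈? ∁ (side n χ))))) (edges G)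

    edgesBetween-side : edgesBetween G (side n χ) (∁ (side n χ)) ≡ across χ
    edgesBetween-side = count _ (λ e → cut (χ (proj₁ e)) (χ (proj₂ e))) (indicator-cut χ) (edges G)

    near⇒balanced : ∀ {d} → Near m d (within χ) (avoiding χ) → Balanced G d (side n χ) (∁ (side n χ))
    near⇒balanced {d} nr@(near xl xs yl ys) =
      subst (_∈[ ℤ.+ m / 4 ± ℤ.+ d / 2 ]) (sym edgesWithin-side) (quarter-interval m d (within χ) xl xs) ,
      subst (_∈[ ℤ.+ m / 4 ± ℤ.+ d / 2 ]) (sym edgesWithin-∁) (quarter-interval m d (avoiding χ) yl ys) ,
      subst (_∈[ ℤ.+ m / 2 ± ℤ.+ d / 1 ]) (sym edgesBetween-side) (half-interval m d (across χ) (proj₁ cross) (proj₂ cross))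
      where cross = near⇒across (size-split χ) nr

  private
    word : List ℕ
    word = encodeGraph G

    s₀ s₁ s₂ : State
    s₀ = initial word
    s₁ = ⟦ setup ⟧ s₀
    s₂ = ⟦ main ⟧ s₁

  word-length : length word ≡ inputSize
  word-length = cong (2 +_) (length-flatten (edges G))

  edge-address : ∀ e → e + 1 + (e + 1) ≡ 2 + (e + e)
  edge-address = solve-∀

  env₁ : Env s₁
  env₁ = record
    { n≡ = setup-n s₀ ; m≡ = setup-m s₀
    ; src≡ = λ e _ → trans (cong (λ μ → μ (e + 1 + (e + 1))) (memory setup s₀ _))
        (trans (cong (contents word) (edge-address e)) (proj₁ (contents-flatten (edges G) e)))
    ; tgt≡ = λ e _ → trans (cong (λ μ → μ (e + 1 + (e + 1) + 1)) (memory setup s₀ _))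
        (trans (cong (contents word) (trans (cong (_+ 1) (edge-address e)) (+-comm (2 + (e + e)) 1))) (proj₂ (contents-flatten (edges G) e))) }

  solution : ∃[ χ ] Solves χ s₂
  solution = main-spec s₁ env₁ (setup-n⁺ s₀) (trans (frame setup s₀ _) word-length)
    (λ x ℓ≤x → trans (cong (λ μ → μ x) (memory setup s₀ _)) (contents-beyond word x (≤-trans (≤-reflexive word-length) ℓ≤x)))
    (≤-trans order≤ (m≤n+m (m + m) 2))

  correct : EncodesBalancedPartition G (output (⟦ algorithm ⟧ s₀))
  correct = ▹-intro P (▹-intro P
    ( side n χ , ∁ (side n χ) , (p∪∁p≡⊤ (side n χ) , ∩-inverseʳ (side n χ))
    , trans (cong₂ applyUpTo (memory finish s₂ _) (trans (finish-len s₂) (trans (frame main s₁ _) (setup-n s₀))))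
        (encodeSide-side n χ (mem s₂) (proj₁ (proj₂ solution)))
    , λ d deg≤d → near⇒balanced χ (proj₂ (proj₂ solution) d
        λ v v<n → ≤-trans (≤-reflexive (deg≡degree v v<n)) (deg≤d (fromℕ< v<n))) ))
    where
    P : State → Set
    P t = EncodesBalancedPartition G (output t)
    χ = proj₁ solution

  -- The four loop bounds are at most 2m + 2, the length of the input; for n and n + 1 this rests on
  -- `order≤`.
  bounds-small : Within {length word} s₁
  bounds-small {0} _ = ≤-reflexive (frame setup s₀ _)
  bounds-small {1} _ = ≤-trans (≤-reflexive (setup-n s₀)) (≤-trans order≤ (≤-trans (m≤n+m (m + m) 2) (≤-reflexive (sym word-length))))
  bounds-small {2} _ = ≤-trans (≤-reflexive (setup-m s₀)) (≤-trans (m≤m+n m m) (≤-trans (m≤n+m (m + m) 2) (≤-reflexive (sym word-length))))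
  bounds-small {3} _ = ≤-trans (≤-reflexive (setup-n⁺ s₀)) (≤-trans (s≤s order≤) (≤-trans (n≤1+n _) (≤-reflexive (sym word-length))))
  bounds-small {suc (suc (suc (suc _)))} (s≤s (s≤s (s≤s (s≤s ()))))

solvable : SolvableInPolynomialTime Admissible encodeGraph EncodesBalancedPartition
solvable = compile algorithm , 7 + weight main , depth main , λ G (loopless , busy) →
  let open Instance G loopless busy in
  ⟦ algorithm ⟧ (initial (encodeGraph G)) , time algorithm (initial (encodeGraph G)) ,
  simulate algorithm _ (initial (encodeGraph G)) ,
  wrapped-time main (initial (encodeGraph G)) _ (λ {k} → bounds-small {k}) , correct

theorem2 : ((G : Multigraph) (d : ℕ) → Loopless G → NoIsolatedVertices G → MaxDegreeAtMost G d →
    Σ[ A ∈ Subset (order G) ] Σ[ B ∈ Subset (order G) ] (IsPartition A B × Balanced G d A B))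
    × SolvableInPolynomialTime Admissible encodeGraph EncodesBalancedPartition
theorem2 = (λ G d loopless busy deg≤d →
    -- Existence is read off from the output of the algorithm, which is balanced for every valid d
    -- and hence for the given one.
    let A , B , partition , _ , balanced = Instance.correct G loopless busy in
    A , B , partition , balanced d deg≤d) ,
  solvable
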